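{- Let $n=2^k$ with $k\ge 1$, and let $Q_n=\langle a,b \mid a^{2n}=e,\ b^2=a^n,\ ab=ba^{ -1}\rangle$ be the generalized quaternion group of order $4n$. Let $\mathcal{P}(Q_{n}^{*})$ be its proper power graph (on $4n-1$ vertices). Then: (i) the distance Laplacian characteristic polynomial of $\mathcal{P}(Q_{n}^{*})$ is, up to the sign $(-1)^{4n-1}$, \[ x(x-4n+1)(x-6n+1)^{2n-3}(x-8n+5)^{n}(x-8n+3)^{n}; \] (ii) the Laplacian characteristic polynomial of $\mathcal{P}(Q_{n}^{*})$ is, up to the sign $(-1)^{4n-1}$, \[ x(x-3)^{n}(x-1)^{n}(x-4n+1)(x-2n+1)^{2n-3}. \] Equivalently, $\det(xI-D^L)$ and $\det(xI-L)$ equal these polynomials, respectively.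
   Context: The (undirected) power graph $\mathcal{P}(\mathcal{G})$ of a finite group $\mathcal{G}$ has vertex set $\mathcal{G}$, and two distinct elements $x,y$ are adjacent iff $y=x^{i}$ or $x=y^{j}$ for some positive integers $i,j$. The proper power graph $\mathcal{P}(\mathcal{G}^*)$ is the induced subgraph of $\mathcal{P}(\mathcal{G})$ on $\mathcal{G}\setminus\{e\}$, $e$ the identity. The Laplacian matrix is $L=\mathrm{Deg}-A$ ($A$ adjacency matrix, $\mathrm{Deg}$ diagonal degree matrix). For a connected graph with vertices $v_1,\dots,v_m$, $D=(d(v_i,v_j))$ is the distance matrix, $Tr(v_i)=\sum_j d(v_i,v_j)$, and the distance Laplacian matrix is $D^L=\mathrm{diag}(Tr(v_1),\dots,Tr(v_m))-D$. The paper defines the (distance) Laplacian characteristic polynomial as $\det(M-xI)$ for $M=L$ (resp. $D^L$). -}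

module Defs where

open import Data.Bool using (Bool; true; false; if_then_else_; _∧_; _∨_; not)
open import Data.Nat as ℕ using (ℕ; zero; suc; _∸_; _<ᵇ_; _≡ᵇ_)
open import Data.Nat.DivMod using (_%_)
open import Data.Fin using (Fin; toℕ; punchIn)
import Data.Fin as Fin
open import Data.Integer as ℤ using (ℤ; +_; -_; _-_)

sumFin : ∀ m → (Fin m → ℤ) → ℤ
sumFin zero    f = + 0
sumFin (suc m) f = f Fin.zero ℤ.+ sumFin m (λ j → f (Fin.suc j))

Matrix : ℕ → Set
Matrix m = Fin m → Fin m → ℤ

altSign : ℕ → ℤ
altSign zero          = + 1
altSign (suc zero)    = - (+ 1)
altSign (suc (suc i)) = altSign i

det : ∀ m → Matrix m → ℤ
det zero    M = + 1
det (suc m) M =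
  sumFin (suc m) (λ j → altSign (toℕ j) ℤ.* (M Fin.zero j ℤ.* det m (λ r c → M (Fin.suc r) (punchIn j c))))

subScalar : ∀ m → Matrix m → ℤ → Matrix m
subScalar m M x i j = if Fin.toℕ i ≡ᵇ Fin.toℕ j then M i j - x else M i j

b2z : Bool → ℤ
b2z true  = + 1
b2z false = + 0

degree : ∀ V → (Fin V → Fin V → Bool) → Fin V → ℤ
degree V adj i = sumFin V (λ j → b2z (adj i j))

laplacian : ∀ V → (Fin V → Fin V → Bool) → Matrix V
laplacian V adj i j =
  if Fin.toℕ i ≡ᵇ Fin.toℕ j then degree V adj i - b2z (adj i j) else - b2z (adj i j)

anyFin : ∀ m → (Fin m → Bool) → Bool
anyFin zero    p = false
anyFin (suc m) p = p Fin.zero ∨ anyFin m (λ j → p (Fin.suc j))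

reach : ∀ V → (Fin V → Fin V → Bool) → ℕ → Fin V → Fin V → Bool
reach V adj zero    u v = Fin.toℕ u ≡ᵇ Fin.toℕ v
reach V adj (suc s) u v =
  reach V adj s u v ∨ anyFin V (λ w → adj u w ∧ reach V adj s w v)

-- least s ∈ {t, t+1, …, t+fuel} with a walk of length ≤ s (or t+fuel if none)
firstReach : ∀ V → (Fin V → Fin V → Bool) → ℕ → ℕ → Fin V → Fin V → ℕ
firstReach V adj t zero       u v = t
firstReach V adj t (suc fuel) u v =
  if reach V adj t u v then t else firstReach V adj (suc t) fuel u v

-- graph distance d(u,v) = length of a shortest u–v walk
-- (a shortest walk has length < V in a connected graph on V vertices)
distance : ∀ V → (Fin V → Fin V → Bool) → Fin V → Fin V → ℕ
distance V adj u v = firstReach V adj 0 V u v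

distanceMatrix : ∀ V → (Fin V → Fin V → Bool) → Matrix V
distanceMatrix V adj i j = + distance V adj i j

transmission : ∀ V → (Fin V → Fin V → Bool) → Fin V → ℤ
transmission V adj i = sumFin V (λ j → distanceMatrix V adj i j)

distanceLaplacian : ∀ V → (Fin V → Fin V → Bool) → Matrix V
distanceLaplacian V adj i j =
  if Fin.toℕ i ≡ᵇ Fin.toℕ j then transmission V adj i - distanceMatrix V adj i j
  else - distanceMatrix V adj i j

-- Generalized quaternion group Q_n = ⟨a,b | a^{2n}=e, b^2=a^n, ab=ba^{-1}⟩,
-- of order 4n, in its standard normal form: every element is uniquely
-- a^i (code i) or a^i b (code 2n+i), 0 ≤ i < 2n.

_mod_ : ℕ → ℕ → ℕ
m mod N = m % suc (N ∸ 1)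

module Quaternion (n : ℕ) where
  N2 : ℕ
  N2 = 2 ℕ.* n

  expo : ℕ → ℕ
  expo c = if c <ᵇ N2 then c else c ∸ N2

  hasB : ℕ → Bool
  hasB c = not (c <ᵇ N2)

  enc : ℕ → Bool → ℕ
  enc i false = i mod N2
  enc i true  = N2 ℕ.+ (i mod N2)

  -- a^i a^j = a^{i+j};  a^i (a^j b) = a^{i+j} b;
  -- (a^i b) a^j = a^{i-j} b;  (a^i b)(a^j b) = a^{i-j} b^2 = a^{i-j+n}
  mul : ℕ → ℕ → ℕ
  mul x y with hasB x | hasB y
  ... | false | false = enc (expo x ℕ.+ expo y) false
  ... | false | true  = enc (expo x ℕ.+ expo y) true
  ... | true  | false = enc (expo x ℕ.+ (N2 ∸ expo y)) true
  ... | true  | true  = enc (expo x ℕ.+ (N2 ∸ expo y) ℕ.+ n) false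

  e : ℕ
  e = 0

  pow : ℕ → ℕ → ℕ
  pow x zero    = e
  pow x (suc m) = mul (pow x m) x

  -- y = x^i for some positive integer i; since x^{4n} = e it suffices
  -- to check 1 ≤ i ≤ 4n
  isPowerOf : ℕ → ℕ → Bool
  isPowerOf y x = anyFin (4 ℕ.* n) (λ i → y ≡ᵇ pow x (suc (toℕ i)))

  -- vertices of the proper power graph: Q_n ∖ {e}, 4n-1 of them;
  -- vertex j corresponds to the element with code j+1
  V : ℕ
  V = 4 ℕ.* n ∸ 1

  elt : Fin V → ℕ
  elt j = suc (toℕ j)

  adj : Fin V → Fin V → Bool
  adj u v = not (elt u ≡ᵇ elt v) ∧ (isPowerOf (elt v) (elt u) ∨ isPowerOf (elt u) (elt v))

  L : Matrix V
  L = laplacian V adj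

  DL : Matrix V
  DL = distanceLaplacian V adj

{-# OPTIONS --safe #-}
-- For n = 2ᵏ the proper power graph of Q_n consists of aⁿ, adjacent to every other
-- vertex, a clique on the other 2n - 2 powers of a (the subgroups of the cyclic 2-group ⟨a⟩ form
-- a chain), and the perfect matching aˢb — aˢ⁺ⁿb (aˢb generates {e, aˢb, aⁿ, aˢ⁺ⁿb}).  It has
-- diameter 2, so D^L = 2V·I - 2J - L with V = 4n - 1, and both polynomials come from
-- det(L - yI + βJ).  As the columns of L - yI sum to -y, replacing the row of aⁿ by the sum of
-- all rows extracts the factor Vβ - y and leaves L - yI with that row replaced by ones; row
-- operations make this matrix lower triangular with determinant
-- (V - y)(2n - 1 - y)^(2n-3)(3 - y)ⁿ(1 - y)ⁿ.
module Submission where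

open import Defs
open import Data.Bool using (Bool; true; false; T; if_then_else_; _∧_; _∨_; not)
open import Data.Bool.Properties using (∧-zeroʳ; ∧-identityʳ; ∨-zeroʳ; ∨-identityʳ; ∨-comm; not-injective)
open import Data.Nat as ℕ using (ℕ; zero; suc; _∸_; _^_; _<_; _≤_; _%_; _<ᵇ_; _≡ᵇ_; z≤n; s≤s)
import Data.Nat.Properties as ℕₚ
import Data.Nat.Tactic.RingSolver as ℕ-Solver
open import Data.Nat.DivMod using (m%n<n; m<n⇒m%n≡m; [m+kn]%n≡m%n; %-distribˡ-+; %-distribˡ-*; m%n%n≡m%n)
open import Data.Nat.Divisibility using (_∣_; divides; ∣-trans; ∣1⇒≡1; *-cancelˡ-∣)
open import Data.Nat.Coprimality using (Coprime; coprime-+; coprime-divisor)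
open import Data.Nat.GCD using (module Bézout; module GCD)
open import Data.Fin using (Fin; toℕ; fromℕ<; punchIn; punchOut)
import Data.Fin as Fin
import Data.Fin.Properties as Finₚ
open import Data.Empty using (⊥-elim)
open import Data.Product using (_×_; _,_; proj₁; proj₂; Σ)
open import Data.Sum using (_⊎_; inj₁; inj₂)
open import Function using (_∘_; id)
open import Relation.Binary.Definitions using (tri<; tri≈; tri>)
open import Relation.Binary.PropositionalEquality
open import Relation.Nullary using (yes; no)
open import Relation.Nullary.Decidable using (dec-true; dec-false)

open import Data.Integer as ℤ using (ℤ; +_; -[1+_]; -_; _+_; _-_; _*_)
import Data.Integer.Properties as ℤₚ
open import Data.Integer.Tactic.RingSolver using (solve-∀)
open import Algebra.Properties.Semiring.Sum ℤₚ.+-*-semiring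
  using (sum; sum-cong-≗; ∑-comm; sum-remove; ∑-distrib-+; *-distribˡ-sum)

≡ᵇ-true⇒≡ : ∀ {a b} → (a ≡ᵇ b) ≡ true → a ≡ b
≡ᵇ-true⇒≡ {a} {b} a≡ᵇb = ℕₚ.≡ᵇ⇒≡ a b (subst T (sym a≡ᵇb) _)

≡ᵇ-false⇒≢ : ∀ {a b} → (a ≡ᵇ b) ≡ false → a ≢ b
≡ᵇ-false⇒≢ {a} a≢ᵇb refl = subst T a≢ᵇb (ℕₚ.≡⇒≡ᵇ a a refl)

<ᵇ-true⇒< : ∀ {a b} → (a <ᵇ b) ≡ true → a ℕ.< b
<ᵇ-true⇒< {a} {b} a<ᵇb = ℕₚ.<ᵇ⇒< a b (subst T (sym a<ᵇb) _)

<ᵇ-false⇒≥ : ∀ {a b} → (a <ᵇ b) ≡ false → b ℕ.≤ a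
<ᵇ-false⇒≥ a≮ᵇb = ℕₚ.≮⇒≥ (λ a<b → subst T a≮ᵇb (ℕₚ.<⇒<ᵇ a<b))

≡ᵇ-comm : ∀ a b → (a ≡ᵇ b) ≡ (b ≡ᵇ a)
≡ᵇ-comm a b with a ℕₚ.≟ b
... | yes refl = refl
... | no a≢b   = trans (dec-false (a ℕₚ.≟ b) a≢b) (sym (dec-false (b ℕₚ.≟ a) (a≢b ∘ sym)))

δ : ℕ → ℕ → ℤ
δ a b = b2z (a ≡ᵇ b)

δ-refl : ∀ a → δ a a ≡ + 1
δ-refl a = cong b2z (dec-true (a ℕₚ.≟ a) refl)

δ-≢ : ∀ {a b} → a ≢ b → δ a b ≡ + 0
δ-≢ {a} {b} a≢b = cong b2z (dec-false (a ℕₚ.≟ b) a≢b)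

δ-sym : ∀ a b → δ a b ≡ δ b a
δ-sym a b = cong b2z (≡ᵇ-comm a b)

sumFin≡sum : ∀ m (f : Fin m → ℤ) → sumFin m f ≡ sum f
sumFin≡sum zero    f = refl
sumFin≡sum (suc m) f = cong (_+_ (f Fin.zero)) (sumFin≡sum m (f ∘ Fin.suc))

sum-neg : ∀ {m} (f : Fin m → ℤ) → sum (λ j → - f j) ≡ - sum f
sum-neg {zero}  f = refl
sum-neg {suc m} f = trans (cong (_+_ (- f Fin.zero)) (sum-neg (f ∘ Fin.suc)))
                          (sym (ℤₚ.neg-distrib-+ (f Fin.zero) (sum (f ∘ Fin.suc))))

sum-zero : ∀ {m} (f : Fin m → ℤ) → (∀ j → f j ≡ + 0) → sum f ≡ + 0
sum-zero {zero}  f f≡0 = refl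
sum-zero {suc m} f f≡0 = cong₂ _+_ (f≡0 Fin.zero) (sum-zero (f ∘ Fin.suc) (f≡0 ∘ Fin.suc))

sum-linear : ∀ {m} (a b : ℤ) (g h : Fin m → ℤ) {f : Fin m → ℤ} → (∀ j → f j ≡ a * g j + b * h j) →
             sum f ≡ a * sum g + b * sum h
sum-linear a b g h {f} f≡ = begin
  sum f                                      ≡⟨ sum-cong-≗ f≡ ⟩
  sum (λ j → a * g j + b * h j)              ≡⟨ ∑-distrib-+ (λ j → a * g j) (λ j → b * h j) ⟩
  sum (λ j → a * g j) + sum (λ j → b * h j)  ≡⟨ sym (cong₂ _+_ (*-distribˡ-sum a g) (*-distribˡ-sum b h)) ⟩
  a * sum g + b * sum h                      ∎
  where open ≡-Reasoning

sum-scale : ∀ {m} (a : ℤ) {f g : Fin m → ℤ} → (∀ j → f j ≡ a * g j) → sum f ≡ a * sum g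
sum-scale a {f} {g} f≡ = trans (sum-cong-≗ f≡) (sym (*-distribˡ-sum a g))

sum-δ : ∀ {m} (k : Fin m) (f : Fin m → ℤ) → sum (λ j → δ (toℕ j) (toℕ k) * f j) ≡ f k
sum-δ {suc m} Fin.zero    f =
  trans (cong₂ _+_ (ℤₚ.*-identityˡ (f Fin.zero)) (sum-zero (λ j → + 0 * f (Fin.suc j)) (λ _ → refl)))
        (ℤₚ.+-identityʳ (f Fin.zero))
sum-δ {suc m} (Fin.suc k) f = trans (ℤₚ.+-identityˡ _) (sum-δ k (f ∘ Fin.suc))

sum-const : ∀ m (β : ℤ) → sum {m} (λ _ → β) ≡ + m * β
sum-const zero    β = refl
sum-const (suc m) β = trans (cong (_+_ β) (sum-const m β)) (sym (ℤₚ.suc-* (+ m) β))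

sumBelow : ℕ → (ℕ → ℤ) → ℤ
sumBelow zero    f = + 0
sumBelow (suc m) f = f 0 + sumBelow m (f ∘ suc)

prodBelow : ℕ → (ℕ → ℤ) → ℤ
prodBelow zero    f = + 1
prodBelow (suc m) f = f 0 * prodBelow m (f ∘ suc)

sumBelow-cong : ∀ m {f g : ℕ → ℤ} → (∀ j → j ℕ.< m → f j ≡ g j) → sumBelow m f ≡ sumBelow m g
sumBelow-cong zero    f≡g = refl
sumBelow-cong (suc m) f≡g = cong₂ _+_ (f≡g 0 (ℕ.s≤s ℕ.z≤n)) (sumBelow-cong m (λ j j<m → f≡g (suc j) (ℕ.s≤s j<m)))

prodBelow-cong : ∀ m {f g : ℕ → ℤ} → (∀ j → j ℕ.< m → f j ≡ g j) → prodBelow m f ≡ prodBelow m g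
prodBelow-cong zero    f≡g = refl
prodBelow-cong (suc m) f≡g = cong₂ _*_ (f≡g 0 (ℕ.s≤s ℕ.z≤n)) (prodBelow-cong m (λ j j<m → f≡g (suc j) (ℕ.s≤s j<m)))

sumBelow-+ : ∀ a b (f : ℕ → ℤ) → sumBelow (a ℕ.+ b) f ≡ sumBelow a f + sumBelow b (f ∘ (a ℕ.+_))
sumBelow-+ zero    b f = sym (ℤₚ.+-identityˡ _)
sumBelow-+ (suc a) b f = trans (cong (_+_ (f 0)) (sumBelow-+ a b (f ∘ suc)))
                               (sym (ℤₚ.+-assoc (f 0) (sumBelow a (f ∘ suc)) (sumBelow b (λ d → f (suc (a ℕ.+ d))))))

prodBelow-+ : ∀ a b (f : ℕ → ℤ) → prodBelow (a ℕ.+ b) f ≡ prodBelow a f * prodBelow b (f ∘ (a ℕ.+_))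
prodBelow-+ zero    b f = sym (ℤₚ.*-identityˡ _)
prodBelow-+ (suc a) b f = trans (cong (_*_ (f 0)) (prodBelow-+ a b (f ∘ suc)))
                                (sym (ℤₚ.*-assoc (f 0) (prodBelow a (f ∘ suc)) (prodBelow b (λ d → f (suc (a ℕ.+ d))))))

sumBelow-const : ∀ m (c : ℤ) → sumBelow m (λ _ → c) ≡ + m * c
sumBelow-const zero    c = refl
sumBelow-const (suc m) c = trans (cong (_+_ c) (sumBelow-const m c)) (sym (ℤₚ.suc-* (+ m) c))

prodBelow-const : ∀ m (c : ℤ) → prodBelow m (λ _ → c) ≡ c ℤ.^ m
prodBelow-const zero    c = refl
prodBelow-const (suc m) c = cong (c *_) (prodBelow-const m c)

sumBelow-linear : ∀ m (a b : ℤ) (g h : ℕ → ℤ) {f : ℕ → ℤ} → (∀ j → j ℕ.< m → f j ≡ a * g j + b * h j) →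
                  sumBelow m f ≡ a * sumBelow m g + b * sumBelow m h
sumBelow-linear zero    a b g h f≡ = sym (cong₂ _+_ (ℤₚ.*-zeroʳ a) (ℤₚ.*-zeroʳ b))
sumBelow-linear (suc m) a b g h f≡ =
  trans (cong₂ _+_ (f≡ 0 (ℕ.s≤s ℕ.z≤n)) (sumBelow-linear m a b (g ∘ suc) (h ∘ suc) (λ j j<m → f≡ (suc j) (ℕ.s≤s j<m))))
        (regroup a b (g 0) (h 0) (sumBelow m (g ∘ suc)) (sumBelow m (h ∘ suc)))
  where
  regroup : ∀ a b g₀ h₀ G H → a * g₀ + b * h₀ + (a * G + b * H) ≡ a * (g₀ + G) + b * (h₀ + H)
  regroup = solve-∀

sumBelow-zero : ∀ m (f : ℕ → ℤ) → (∀ j → j ℕ.< m → f j ≡ + 0) → sumBelow m f ≡ + 0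
sumBelow-zero m f f≡0 = trans (sumBelow-cong m f≡0) (trans (sumBelow-const m (+ 0)) (ℤₚ.*-zeroʳ (+ m)))

sumBelow-δ : ∀ m a (f : ℕ → ℤ) → a ℕ.< m → sumBelow m (λ j → δ a j * f j) ≡ f a
sumBelow-δ (suc m) zero    f _ =
  trans (cong₂ _+_ (ℤₚ.*-identityˡ (f 0)) (sumBelow-zero m (λ j → + 0 * f (suc j)) (λ _ _ → refl))) (ℤₚ.+-identityʳ (f 0))
sumBelow-δ (suc m) (suc a) f (ℕ.s≤s a<m) = trans (ℤₚ.+-identityˡ _) (sumBelow-δ m a (f ∘ suc) a<m)

sumBelow-* : ∀ m (c : ℤ) (f : ℕ → ℤ) → sumBelow m (λ j → c * f j) ≡ c * sumBelow m f
sumBelow-* zero    c f = sym (ℤₚ.*-zeroʳ c)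
sumBelow-* (suc m) c f = trans (cong (_+_ (c * f 0)) (sumBelow-* m c (f ∘ suc)))
                               (sym (ℤₚ.*-distribˡ-+ c (f 0) (sumBelow m (f ∘ suc))))

sumBelow-distrib : ∀ m (f g : ℕ → ℤ) → sumBelow m (λ j → f j + g j) ≡ sumBelow m f + sumBelow m g
sumBelow-distrib m f g = trans (sumBelow-linear m (+ 1) (+ 1) f g (λ j _ → sym (cong₂ _+_ (ℤₚ.*-identityˡ (f j)) (ℤₚ.*-identityˡ (g j)))))
                               (cong₂ _+_ (ℤₚ.*-identityˡ (sumBelow m f)) (ℤₚ.*-identityˡ (sumBelow m g)))

-- Determinants

minor : ∀ {m} → Matrix (suc m) → Fin (suc m) → Matrix m
minor M j r c = M (Fin.suc r) (punchIn j c)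

cofactorTerm : ∀ {m} → Matrix (suc m) → Fin (suc m) → ℤ
cofactorTerm {m} M j = altSign (toℕ j) * (M Fin.zero j * det m (minor M j))

det-expand : ∀ {m} (M : Matrix (suc m)) → det (suc m) M ≡ sum (cofactorTerm M)
det-expand {m} M = sumFin≡sum (suc m) (cofactorTerm M)

det-cong : ∀ m {M N : Matrix m} → (∀ i k → M i k ≡ N i k) → det m M ≡ det m N
det-cong zero    M≡N = refl
det-cong (suc m) {M} {N} M≡N = begin
  det (suc m) M          ≡⟨ det-expand M ⟩
  sum (cofactorTerm M)   ≡⟨ sum-cong-≗ term≡ ⟩
  sum (cofactorTerm N)   ≡⟨ sym (det-expand N) ⟩
  det (suc m) N          ∎
  where
  open ≡-Reasoning
  term≡ : ∀ j → cofactorTerm M j ≡ cofactorTerm N j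
  term≡ j = cong₂ (λ a d → altSign (toℕ j) * (a * d)) (M≡N Fin.zero j)
                  (det-cong m (λ r c → M≡N (Fin.suc r) (punchIn j c)))

det-rowLinear : ∀ m (t : Fin m) (a b : ℤ) (M P Q : Matrix m) →
  (∀ i k → i ≢ t → P i k ≡ M i k) → (∀ i k → i ≢ t → Q i k ≡ M i k) →
  (∀ k → M t k ≡ a * P t k + b * Q t k) →
  det m M ≡ a * det m P + b * det m Q
det-rowLinear (suc m) t a b M P Q P≡M Q≡M Mₜ≡ = begin
  det (suc m) M                                          ≡⟨ det-expand M ⟩
  sum (cofactorTerm M)                                   ≡⟨ sum-linear a b (cofactorTerm P) (cofactorTerm Q) (term≡ t P≡M Q≡M Mₜ≡) ⟩
  a * sum (cofactorTerm P) + b * sum (cofactorTerm Q)    ≡⟨ sym (cong₂ (λ p q → a * p + b * q) (det-expand P) (det-expand Q)) ⟩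
  a * det (suc m) P + b * det (suc m) Q                  ∎
  where
  open ≡-Reasoning
  distrib₀ : ∀ a b s p q d → s * ((a * p + b * q) * d) ≡ a * (s * (p * d)) + b * (s * (q * d))
  distrib₀ = solve-∀
  distrib₁ : ∀ a b s x p q → s * (x * (a * p + b * q)) ≡ a * (s * (x * p)) + b * (s * (x * q))
  distrib₁ = solve-∀
  term≡ : ∀ t → (∀ i k → i ≢ t → P i k ≡ M i k) → (∀ i k → i ≢ t → Q i k ≡ M i k) →
          (∀ k → M t k ≡ a * P t k + b * Q t k) →
          ∀ j → cofactorTerm M j ≡ a * cofactorTerm P j + b * cofactorTerm Q j
  term≡ Fin.zero P≡M Q≡M Mₜ≡ j = begin
    s * (M Fin.zero j * d)
      ≡⟨ cong (λ x → s * (x * d)) (Mₜ≡ j) ⟩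
    s * ((a * P Fin.zero j + b * Q Fin.zero j) * d)
      ≡⟨ distrib₀ a b s (P Fin.zero j) (Q Fin.zero j) d ⟩
    a * (s * (P Fin.zero j * d)) + b * (s * (Q Fin.zero j * d))
      ≡⟨ cong₂ (λ p q → a * (s * (P Fin.zero j * p)) + b * (s * (Q Fin.zero j * q)))
               (det-cong m (λ r c → sym (P≡M (Fin.suc r) (punchIn j c) (λ ()))))
               (det-cong m (λ r c → sym (Q≡M (Fin.suc r) (punchIn j c) (λ ())))) ⟩
    a * cofactorTerm P j + b * cofactorTerm Q j ∎
    where
    s = altSign (toℕ j)
    d = det m (minor M j)
  term≡ (Fin.suc t) P≡M Q≡M Mₜ≡ j = begin
    s * (M Fin.zero j * det m (minor M j))
      ≡⟨ cong (λ d → s * (M Fin.zero j * d))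
              (det-rowLinear m t a b (minor M j) (minor P j) (minor Q j)
                 (λ i k i≢t → P≡M (Fin.suc i) (punchIn j k) (i≢t ∘ Finₚ.suc-injective))
                 (λ i k i≢t → Q≡M (Fin.suc i) (punchIn j k) (i≢t ∘ Finₚ.suc-injective))
                 (λ k → Mₜ≡ (punchIn j k))) ⟩
    s * (M Fin.zero j * (a * det m (minor P j) + b * det m (minor Q j)))
      ≡⟨ distrib₁ a b s (M Fin.zero j) (det m (minor P j)) (det m (minor Q j)) ⟩
    a * (s * (M Fin.zero j * det m (minor P j))) + b * (s * (M Fin.zero j * det m (minor Q j)))
      ≡⟨ cong₂ (λ p q → a * (s * (p * det m (minor P j))) + b * (s * (q * det m (minor Q j))))
               (sym (P≡M Fin.zero j (λ ()))) (sym (Q≡M Fin.zero j (λ ()))) ⟩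
    a * cofactorTerm P j + b * cofactorTerm Q j ∎
    where
    s = altSign (toℕ j)

det-scaleRows : ∀ m (c : ℕ → ℤ) (M N : Matrix m) → (∀ i k → N i k ≡ c (toℕ i) * M i k) →
                det m N ≡ prodBelow m c * det m M
det-scaleRows zero    c M N N≡cM = sym (ℤₚ.*-identityʳ (+ 1))
det-scaleRows (suc m) c M N N≡cM =
  trans (det-expand N) (trans (sum-scale (prodBelow (suc m) c) term≡) (cong (prodBelow (suc m) c *_) (sym (det-expand M))))
  where
  rearrange : ∀ s c₀ x p d → s * ((c₀ * x) * (p * d)) ≡ (c₀ * p) * (s * (x * d))
  rearrange = solve-∀
  term≡ : ∀ j → cofactorTerm N j ≡ prodBelow (suc m) c * cofactorTerm M j
  term≡ j = begin
    altSign (toℕ j) * (N Fin.zero j * det m (minor N j))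
      ≡⟨ cong₂ (λ x d → altSign (toℕ j) * (x * d)) (N≡cM Fin.zero j)
               (det-scaleRows m (c ∘ suc) (minor M j) (minor N j) (λ r k → N≡cM (Fin.suc r) (punchIn j k))) ⟩
    altSign (toℕ j) * ((c 0 * M Fin.zero j) * (prodBelow m (c ∘ suc) * det m (minor M j)))
      ≡⟨ rearrange (altSign (toℕ j)) (c 0) (M Fin.zero j) (prodBelow m (c ∘ suc)) (det m (minor M j)) ⟩
    prodBelow (suc m) c * cofactorTerm M j ∎
    where open ≡-Reasoning

altSign-suc : ∀ k → altSign (suc k) ≡ - altSign k
altSign-suc zero    = refl
altSign-suc (suc k) = trans (sym (ℤₚ.neg-involutive (altSign k))) (cong -_ (sym (altSign-suc k)))

toℕ-punchIn-< : ∀ {n} (i : Fin (suc n)) (c : Fin n) → toℕ c ℕ.< toℕ i → toℕ (punchIn i c) ≡ toℕ c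
toℕ-punchIn-< (Fin.suc i) Fin.zero    _          = refl
toℕ-punchIn-< (Fin.suc i) (Fin.suc c) (ℕ.s≤s c<i) = cong suc (toℕ-punchIn-< i c c<i)

toℕ-punchIn-≥ : ∀ {n} (i : Fin (suc n)) (c : Fin n) → toℕ i ℕ.≤ toℕ c → toℕ (punchIn i c) ≡ suc (toℕ c)
toℕ-punchIn-≥ Fin.zero    c       _          = refl
toℕ-punchIn-≥ (Fin.suc i) (Fin.suc c) (ℕ.s≤s i≤c) = cong suc (toℕ-punchIn-≥ i c i≤c)

toℕ-punchOut-< : ∀ {n} {i j : Fin (suc n)} (i≢j : i ≢ j) → toℕ j ℕ.< toℕ i → toℕ (punchOut i≢j) ≡ toℕ j
toℕ-punchOut-< {i = i} i≢j j<i with toℕ (punchOut i≢j) ℕₚ.<? toℕ i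
... | yes o<i = trans (sym (toℕ-punchIn-< i (punchOut i≢j) o<i)) (cong toℕ (Finₚ.punchIn-punchOut i≢j))
... | no o≮i  = ⊥-elim (ℕₚ.<-asym j<i (subst (toℕ i ℕ.<_) j≡ (ℕ.s≤s (ℕₚ.≮⇒≥ o≮i))))
  where j≡ = trans (sym (toℕ-punchIn-≥ i (punchOut i≢j) (ℕₚ.≮⇒≥ o≮i))) (cong toℕ (Finₚ.punchIn-punchOut i≢j))

toℕ-punchOut-> : ∀ {n} {i j : Fin (suc n)} (i≢j : i ≢ j) → toℕ i ℕ.< toℕ j → suc (toℕ (punchOut i≢j)) ≡ toℕ j
toℕ-punchOut-> {i = i} i≢j i<j with toℕ (punchOut i≢j) ℕₚ.<? toℕ i
... | yes o<i = ⊥-elim (ℕₚ.<-asym i<j (subst (ℕ._< toℕ i) j≡ o<i))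
  where j≡ = trans (sym (toℕ-punchIn-< i (punchOut i≢j) o<i)) (cong toℕ (Finₚ.punchIn-punchOut i≢j))
... | no o≮i  = trans (sym (toℕ-punchIn-≥ i (punchOut i≢j) (ℕₚ.≮⇒≥ o≮i))) (cong toℕ (Finₚ.punchIn-punchOut i≢j))

-- Deleting columns a and b in either order leaves the same columns.
punchIn-punchOut-comm : ∀ {m} {a b : Fin (suc (suc m))} (a≢b : a ≢ b) (b≢a : b ≢ a) → toℕ a ℕ.< toℕ b →
  ∀ c → punchIn a (punchIn (punchOut a≢b) c) ≡ punchIn b (punchIn (punchOut b≢a) c)
punchIn-punchOut-comm {a = a} {b} a≢b b≢a a<b c = Finₚ.toℕ-injective toℕ≡
  where
  l = toℕ (punchOut a≢b)
  suc-l≡b : suc l ≡ toℕ b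
  suc-l≡b = toℕ-punchOut-> a≢b a<b
  a′≡a : toℕ (punchOut b≢a) ≡ toℕ a
  a′≡a = toℕ-punchOut-< b≢a a<b
  a≤l : toℕ a ℕ.≤ l
  a≤l = ℕₚ.≤-pred (subst (toℕ a ℕ.<_) (sym suc-l≡b) a<b)
  below : ∀ {n} (i : Fin (suc n)) (x : Fin n) {v} → toℕ x ≡ v → v ℕ.< toℕ i → toℕ (punchIn i x) ≡ v
  below i x refl = toℕ-punchIn-< i x
  above : ∀ {n} (i : Fin (suc n)) (x : Fin n) {v} → toℕ x ≡ v → toℕ i ℕ.≤ v → toℕ (punchIn i x) ≡ suc v
  above i x refl = toℕ-punchIn-≥ i x
  toℕ≡ : toℕ (punchIn a (punchIn (punchOut a≢b) c)) ≡ toℕ (punchIn b (punchIn (punchOut b≢a) c))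
  toℕ≡ with toℕ c ℕₚ.<? toℕ a | toℕ c ℕₚ.<? l
  ... | yes c<a | _ =
    trans (below a _ (toℕ-punchIn-< (punchOut a≢b) c (ℕₚ.<-≤-trans c<a a≤l)) c<a)
          (sym (below b _ (toℕ-punchIn-< (punchOut b≢a) c (subst (toℕ c ℕ.<_) (sym a′≡a) c<a)) (ℕₚ.<-trans c<a a<b)))
  ... | no c≮a | yes c<l =
    trans (above a _ (toℕ-punchIn-< (punchOut a≢b) c c<l) (ℕₚ.≮⇒≥ c≮a))
          (sym (below b _ (toℕ-punchIn-≥ (punchOut b≢a) c (subst (ℕ._≤ toℕ c) (sym a′≡a) (ℕₚ.≮⇒≥ c≮a)))
                         (subst (suc (toℕ c) ℕ.<_) suc-l≡b (ℕ.s≤s c<l))))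
  ... | no c≮a | no c≮l =
    trans (above a _ (toℕ-punchIn-≥ (punchOut a≢b) c (ℕₚ.≮⇒≥ c≮l)) (ℕₚ.≤-trans a≤l (ℕₚ.m≤n⇒m≤1+n (ℕₚ.≮⇒≥ c≮l))))
          (sym (above b _ (toℕ-punchIn-≥ (punchOut b≢a) c (subst (ℕ._≤ toℕ c) (sym a′≡a) (ℕₚ.≮⇒≥ c≮a)))
                         (subst (ℕ._≤ suc (toℕ c)) suc-l≡b (ℕ.s≤s (ℕₚ.≮⇒≥ c≮l)))))

altSign-punchOut : ∀ {m} {a b : Fin (suc (suc m))} (a≢b : a ≢ b) (b≢a : b ≢ a) → toℕ a ℕ.< toℕ b →
  altSign (toℕ a) * altSign (toℕ (punchOut a≢b)) ≡ - (altSign (toℕ b) * altSign (toℕ (punchOut b≢a)))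
altSign-punchOut {a = a} {b} a≢b b≢a a<b
  rewrite toℕ-punchOut-< b≢a a<b | sym (toℕ-punchOut-> a≢b a<b) | altSign-suc (toℕ (punchOut a≢b)) =
  flip (altSign (toℕ a)) (altSign (toℕ (punchOut a≢b)))
  where
  flip : ∀ x y → x * y ≡ - (- y * x)
  flip = solve-∀

minor₂ : ∀ {m} → Matrix (suc (suc m)) → Fin (suc (suc m)) → Fin (suc m) → Matrix m
minor₂ M j l r c = M (Fin.suc (Fin.suc r)) (punchIn j (punchIn l c))

-- The term of the double expansion along rows 0 and 1 that uses columns a and b.
pairTerm : ∀ {m} → Matrix (suc (suc m)) → Fin (suc (suc m)) → Fin (suc (suc m)) → ℤ
pairTerm {m} M a b with a Finₚ.≟ b
... | yes _  = + 0
... | no a≢b = altSign (toℕ a) * altSign (toℕ (punchOut a≢b)) * M Fin.zero a * M (Fin.suc Fin.zero) b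
               * det m (minor₂ M a (punchOut a≢b))

pairTerm-diag : ∀ {m} (M : Matrix (suc (suc m))) a → pairTerm M a a ≡ + 0
pairTerm-diag M a with a Finₚ.≟ a
... | yes _  = refl
... | no a≢a = ⊥-elim (a≢a refl)

pairTerm-punchIn : ∀ {m} (M : Matrix (suc (suc m))) j l →
  pairTerm M j (punchIn j l) ≡
  altSign (toℕ j) * altSign (toℕ l) * M Fin.zero j * M (Fin.suc Fin.zero) (punchIn j l) * det m (minor₂ M j l)
pairTerm-punchIn {m} M j l with j Finₚ.≟ punchIn j l
... | yes j≡ = ⊥-elim (Finₚ.punchInᵢ≢i j l (sym j≡))
... | no j≢ = cong (λ x → altSign (toℕ j) * altSign (toℕ x) * M Fin.zero j * M (Fin.suc Fin.zero) (punchIn j l) * det m (minor₂ M j x))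
                   (trans (Finₚ.punchOut-cong j refl) (Finₚ.punchOut-punchIn j))

det-expandPairs : ∀ {m} (M : Matrix (suc (suc m))) → det (suc (suc m)) M ≡ sum (λ a → sum (pairTerm M a))
det-expandPairs {m} M = trans (det-expand M) (sum-cong-≗ row≡)
  where
  open ≡-Reasoning
  regroup : ∀ s a t b d → s * (a * (t * (b * d))) ≡ s * t * a * b * d
  regroup = solve-∀
  row≡ : ∀ j → cofactorTerm M j ≡ sum (pairTerm M j)
  row≡ j = begin
    altSign (toℕ j) * (M Fin.zero j * det (suc m) (minor M j))
      ≡⟨ cong (λ d → altSign (toℕ j) * (M Fin.zero j * d)) (det-expand (minor M j)) ⟩
    altSign (toℕ j) * (M Fin.zero j * sum (cofactorTerm (minor M j)))
      ≡⟨ trans (cong (s *_) (*-distribˡ-sum (M Fin.zero j) (cofactorTerm (minor M j))))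
               (*-distribˡ-sum s (λ l → M Fin.zero j * cofactorTerm (minor M j) l)) ⟩
    sum (λ l → s * (M Fin.zero j * cofactorTerm (minor M j) l))
      ≡⟨ sum-cong-≗ (λ l → trans (regroup s (M Fin.zero j) (altSign (toℕ l)) (M (Fin.suc Fin.zero) (punchIn j l)) (det m (minor₂ M j l)))
                                 (sym (pairTerm-punchIn M j l))) ⟩
    sum (λ l → pairTerm M j (punchIn j l))
      ≡⟨ sym (ℤₚ.+-identityˡ _) ⟩
    + 0 + sum (λ l → pairTerm M j (punchIn j l))
      ≡⟨ cong (_+ sum (λ l → pairTerm M j (punchIn j l))) (sym (pairTerm-diag M j)) ⟩
    pairTerm M j j + sum (λ l → pairTerm M j (punchIn j l))
      ≡⟨ sym (sum-remove (pairTerm M j)) ⟩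
    sum (pairTerm M j) ∎
    where s = altSign (toℕ j)

pairTerm-swap : ∀ {m} (M N : Matrix (suc (suc m))) →
  (∀ k → N Fin.zero k ≡ M (Fin.suc Fin.zero) k) → (∀ k → N (Fin.suc Fin.zero) k ≡ M Fin.zero k) →
  (∀ r k → N (Fin.suc (Fin.suc r)) k ≡ M (Fin.suc (Fin.suc r)) k) →
  ∀ a b → pairTerm N a b ≡ - pairTerm M b a
pairTerm-swap {m} M N N₀ N₁ N₂ a b with a Finₚ.≟ b | b Finₚ.≟ a
... | yes _    | yes _    = refl
... | yes a≡b  | no b≢a   = ⊥-elim (b≢a (sym a≡b))
... | no a≢b   | yes b≡a  = ⊥-elim (a≢b (sym b≡a))
... | no a≢b   | no b≢a   = begin
  σ₁ * N Fin.zero a * N (Fin.suc Fin.zero) b * det m (minor₂ N a (punchOut a≢b))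
    ≡⟨ cong₂ (λ x y → σ₁ * x * y * det m (minor₂ N a (punchOut a≢b))) (N₀ a) (N₁ b) ⟩
  σ₁ * M (Fin.suc Fin.zero) a * M Fin.zero b * det m (minor₂ N a (punchOut a≢b))
    ≡⟨ cong₂ (λ s d → s * M (Fin.suc Fin.zero) a * M Fin.zero b * d) σ₁≡-σ₂
             (det-cong m (λ r c → trans (N₂ r _) (cong (M (Fin.suc (Fin.suc r))) (columns≡ c)))) ⟩
  - σ₂ * M (Fin.suc Fin.zero) a * M Fin.zero b * det m (minor₂ M b (punchOut b≢a))
    ≡⟨ swap σ₂ (M (Fin.suc Fin.zero) a) (M Fin.zero b) (det m (minor₂ M b (punchOut b≢a))) ⟩
  - (σ₂ * M Fin.zero b * M (Fin.suc Fin.zero) a * det m (minor₂ M b (punchOut b≢a))) ∎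
  where
  open ≡-Reasoning
  σ₁ = altSign (toℕ a) * altSign (toℕ (punchOut a≢b))
  σ₂ = altSign (toℕ b) * altSign (toℕ (punchOut b≢a))
  swap : ∀ s x y d → (- s) * x * y * d ≡ - (s * y * x * d)
  swap = solve-∀
  negate : ∀ {x y : ℤ} → x ≡ - y → y ≡ - x
  negate {x} {y} x≡-y = trans (sym (ℤₚ.neg-involutive y)) (cong -_ (sym x≡-y))
  σ₁≡-σ₂ : σ₁ ≡ - σ₂
  σ₁≡-σ₂ with ℕₚ.<-cmp (toℕ a) (toℕ b)
  ... | tri< a<b _ _ = altSign-punchOut a≢b b≢a a<b
  ... | tri≈ _ a≡b _ = ⊥-elim (a≢b (Finₚ.toℕ-injective a≡b))
  ... | tri> _ _ b<a = negate (altSign-punchOut b≢a a≢b b<a)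
  columns≡ : ∀ c → punchIn a (punchIn (punchOut a≢b) c) ≡ punchIn b (punchIn (punchOut b≢a) c)
  columns≡ c with ℕₚ.<-cmp (toℕ a) (toℕ b)
  ... | tri< a<b _ _ = punchIn-punchOut-comm a≢b b≢a a<b c
  ... | tri≈ _ a≡b _ = ⊥-elim (a≢b (Finₚ.toℕ-injective a≡b))
  ... | tri> _ _ b<a = sym (punchIn-punchOut-comm b≢a a≢b b<a c)

det-swap₀₁ : ∀ m (M N : Matrix (suc (suc m))) →
  (∀ k → N Fin.zero k ≡ M (Fin.suc Fin.zero) k) → (∀ k → N (Fin.suc Fin.zero) k ≡ M Fin.zero k) →
  (∀ r k → N (Fin.suc (Fin.suc r)) k ≡ M (Fin.suc (Fin.suc r)) k) →
  det (suc (suc m)) N ≡ - det (suc (suc m)) M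
det-swap₀₁ m M N N₀ N₁ N₂ = begin
  det (suc (suc m)) N                        ≡⟨ det-expandPairs N ⟩
  sum (λ a → sum (λ b → pairTerm N a b))     ≡⟨ sum-cong-≗ (λ a → sum-cong-≗ (pairTerm-swap M N N₀ N₁ N₂ a)) ⟩
  sum (λ a → sum (λ b → - pairTerm M b a))   ≡⟨ sum-cong-≗ (λ a → sum-neg (λ b → pairTerm M b a)) ⟩
  sum (λ a → - sum (λ b → pairTerm M b a))   ≡⟨ sum-neg (λ a → sum (λ b → pairTerm M b a)) ⟩
  - sum (λ a → sum (λ b → pairTerm M b a))   ≡⟨ cong -_ (∑-comm (λ a b → pairTerm M b a)) ⟩
  - sum (λ b → sum (λ a → pairTerm M b a))   ≡⟨ cong -_ (sym (det-expandPairs M)) ⟩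
  - det (suc (suc m)) M                      ∎
  where open ≡-Reasoning

x≡-x⇒x≡0 : ∀ {x : ℤ} → x ≡ - x → x ≡ + 0
x≡-x⇒x≡0 {+ zero}    _  = refl
x≡-x⇒x≡0 {+ suc n}   ()
x≡-x⇒x≡0 { -[1+ n ]} ()

private
  EqualRowsVanish : ℕ → Set
  EqualRowsVanish m = ∀ (M : Matrix m) {s t} → s ≢ t → (∀ k → M s k ≡ M t k) → det m M ≡ + 0

  laterRowsEqual : ∀ m → EqualRowsVanish m → ∀ (M : Matrix (suc m)) {s t} → s ≢ t →
                   (∀ k → M (Fin.suc s) k ≡ M (Fin.suc t) k) → det (suc m) M ≡ + 0
  laterRowsEqual m vanish M s≢t M≡ = trans (det-expand M) (sum-zero (cofactorTerm M) term≡0)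
    where
    term≡0 : ∀ j → cofactorTerm M j ≡ + 0
    term≡0 j = begin
      altSign (toℕ j) * (M Fin.zero j * det m (minor M j))  ≡⟨ cong (λ d → altSign (toℕ j) * (M Fin.zero j * d))
                                                                  (vanish (minor M j) s≢t (M≡ ∘ punchIn j)) ⟩
      altSign (toℕ j) * (M Fin.zero j * + 0)                ≡⟨ cong (altSign (toℕ j) *_) (ℤₚ.*-zeroʳ (M Fin.zero j)) ⟩
      altSign (toℕ j) * + 0                             ≡⟨ ℤₚ.*-zeroʳ (altSign (toℕ j)) ⟩
      + 0                                               ∎
      where open ≡-Reasoning

  swapRows₀₁ : ∀ {m} → Matrix (suc (suc m)) → Matrix (suc (suc m))
  swapRows₀₁ M Fin.zero             = M (Fin.suc Fin.zero)
  swapRows₀₁ M (Fin.suc Fin.zero)       = M Fin.zero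
  swapRows₀₁ M (Fin.suc (Fin.suc r))    = M (Fin.suc (Fin.suc r))

  firstRowRepeated : ∀ m → EqualRowsVanish m → ∀ (M : Matrix (suc m)) t →
                     (∀ k → M Fin.zero k ≡ M (Fin.suc t) k) → det (suc m) M ≡ + 0
  firstRowRepeated (suc m) vanish M Fin.zero    M≡ = x≡-x⇒x≡0 (det-swap₀₁ m M M M≡ (sym ∘ M≡) (λ _ _ → refl))
  firstRowRepeated (suc m) vanish M (Fin.suc t) M≡ = begin
    det (suc (suc m)) M                      ≡⟨ sym (ℤₚ.neg-involutive _) ⟩
    - - det (suc (suc m)) M                  ≡⟨ cong -_ (sym (det-swap₀₁ m M (swapRows₀₁ M) (λ _ → refl) (λ _ → refl) (λ _ _ → refl))) ⟩
    - det (suc (suc m)) (swapRows₀₁ M)       ≡⟨ cong -_ (laterRowsEqual (suc m) vanish (swapRows₀₁ M) {Fin.zero} {Fin.suc t} (λ ()) M≡) ⟩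
    + 0                                      ∎
    where open ≡-Reasoning

det-equalRows : ∀ m (M : Matrix m) {s t} → s ≢ t → (∀ k → M s k ≡ M t k) → det m M ≡ + 0
det-equalRows (suc m) M {Fin.zero}  {Fin.zero}  s≢t _  = ⊥-elim (s≢t refl)
det-equalRows (suc m) M {Fin.zero}  {Fin.suc t} _   M≡ = firstRowRepeated m (det-equalRows m) M t M≡
det-equalRows (suc m) M {Fin.suc s} {Fin.zero}  _   M≡ = firstRowRepeated m (det-equalRows m) M s (sym ∘ M≡)
det-equalRows (suc m) M {Fin.suc s} {Fin.suc t} s≢t M≡ = laterRowsEqual m (det-equalRows m) M (s≢t ∘ cong Fin.suc) M≡

updateRow : ∀ {m} → Matrix m → Fin m → (Fin m → ℤ) → Matrix m
updateRow M t r i with i Finₚ.≟ t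
... | yes _ = r
... | no _  = M i

updateRow-≡ : ∀ {m} (M : Matrix m) t r k → updateRow M t r t k ≡ r k
updateRow-≡ M t r k with t Finₚ.≟ t
... | yes _   = refl
... | no t≢t  = ⊥-elim (t≢t refl)

updateRow-≢ : ∀ {m} (M : Matrix m) t r {i} k → i ≢ t → updateRow M t r i k ≡ M i k
updateRow-≢ M t r {i} k i≢t with i Finₚ.≟ t
... | yes i≡t = ⊥-elim (i≢t i≡t)
... | no _    = refl

det-addToRow : ∀ m (M N : Matrix m) (t : Fin m) {p} (g : Fin p → Fin m) (c : Fin p → ℤ) →
  (∀ j → g j ≡ t → c j ≡ + 0) →
  (∀ i k → i ≢ t → N i k ≡ M i k) →
  (∀ k → N t k ≡ M t k + sum (λ j → c j * M (g j) k)) →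
  det m N ≡ det m M
det-addToRow m M N t {zero} g c _ N≡M Nₜ≡ = det-cong m N≡M′
  where
  N≡M′ : ∀ i k → N i k ≡ M i k
  N≡M′ i k with i Finₚ.≟ t
  ... | yes refl = trans (Nₜ≡ k) (ℤₚ.+-identityʳ (M i k))
  ... | no i≢t   = N≡M i k i≢t
det-addToRow m M N t {suc p} g c cₜ≡0 N≡M Nₜ≡ = begin
  det m N                          ≡⟨ det-rowLinear m t (+ 1) (c Fin.zero) N N′ E
                                        (λ i k i≢t → trans (updateRow-≢ M t _ k i≢t) (sym (N≡M i k i≢t)))
                                        (λ i k i≢t → trans (updateRow-≢ M t _ k i≢t) (sym (N≡M i k i≢t)))
                                        Nₜ≡′ ⟩
  + 1 * det m N′ + c Fin.zero * det m E ≡⟨ cong₂ _+_ (trans (ℤₚ.*-identityˡ _) det-N′) c₀E≡0 ⟩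
  det m M + + 0                    ≡⟨ ℤₚ.+-identityʳ (det m M) ⟩
  det m M                          ∎
  where
  open ≡-Reasoning
  rest : Fin m → ℤ
  rest k = sum (λ j → c (Fin.suc j) * M (g (Fin.suc j)) k)
  N′ = updateRow M t (λ k → M t k + rest k)
  E  = updateRow M t (M (g Fin.zero))
  regroup : ∀ a b x s → a + (b * x + s) ≡ + 1 * (a + s) + b * x
  regroup = solve-∀
  Nₜ≡′ : ∀ k → N t k ≡ + 1 * N′ t k + c Fin.zero * E t k
  Nₜ≡′ k = begin
    N t k                                               ≡⟨ Nₜ≡ k ⟩
    M t k + (c Fin.zero * M (g Fin.zero) k + rest k)             ≡⟨ regroup (M t k) (c Fin.zero) (M (g Fin.zero) k) (rest k) ⟩
    + 1 * (M t k + rest k) + c Fin.zero * M (g Fin.zero) k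
      ≡⟨ sym (cong₂ (λ x y → + 1 * x + c Fin.zero * y) (updateRow-≡ M t _ k) (updateRow-≡ M t _ k)) ⟩
    + 1 * N′ t k + c Fin.zero * E t k                        ∎
  det-N′ : det m N′ ≡ det m M
  det-N′ = det-addToRow m M N′ t (g ∘ Fin.suc) (c ∘ Fin.suc) (cₜ≡0 ∘ Fin.suc) (λ i k i≢t → updateRow-≢ M t _ k i≢t)
                        (updateRow-≡ M t _)
  c₀E≡0 : c Fin.zero * det m E ≡ + 0
  c₀E≡0 with g Fin.zero Finₚ.≟ t
  ... | yes g₀≡t = cong (_* det m E) (cₜ≡0 Fin.zero g₀≡t)
  ... | no g₀≢t  = trans (cong (c Fin.zero *_) (det-equalRows m E (g₀≢t ∘ sym)
                                 (λ k → trans (updateRow-≡ M t _ k) (sym (updateRow-≢ M t _ k g₀≢t)))))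
                         (ℤₚ.*-zeroʳ (c Fin.zero))

det-rowOps : ∀ m (S : Fin m → Bool) (w : Fin m → Fin m → ℤ) (M N : Matrix m) →
  (∀ i j → S j ≡ true → w i j ≡ + 0) →
  (∀ i k → S i ≡ false → N i k ≡ M i k) →
  (∀ i k → S i ≡ true → N i k ≡ M i k + sum (λ j → w i j * M j k)) →
  det m N ≡ det m M
det-rowOps m S w M N w≡0 N≡M N≡M+ = trans (det-cong m N≡Pₘ) (det-P m)
  where
  P : ℕ → Matrix m
  P t i k = if (toℕ i <ᵇ t) ∧ S i then N i k else M i k

  <ᵇ-suc : ∀ a t → a ≢ t → (a <ᵇ suc t) ≡ (a <ᵇ t)
  <ᵇ-suc a t a≢t with a ℕₚ.<? t
  ... | yes a<t = trans (dec-true (a ℕₚ.<? suc t) (ℕₚ.m≤n⇒m≤1+n a<t)) (sym (dec-true (a ℕₚ.<? t) a<t))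
  ... | no a≮t  = trans (dec-false (a ℕₚ.<? suc t) (λ a<1+t → a≮t (ℕₚ.≤∧≢⇒< (ℕₚ.≤-pred a<1+t) a≢t)))
                        (sym (dec-false (a ℕₚ.<? t) a≮t))

  P-suc : ∀ t i k → toℕ i ≢ t → P (suc t) i k ≡ P t i k
  P-suc t i k i≢t = cong (λ b → if b ∧ S i then N i k else M i k) (<ᵇ-suc (toℕ i) t i≢t)

  P-outside : ∀ t j k → S j ≡ false → P t j k ≡ M j k
  P-outside t j k Sj≡false rewrite Sj≡false | ∧-zeroʳ (toℕ j <ᵇ t) = refl

  N≡Pₘ : ∀ i k → N i k ≡ P m i k
  N≡Pₘ i k rewrite dec-true (toℕ i ℕₚ.<? m) (Finₚ.toℕ<n i) with S i in Si
  ... | true  = refl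
  ... | false = N≡M i k Si

  step : ∀ t → det m (P (suc t)) ≡ det m (P t)
  step t with t ℕₚ.<? m
  ... | no t≮m = det-cong m (λ i k → P-suc t i k (λ i≡t → t≮m (subst (ℕ._< m) i≡t (Finₚ.toℕ<n i))))
  ... | yes t<m with S f in Sf
    where f = fromℕ< t<m
  ...   | false = det-cong m unchanged
    where
    f = fromℕ< t<m
    unchanged : ∀ i k → P (suc t) i k ≡ P t i k
    unchanged i k with toℕ i ℕₚ.≟ t
    ... | no i≢t = P-suc t i k i≢t
    ... | yes i≡t rewrite Finₚ.toℕ-injective {i = i} {j = f} (trans i≡t (sym (Finₚ.toℕ-fromℕ< t<m))) =
      trans (P-outside (suc t) f k Sf) (sym (P-outside t f k Sf))
  ...   | true = det-addToRow m (P t) (P (suc t)) f id (w f) (λ j j≡f → w≡0 f j (subst (λ z → S z ≡ true) (sym j≡f) Sf))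
                   (λ i k i≢f → P-suc t i k (i≢f ∘ f≡ i)) rowₜ
    where
    f = fromℕ< t<m
    f≡ : ∀ i → toℕ i ≡ t → i ≡ f
    f≡ i i≡t = Finₚ.toℕ-injective (trans i≡t (sym (Finₚ.toℕ-fromℕ< t<m)))
    rowₜ : ∀ k → P (suc t) f k ≡ P t f k + sum (λ j → w f j * P t j k)
    rowₜ k rewrite Finₚ.toℕ-fromℕ< t<m | Sf | dec-true (t ℕₚ.<? suc t) (ℕₚ.n<1+n t) | dec-false (t ℕₚ.<? t) (ℕₚ.<-irrefl refl) =
      trans (N≡M+ f k Sf) (cong (_+_ (M f k)) (sum-cong-≗ same))
      where
      same : ∀ j → w f j * M j k ≡ w f j * P t j k
      same j = bySj (S j) refl
        where
        bySj : ∀ b → S j ≡ b → w f j * M j k ≡ w f j * P t j k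
        bySj true  Sj = trans (cong (_* M j k) (w≡0 f j Sj)) (sym (cong (_* P t j k) (w≡0 f j Sj)))
        bySj false Sj = cong (w f j *_) (sym (P-outside t j k Sj))

  det-P : ∀ t → det m (P t) ≡ det m M
  det-P zero    = refl
  det-P (suc t) = trans (step t) (det-P t)

updateRow-cong : ∀ {m} (M : Matrix m) t {r r′ : Fin m → ℤ} → (∀ k → r k ≡ r′ k) →
                 ∀ i k → updateRow M t r i k ≡ updateRow M t r′ i k
updateRow-cong M t r≡r′ i k with i Finₚ.≟ t
... | yes _ = r≡r′ k
... | no _  = refl

det-rowSum : ∀ m (M : Matrix m) (r : Fin m) → det m (updateRow M r (λ k → sum (λ j → M j k))) ≡ det m M
det-rowSum m M r = det-addToRow m M (updateRow M r (λ k → sum (λ j → M j k))) r id others others-r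
                                (λ i k → updateRow-≢ M r _ k) rowᵣ
  where
  δᵣ : Fin m → ℤ
  δᵣ j = δ (toℕ j) (toℕ r)
  others : Fin m → ℤ
  others j = + 1 - δᵣ j
  others-r : ∀ j → j ≡ r → others j ≡ + 0
  others-r j refl = cong (_-_ (+ 1)) (δ-refl (toℕ j))
  rowᵣ : ∀ k → updateRow M r (λ k → sum (λ j → M j k)) r k ≡ M r k + sum (λ j → others j * M j k)
  rowᵣ k = begin
    updateRow M r (λ k → sum (λ j → M j k)) r k                   ≡⟨ updateRow-≡ M r _ k ⟩
    sum (λ j → M j k)                                             ≡⟨ split (M r k) (sum (λ j → M j k)) ⟩
    M r k + (+ 1 * sum (λ j → M j k) + - (+ 1) * M r k)           ≡⟨ cong (λ x → M r k + (+ 1 * sum (λ j → M j k) + - (+ 1) * x))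
                                                                         (sym (sum-δ r (λ j → M j k))) ⟩
    M r k + (+ 1 * sum (λ j → M j k) + - (+ 1) * sum (λ j → δᵣ j * M j k))
      ≡⟨ cong (_+_ (M r k)) (sym (sum-linear (+ 1) (- (+ 1)) (λ j → M j k) (λ j → δᵣ j * M j k) (λ j → complement (M j k) (δᵣ j)))) ⟩
    M r k + sum (λ j → others j * M j k)                          ∎
    where
    open ≡-Reasoning
    split : ∀ x s → s ≡ x + (+ 1 * s + - (+ 1) * x)
    split = solve-∀
    complement : ∀ x d → (+ 1 - d) * x ≡ + 1 * x + - (+ 1) * (d * x)
    complement = solve-∀

det-constantRow : ∀ m (M : Matrix m) (r : Fin m) a →
                  det m (updateRow M r (λ _ → a)) ≡ a * det m (updateRow M r (λ _ → + 1))
det-constantRow m M r a =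
  trans (det-rowLinear m r a (+ 0) (updateRow M r (λ _ → a)) M₁ M₁ same same rowᵣ) (ℤₚ.+-identityʳ (a * det m M₁))
  where
  M₁ = updateRow M r (λ _ → + 1)
  same : ∀ i k → i ≢ r → M₁ i k ≡ updateRow M r (λ _ → a) i k
  same i k i≢r = trans (updateRow-≢ M r _ k i≢r) (sym (updateRow-≢ M r _ k i≢r))
  rowᵣ : ∀ k → updateRow M r (λ _ → a) r k ≡ a * M₁ r k + + 0 * M₁ r k
  rowᵣ k rewrite updateRow-≡ M r (λ _ → a) k | updateRow-≡ M r (λ _ → + 1) k =
    sym (trans (ℤₚ.+-identityʳ (a * + 1)) (ℤₚ.*-identityʳ a))

-- Subtracting β times the row of ones from every other row.
det-removeConstant : ∀ m (K : Matrix m) (β : ℤ) (r : Fin m) →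
  det m (updateRow (λ i k → K i k + β) r (λ _ → + 1)) ≡ det m (updateRow K r (λ _ → + 1))
det-removeConstant m K β r = sym (det-rowOps m notR (λ _ j → - β * δᵣ j) Kβ[r≔1] K[r≔1] w≡0 atR offR)
  where
  Kβ[r≔1] = updateRow (λ i k → K i k + β) r (λ _ → + 1)
  K[r≔1]  = updateRow K r (λ _ → + 1)
  δᵣ : Fin m → ℤ
  δᵣ j = δ (toℕ j) (toℕ r)
  notR : Fin m → Bool
  notR i = not (toℕ i ≡ᵇ toℕ r)
  i≢r⇒δᵣ≡0 : ∀ {i} → notR i ≡ true → δᵣ i ≡ + 0
  i≢r⇒δᵣ≡0 i≢r = cong b2z (not-injective i≢r)
  w≡0 : ∀ i j → notR j ≡ true → - β * δᵣ j ≡ + 0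
  w≡0 _ j j≢r = trans (cong (- β *_) (i≢r⇒δᵣ≡0 {j} j≢r)) (ℤₚ.*-zeroʳ (- β))
  atR : ∀ i k → notR i ≡ false → K[r≔1] i k ≡ Kβ[r≔1] i k
  atR i k i≡r with Finₚ.toℕ-injective {i = i} {j = r} (≡ᵇ-true⇒≡ (not-injective i≡r))
  ... | refl = trans (updateRow-≡ K r _ k) (sym (updateRow-≡ _ r _ k))
  cancel : ∀ x β → x ≡ x + β + - β * + 1
  cancel = solve-∀
  reorder : ∀ β d x → - β * d * x ≡ d * (- β * x)
  reorder = solve-∀
  offR : ∀ i k → notR i ≡ true → K[r≔1] i k ≡ Kβ[r≔1] i k + sum (λ j → - β * δᵣ j * Kβ[r≔1] j k)
  offR i k i≢r = begin
    K[r≔1] i k                                            ≡⟨ updateRow-≢ K r _ k i≢r′ ⟩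
    K i k                                                 ≡⟨ cancel (K i k) β ⟩
    K i k + β + - β * + 1                                 ≡⟨ cong₂ (λ x y → x + - β * y) (sym (updateRow-≢ _ r _ k i≢r′))
                                                                    (sym (updateRow-≡ _ r _ k)) ⟩
    Kβ[r≔1] i k + - β * Kβ[r≔1] r k                       ≡⟨ cong (_+_ (Kβ[r≔1] i k)) (sym (sum-δ r (λ j → - β * Kβ[r≔1] j k))) ⟩
    Kβ[r≔1] i k + sum (λ j → δᵣ j * (- β * Kβ[r≔1] j k))
      ≡⟨ cong (_+_ (Kβ[r≔1] i k)) (sum-cong-≗ (λ j → sym (reorder β (δᵣ j) (Kβ[r≔1] j k)))) ⟩
    Kβ[r≔1] i k + sum (λ j → - β * δᵣ j * Kβ[r≔1] j k)   ∎
    where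
    open ≡-Reasoning
    i≢r′ : i ≢ r
    i≢r′ refl with trans (sym (δ-refl (toℕ i))) (i≢r⇒δᵣ≡0 {i} i≢r)
    ... | ()

-- Replacing row r by the sum of all rows yields the constant row c + mβ, which then
-- cancels the β in every other row.
det-addConstant : ∀ m (K : Matrix m) (c β : ℤ) (r : Fin m) → (∀ k → sum (λ j → K j k) ≡ c) →
                  det m (λ i k → K i k + β) ≡ (c + + m * β) * det m (updateRow K r (λ _ → + 1))
det-addConstant m K c β r colSum = begin
  det m Kβ                                                  ≡⟨ sym (det-rowSum m Kβ r) ⟩
  det m (updateRow Kβ r (λ k → sum (λ j → Kβ j k)))         ≡⟨ det-cong m (updateRow-cong Kβ r colSumβ) ⟩
  det m (updateRow Kβ r (λ _ → c + + m * β))                ≡⟨ det-constantRow m Kβ r (c + + m * β) ⟩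
  (c + + m * β) * det m (updateRow Kβ r (λ _ → + 1))        ≡⟨ cong ((c + + m * β) *_) (det-removeConstant m K β r) ⟩
  (c + + m * β) * det m (updateRow K r (λ _ → + 1))         ∎
  where
  open ≡-Reasoning
  Kβ : Matrix m
  Kβ i k = K i k + β
  colSumβ : ∀ k → sum (λ j → Kβ j k) ≡ c + + m * β
  colSumβ k = trans (∑-distrib-+ (λ j → K j k) (λ _ → β)) (cong₂ _+_ (colSum k) (sum-const m β))

-- Entries are given at all indices so that index arithmetic (such as i + n or i ∸ n) stays in ℕ.
ℕMatrix : Set
ℕMatrix = ℕ → ℕ → ℤ

restrict : ∀ m → ℕMatrix → Matrix m
restrict m A i k = A (toℕ i) (toℕ k)

sum≡sumBelow : ∀ m (f : ℕ → ℤ) → sum {m} (f ∘ toℕ) ≡ sumBelow m f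
sum≡sumBelow zero    f = refl
sum≡sumBelow (suc m) f = cong (_+_ (f 0)) (sum≡sumBelow m (f ∘ suc))

det-lowerTriangular : ∀ m (A : ℕMatrix) → (∀ i k → i ℕ.< k → k ℕ.< m → A i k ≡ + 0) →
                      det m (restrict m A) ≡ prodBelow m (λ i → A i i)
det-lowerTriangular zero    A _       = refl
det-lowerTriangular (suc m) A upper≡0 = begin
  det (suc m) (restrict (suc m) A)
    ≡⟨ det-expand (restrict (suc m) A) ⟩
  + 1 * (A 0 0 * det m (restrict m A′)) + sum (cofactorTerm (restrict (suc m) A) ∘ Fin.suc)
    ≡⟨ cong₂ _+_ (ℤₚ.*-identityˡ (A 0 0 * det m (restrict m A′))) (sum-zero _ offDiagonal) ⟩
  A 0 0 * det m (restrict m A′) + + 0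
    ≡⟨ ℤₚ.+-identityʳ (A 0 0 * det m (restrict m A′)) ⟩
  A 0 0 * det m (restrict m A′)
    ≡⟨ cong (A 0 0 *_) (det-lowerTriangular m A′ (λ i k i<k k<m → upper≡0 (suc i) (suc k) (ℕ.s≤s i<k) (ℕ.s≤s k<m))) ⟩
  prodBelow (suc m) (λ i → A i i) ∎
  where
  open ≡-Reasoning
  A′ : ℕMatrix
  A′ i k = A (suc i) (suc k)
  offDiagonal : ∀ j → cofactorTerm (restrict (suc m) A) (Fin.suc j) ≡ + 0
  offDiagonal j rewrite upper≡0 0 (suc (toℕ j)) (ℕ.s≤s ℕ.z≤n) (ℕ.s≤s (Finₚ.toℕ<n j)) = ℤₚ.*-zeroʳ (altSign (suc (toℕ j)))

det-rowOpsℕ : ∀ m (S : ℕ → Bool) (w : ℕ → ℕ → ℤ) (A B : ℕMatrix) →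
  (∀ i j → i ℕ.< m → j ℕ.< m → S j ≡ true → w i j ≡ + 0) →
  (∀ i k → i ℕ.< m → S i ≡ false → B i k ≡ A i k) →
  (∀ i k → i ℕ.< m → k ℕ.< m → S i ≡ true → B i k ≡ A i k + sumBelow m (λ j → w i j * A j k)) →
  det m (restrict m B) ≡ det m (restrict m A)
det-rowOpsℕ m S w A B w≡0 B≡A B≡A+ =
  det-rowOps m (S ∘ toℕ) (λ i j → w (toℕ i) (toℕ j)) (restrict m A) (restrict m B)
    (λ i j → w≡0 (toℕ i) (toℕ j) (Finₚ.toℕ<n i) (Finₚ.toℕ<n j))
    (λ i k → B≡A (toℕ i) (toℕ k) (Finₚ.toℕ<n i))
    (λ i k Si → trans (B≡A+ (toℕ i) (toℕ k) (Finₚ.toℕ<n i) (Finₚ.toℕ<n k) Si)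
                      (cong (_+_ (A (toℕ i) (toℕ k))) (sym (sum≡sumBelow m (λ j → w (toℕ i) j * A j (toℕ k))))))

det-scaleRowsℕ : ∀ m (c : ℕ → ℤ) (A B : ℕMatrix) → (∀ i k → i ℕ.< m → B i k ≡ c i * A i k) →
                 det m (restrict m B) ≡ prodBelow m c * det m (restrict m A)
det-scaleRowsℕ m c A B B≡cA = det-scaleRows m c (restrict m A) (restrict m B) (λ i k → B≡cA (toℕ i) (toℕ k) (Finₚ.toℕ<n i))

-- Laplacians

subScalar-δ : ∀ m (M : Matrix m) x i k → subScalar m M x i k ≡ M i k - x * δ (toℕ i) (toℕ k)
subScalar-δ m M x i k with toℕ i ≡ᵇ toℕ k
... | true  = cong (_-_ (M i k)) (sym (ℤₚ.*-identityʳ x))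
... | false = sym (trans (cong (_-_ (M i k)) (ℤₚ.*-zeroʳ x)) (ℤₚ.+-identityʳ (M i k)))

laplacian-δ : ∀ V adj (i k : Fin V) → laplacian V adj i k ≡ δ (toℕ i) (toℕ k) * degree V adj i - b2z (adj i k)
laplacian-δ V adj i k with toℕ i ≡ᵇ toℕ k
... | true  = cong (_- b2z (adj i k)) (sym (ℤₚ.*-identityˡ (degree V adj i)))
... | false = sym (ℤₚ.+-identityˡ (- b2z (adj i k)))

shiftedLaplacian : ∀ V → (Fin V → Fin V → Bool) → ℤ → Matrix V
shiftedLaplacian V adj y i k = laplacian V adj i k - y * δ (toℕ i) (toℕ k)

module _ {V : ℕ} (adj : Fin V → Fin V → Bool) (adj-sym : ∀ i k → adj i k ≡ adj k i) where

  shiftedLaplacian-colSum : ∀ y k → sum (λ j → shiftedLaplacian V adj y j k) ≡ - y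
  shiftedLaplacian-colSum y k = begin
    sum (λ j → shiftedLaplacian V adj y j k)
      ≡⟨ sum-cong-≗ (λ j → trans (cong (_- y * δ (toℕ j) (toℕ k)) (laplacian-δ V adj j k))
                                 (split (δ (toℕ j) (toℕ k)) (degree V adj j) (b2z (adj j k)) y)) ⟩
    sum (λ j → + 1 * (δ (toℕ j) (toℕ k) * (degree V adj j - y)) + - (+ 1) * b2z (adj j k))
      ≡⟨ sum-linear (+ 1) (- (+ 1)) (λ j → δ (toℕ j) (toℕ k) * (degree V adj j - y)) (λ j → b2z (adj j k)) (λ _ → refl) ⟩
    + 1 * sum (λ j → δ (toℕ j) (toℕ k) * (degree V adj j - y)) + - (+ 1) * sum (λ j → b2z (adj j k))
      ≡⟨ cong₂ (λ a b → + 1 * a + - (+ 1) * b) (sum-δ k (λ j → degree V adj j - y))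
               (trans (sum-cong-≗ (λ j → cong b2z (adj-sym j k))) (sym (sumFin≡sum V (λ j → b2z (adj k j))))) ⟩
    + 1 * (degree V adj k - y) + - (+ 1) * degree V adj k
      ≡⟨ cancel (degree V adj k) y ⟩
    - y ∎
    where
    open ≡-Reasoning
    split : ∀ d g a y → d * g - a - y * d ≡ + 1 * (d * (g - y)) + - (+ 1) * a
    split = solve-∀
    cancel : ∀ g y → + 1 * (g - y) + - (+ 1) * g ≡ - y
    cancel = solve-∀

  det-charLaplacian : ∀ (r : Fin V) x →
    det V (subScalar V (laplacian V adj) x) ≡ - x * det V (updateRow (shiftedLaplacian V adj x) r (λ _ → + 1))
  det-charLaplacian r x = begin
    det V (subScalar V (laplacian V adj) x)
      ≡⟨ det-cong V (λ i k → trans (subScalar-δ V (laplacian V adj) x i k) (sym (ℤₚ.+-identityʳ _))) ⟩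
    det V (λ i k → shiftedLaplacian V adj x i k + + 0)
      ≡⟨ det-addConstant V (shiftedLaplacian V adj x) (- x) (+ 0) r (shiftedLaplacian-colSum x) ⟩
    (- x + + V * + 0) * det V N
      ≡⟨ cong (_* det V N) (trans (cong (_+_ (- x)) (ℤₚ.*-zeroʳ (+ V))) (ℤₚ.+-identityʳ (- x))) ⟩
    - x * det V N ∎
    where
    open ≡-Reasoning
    N = updateRow (shiftedLaplacian V adj x) r (λ _ → + 1)

-- Graphs with a universal vertex

anyFin-witness : ∀ m (p : Fin m → Bool) w → p w ≡ true → anyFin m p ≡ true
anyFin-witness (suc m) p Fin.zero    pw rewrite pw = refl
anyFin-witness (suc m) p (Fin.suc w) pw with p Fin.zero
... | true  = refl
... | false = anyFin-witness m (p ∘ Fin.suc) w pw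

anyFin-none : ∀ m (p : Fin m → Bool) → (∀ w → p w ≡ false) → anyFin m p ≡ false
anyFin-none zero    p _     = refl
anyFin-none (suc m) p none rewrite none Fin.zero = anyFin-none m (p ∘ Fin.suc) (none ∘ Fin.suc)

anyFin-δ : ∀ m (a : Fin m → Bool) (k : Fin m) → anyFin m (λ w → a w ∧ (toℕ w ≡ᵇ toℕ k)) ≡ a k
anyFin-δ (suc m) a Fin.zero =
  trans (cong₂ _∨_ (∧-identityʳ (a Fin.zero)) (anyFin-none m _ (λ w → ∧-zeroʳ (a (Fin.suc w))))) (∨-identityʳ (a Fin.zero))
anyFin-δ (suc m) a (Fin.suc k) rewrite ∧-zeroʳ (a Fin.zero) = anyFin-δ m (a ∘ Fin.suc) k

module _ {V : ℕ} (adj : Fin V → Fin V → Bool)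
         (adj-sym : ∀ i k → adj i k ≡ adj k i) (adj-irrefl : ∀ i → adj i i ≡ false)
         (w : Fin V) (w-universal : ∀ i → i ≢ w → adj i w ≡ true) where

  reach₁ : ∀ i k → reach V adj 1 i k ≡ ((toℕ i ≡ᵇ toℕ k) ∨ adj i k)
  reach₁ i k = cong ((toℕ i ≡ᵇ toℕ k) ∨_) (anyFin-δ V (adj i) k)

  reach₁-universal : ∀ k → reach V adj 1 w k ≡ true
  reach₁-universal k with k Finₚ.≟ w
  ... | yes refl = trans (reach₁ w w) (cong (_∨ adj w w) (dec-true (toℕ w ℕₚ.≟ toℕ w) refl))
  ... | no k≢w   = trans (reach₁ w k) (trans (cong ((toℕ w ≡ᵇ toℕ k) ∨_) (trans (adj-sym w k) (w-universal k k≢w)))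
                                             (∨-zeroʳ (toℕ w ≡ᵇ toℕ k)))

  reach₂ : ∀ i k → reach V adj 2 i k ≡ true
  reach₂ i k with i Finₚ.≟ w
  ... | yes refl = cong (_∨ anyFin V (λ v → adj w v ∧ reach V adj 1 v k)) (reach₁-universal k)
  ... | no i≢w   = trans (cong (reach V adj 1 i k ∨_)
                               (anyFin-witness V (λ v → adj i v ∧ reach V adj 1 v k) w
                                  (cong₂ _∧_ (w-universal i i≢w) (reach₁-universal k))))
                         (∨-zeroʳ (reach V adj 1 i k))

  adj-diagonal : ∀ i k → (toℕ i ≡ᵇ toℕ k) ≡ true → adj i k ≡ false
  adj-diagonal i k i≡k rewrite Finₚ.toℕ-injective {i = i} {j = k} (≡ᵇ-true⇒≡ i≡k) = adj-irrefl k

  firstReach-from₂ : ∀ fuel i k → firstReach V adj 2 fuel i k ≡ 2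
  firstReach-from₂ zero    i k = refl
  firstReach-from₂ (suc f) i k rewrite reach₂ i k = refl

  distance-universal : 1 ℕ.< V → ∀ i k → + distance V adj i k ≡ + 2 - + 2 * δ (toℕ i) (toℕ k) - b2z (adj i k)
  distance-universal 1<V i k = begin
    + firstReach V adj 0 V i k
      ≡⟨ cong (λ fuel → + firstReach V adj 0 fuel i k) (trans (sym (ℕₚ.m∸n+n≡m 1<V)) (ℕₚ.+-comm (V ∸ 2) 2)) ⟩
    + firstReach V adj 0 (2 ℕ.+ (V ∸ 2)) i k
      ≡⟨ cong (λ d → + (if toℕ i ≡ᵇ toℕ k then 0 else if reach V adj 1 i k then 1 else d)) (firstReach-from₂ (V ∸ 2) i k) ⟩
    + (if toℕ i ≡ᵇ toℕ k then 0 else if reach V adj 1 i k then 1 else 2)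
      ≡⟨ cong (λ r → + (if toℕ i ≡ᵇ toℕ k then 0 else if r then 1 else 2)) (reach₁ i k) ⟩
    + (if toℕ i ≡ᵇ toℕ k then 0 else if (toℕ i ≡ᵇ toℕ k) ∨ adj i k then 1 else 2)
      ≡⟨ formula (toℕ i ≡ᵇ toℕ k) (adj i k) (adj-diagonal i k) ⟩
    + 2 - + 2 * δ (toℕ i) (toℕ k) - b2z (adj i k) ∎
    where
    open ≡-Reasoning
    formula : ∀ b a → (b ≡ true → a ≡ false) →
              + (if b then 0 else if b ∨ a then 1 else 2) ≡ + 2 - + 2 * b2z b - b2z a
    formula true  a     a≡false rewrite a≡false refl = refl
    formula false true  _ = refl
    formula false false _ = refl

  transmission-universal : 1 ℕ.< V → ∀ i → transmission V adj i ≡ + 2 * + V - + 2 - degree V adj i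
  transmission-universal 1<V i = begin
    transmission V adj i
      ≡⟨ sumFin≡sum V (distanceMatrix V adj i) ⟩
    sum (λ j → + distance V adj i j)
      ≡⟨ sum-linear (+ 2) (- (+ 1)) notI (λ j → b2z (adj i j)) (λ j → trans (distance-universal 1<V i j)
                                                                      (split (δ-sym (toℕ i) (toℕ j)) (b2z (adj i j)))) ⟩
    + 2 * sum notI + - (+ 1) * sum (λ j → b2z (adj i j))
      ≡⟨ cong₂ (λ s d → + 2 * s + - (+ 1) * d) sum-notI (sym (sumFin≡sum V (λ j → b2z (adj i j)))) ⟩
    + 2 * (+ 1 * + V + - (+ 1) * + 1) + - (+ 1) * degree V adj i
      ≡⟨ tidy (+ V) (degree V adj i) ⟩
    + 2 * + V - + 2 - degree V adj i ∎
    where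
    open ≡-Reasoning
    notI : Fin V → ℤ
    notI j = + 1 - δ (toℕ j) (toℕ i) * + 1
    split : ∀ {d d′} → d ≡ d′ → ∀ a → + 2 - + 2 * d - a ≡ + 2 * (+ 1 - d′ * + 1) + - (+ 1) * a
    split {d} refl a = lemma d a
      where
      lemma : ∀ d a → + 2 - + 2 * d - a ≡ + 2 * (+ 1 - d * + 1) + - (+ 1) * a
      lemma = solve-∀
    complement : ∀ d → + 1 - d ≡ + 1 * + 1 + - (+ 1) * d
    complement = solve-∀
    sum-notI : sum notI ≡ + 1 * + V + - (+ 1) * + 1
    sum-notI = trans (sum-linear (+ 1) (- (+ 1)) (λ (_ : Fin V) → + 1) (λ j → δ (toℕ j) (toℕ i) * + 1)
                                 (λ j → complement (δ (toℕ j) (toℕ i) * + 1)))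
                     (cong₂ (λ s d → + 1 * s + - (+ 1) * d) (trans (sum-const V (+ 1)) (ℤₚ.*-identityʳ (+ V))) (sum-δ i (λ _ → + 1)))
    tidy : ∀ v g → + 2 * (+ 1 * v + - (+ 1) * + 1) + - (+ 1) * g ≡ + 2 * v - + 2 - g
    tidy = solve-∀

  distanceLaplacian-universal : 1 ℕ.< V → ∀ x i k →
    subScalar V (distanceLaplacian V adj) x i k ≡ - (shiftedLaplacian V adj (+ 2 * + V - x) i k + + 2)
  distanceLaplacian-universal 1<V x i k = begin
    subScalar V (distanceLaplacian V adj) x i k
      ≡⟨ cong₂ (entry (toℕ i ≡ᵇ toℕ k)) (transmission-universal 1<V i) (distance-universal 1<V i k) ⟩
    entry (toℕ i ≡ᵇ toℕ k) (+ 2 * + V - + 2 - degree V adj i) (+ 2 - + 2 * δ (toℕ i) (toℕ k) - b2z (adj i k))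
      ≡⟨ formula (toℕ i ≡ᵇ toℕ k) (degree V adj i) (b2z (adj i k)) (cong b2z ∘ adj-diagonal i k) ⟩
    - (δ (toℕ i) (toℕ k) * degree V adj i - b2z (adj i k) - (+ 2 * + V - x) * δ (toℕ i) (toℕ k) + + 2)
      ≡⟨ cong (λ l → - (l - (+ 2 * + V - x) * δ (toℕ i) (toℕ k) + + 2)) (sym (laplacian-δ V adj i k)) ⟩
    - (shiftedLaplacian V adj (+ 2 * + V - x) i k + + 2) ∎
    where
    open ≡-Reasoning
    entry : Bool → ℤ → ℤ → ℤ
    entry b t d = if b then (if b then t - d else - d) - x else (if b then t - d else - d)
    formula : ∀ b g a → (b ≡ true → a ≡ + 0) →
      entry b (+ 2 * + V - + 2 - g) (+ 2 - + 2 * b2z b - a) ≡ - (b2z b * g - a - (+ 2 * + V - x) * b2z b + + 2)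
    formula true  g a a≡0 rewrite a≡0 refl = diagonal (+ V) x g
      where
      diagonal : ∀ v x g → + 2 * v - + 2 - g - (+ 2 - + 2 * + 1 - + 0) - x ≡ - (+ 1 * g - + 0 - (+ 2 * v - x) * + 1 + + 2)
      diagonal = solve-∀
    formula false g a _ = offDiagonal (+ V) x g a
      where
      offDiagonal : ∀ v x g a → - (+ 2 - + 2 * + 0 - a) ≡ - (+ 0 * g - a - (+ 2 * v - x) * + 0 + + 2)
      offDiagonal = solve-∀

  det-charDistanceLaplacian : 1 ℕ.< V → ∀ x →
    det V (subScalar V (distanceLaplacian V adj) x) ≡
    (- (+ 1)) ℤ.^ V * (x * det V (updateRow (shiftedLaplacian V adj (+ 2 * + V - x)) w (λ _ → + 1)))
  det-charDistanceLaplacian 1<V x = begin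
    det V (subScalar V (distanceLaplacian V adj) x)
      ≡⟨ det-scaleRows V (λ _ → - (+ 1)) (λ i k → shiftedLaplacian V adj y i k + + 2) _
                       (λ i k → trans (distanceLaplacian-universal 1<V x i k) (sym (ℤₚ.-1*i≡-i _))) ⟩
    prodBelow V (λ _ → - (+ 1)) * det V (λ i k → shiftedLaplacian V adj y i k + + 2)
      ≡⟨ cong₂ _*_ (prodBelow-const V (- (+ 1)))
                   (det-addConstant V (shiftedLaplacian V adj y) (- y) (+ 2) w (shiftedLaplacian-colSum adj adj-sym y)) ⟩
    (- (+ 1)) ℤ.^ V * ((- y + + V * + 2) * det V N)
      ≡⟨ cong (λ c → (- (+ 1)) ℤ.^ V * (c * det V N)) (shift (+ V) x) ⟩
    (- (+ 1)) ℤ.^ V * (x * det V N) ∎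
    where
    open ≡-Reasoning
    y = + 2 * + V - x
    N = updateRow (shiftedLaplacian V adj y) w (λ _ → + 1)
    shift : ∀ v x → - (+ 2 * v - x) + v * + 2 ≡ x
    shift = solve-∀

-- Arithmetic in Q_n

module QuaternionArithmetic (t : ℕ) where
  n : ℕ
  n = suc (suc t)
  open Quaternion n

  n<N2 : n < N2
  n<N2 = ℕₚ.m<m+n n {n ℕ.+ 0} (s≤s z≤n)

  private
    hasB-a : ∀ {x} → x < N2 → hasB x ≡ false
    hasB-a {x} x<N2 rewrite dec-true (x ℕₚ.<? N2) x<N2 = refl

    hasB-b : ∀ {x} → N2 ≤ x → hasB x ≡ true
    hasB-b {x} N2≤x rewrite dec-false (x ℕₚ.<? N2) (ℕₚ.≤⇒≯ N2≤x) = refl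

    expo-a : ∀ {x} → x < N2 → expo x ≡ x
    expo-a {x} x<N2 rewrite dec-true (x ℕₚ.<? N2) x<N2 = refl

    expo-b : ∀ {x} → N2 ≤ x → expo x ≡ x ∸ N2
    expo-b {x} N2≤x rewrite dec-false (x ℕₚ.<? N2) (ℕₚ.≤⇒≯ N2≤x) = refl

    true≢false : true ≢ false
    true≢false ()

  mul-aa : ∀ {x y} → x < N2 → y < N2 → mul x y ≡ (x ℕ.+ y) % N2
  mul-aa {x} {y} x<N2 y<N2 with hasB x in hx | hasB y in hy
  ... | false | false rewrite expo-a x<N2 | expo-a y<N2 = refl
  ... | true  | _     = ⊥-elim (true≢false (trans (sym hx) (hasB-a x<N2)))
  ... | false | true  = ⊥-elim (true≢false (trans (sym hy) (hasB-a y<N2)))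

  mul-ab : ∀ {x y} → x < N2 → N2 ≤ y → mul x y ≡ N2 ℕ.+ (x ℕ.+ (y ∸ N2)) % N2
  mul-ab {x} {y} x<N2 N2≤y with hasB x in hx | hasB y in hy
  ... | false | true  rewrite expo-a x<N2 | expo-b N2≤y = refl
  ... | true  | _     = ⊥-elim (true≢false (trans (sym hx) (hasB-a x<N2)))
  ... | false | false = ⊥-elim (true≢false (trans (sym (hasB-b N2≤y)) hy))

  mul-bb : ∀ {x y} → N2 ≤ x → N2 ≤ y → mul x y ≡ ((x ∸ N2) ℕ.+ (N2 ∸ (y ∸ N2)) ℕ.+ n) % N2
  mul-bb {x} {y} N2≤x N2≤y with hasB x in hx | hasB y in hy
  ... | true  | true  rewrite expo-b N2≤x | expo-b N2≤y = refl
  ... | false | _     = ⊥-elim (true≢false (trans (sym (hasB-b N2≤x)) hx))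
  ... | true  | false = ⊥-elim (true≢false (trans (sym (hasB-b N2≤y)) hy))

  %-absorbˡ : ∀ a b → ((a % N2) ℕ.+ b) % N2 ≡ (a ℕ.+ b) % N2
  %-absorbˡ a b = trans (%-distribˡ-+ (a % N2) b N2)
                        (trans (cong (λ z → (z ℕ.+ b % N2) % N2) (m%n%n≡m%n a N2)) (sym (%-distribˡ-+ a b N2)))

  pow-a : ∀ {x} → x < N2 → ∀ m → pow x m ≡ (x ℕ.* m) % N2
  pow-a {x} x<N2 zero    rewrite ℕₚ.*-zeroʳ x = refl
  pow-a {x} x<N2 (suc m) = begin
    mul (pow x m) x                ≡⟨ cong (λ z → mul z x) (pow-a x<N2 m) ⟩
    mul ((x ℕ.* m) % N2) x         ≡⟨ mul-aa (m%n<n (x ℕ.* m) N2) x<N2 ⟩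
    ((x ℕ.* m) % N2 ℕ.+ x) % N2    ≡⟨ %-absorbˡ (x ℕ.* m) x ⟩
    (x ℕ.* m ℕ.+ x) % N2           ≡⟨ cong (_% N2) (trans (ℕₚ.+-comm (x ℕ.* m) x) (sym (ℕₚ.*-suc x m))) ⟩
    (x ℕ.* suc m) % N2             ∎
    where open ≡-Reasoning

  isPowerOf-witness : ∀ {y x} m → m < 4 ℕ.* n → pow x (suc m) ≡ y → isPowerOf y x ≡ true
  isPowerOf-witness {y} {x} m m<4n pow≡y =
    anyFin-witness (4 ℕ.* n) (λ i → y ≡ᵇ pow x (suc (toℕ i))) (fromℕ< m<4n)
      (trans (cong (λ j → y ≡ᵇ pow x (suc j)) (Finₚ.toℕ-fromℕ< m<4n))
             (trans (cong (y ≡ᵇ_) pow≡y) (dec-true (y ℕₚ.≟ y) refl)))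

  isPowerOf-ab : ∀ {p y} → p < N2 → N2 ≤ y → isPowerOf y p ≡ false
  isPowerOf-ab {p} {y} p<N2 N2≤y = anyFin-none (4 ℕ.* n) (λ i → y ≡ᵇ pow p (suc (toℕ i))) (λ i →
    dec-false (y ℕₚ.≟ pow p (suc (toℕ i)))
      (λ y≡ → ℕₚ.<⇒≱ (subst (_< N2) (sym (trans y≡ (pow-a p<N2 (suc (toℕ i))))) (m%n<n (p ℕ.* suc (toℕ i)) N2)) N2≤y))

  -- x = aˢb, whose powers are e, x, aⁿ and x′ = x³ = aˢ⁺ⁿb.
  module Order4 (s : ℕ) (s<N2 : s < N2) where
    x x′ : ℕ
    x  = N2 ℕ.+ s
    x′ = N2 ℕ.+ (n ℕ.+ s) % N2

    N2≤x : N2 ≤ x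
    N2≤x = ℕₚ.m≤m+n N2 s

    N2≤x′ : N2 ≤ x′
    N2≤x′ = ℕₚ.m≤m+n N2 _

    private
      x∸N2 : x ∸ N2 ≡ s
      x∸N2 = ℕₚ.m+n∸m≡n N2 s

      x′∸N2 : x′ ∸ N2 ≡ (n ℕ.+ s) % N2
      x′∸N2 = ℕₚ.m+n∸m≡n N2 _

      s+[N2∸s] : s ℕ.+ (N2 ∸ s) ≡ N2
      s+[N2∸s] = ℕₚ.m+[n∸m]≡n (ℕₚ.<⇒≤ s<N2)

    e·x : mul 0 x ≡ x
    e·x = trans (mul-ab (s≤s z≤n) N2≤x) (trans (cong (λ z → N2 ℕ.+ z % N2) x∸N2) (cong (N2 ℕ.+_) (m<n⇒m%n≡m s<N2)))

    x·x : mul x x ≡ n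
    x·x = begin
      mul x x                                     ≡⟨ mul-bb N2≤x N2≤x ⟩
      ((x ∸ N2) ℕ.+ (N2 ∸ (x ∸ N2)) ℕ.+ n) % N2   ≡⟨ cong (λ z → (z ℕ.+ (N2 ∸ z) ℕ.+ n) % N2) x∸N2 ⟩
      (s ℕ.+ (N2 ∸ s) ℕ.+ n) % N2                 ≡⟨ cong (λ z → (z ℕ.+ n) % N2) s+[N2∸s] ⟩
      (N2 ℕ.+ n) % N2                             ≡⟨ cong (_% N2) (shift n) ⟩
      (n ℕ.+ 1 ℕ.* N2) % N2                       ≡⟨ [m+kn]%n≡m%n n 1 N2 ⟩
      n % N2                                      ≡⟨ m<n⇒m%n≡m n<N2 ⟩
      n                                           ∎
      where
      open ≡-Reasoning
      shift : ∀ n → 2 ℕ.* n ℕ.+ n ≡ n ℕ.+ 1 ℕ.* (2 ℕ.* n)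
      shift = ℕ-Solver.solve-∀

    aⁿ·x : mul n x ≡ x′
    aⁿ·x = trans (mul-ab n<N2 N2≤x) (cong (λ z → N2 ℕ.+ (n ℕ.+ z) % N2) x∸N2)

    x′·x : mul x′ x ≡ 0
    x′·x = begin
      mul x′ x                                     ≡⟨ mul-bb N2≤x′ N2≤x ⟩
      ((x′ ∸ N2) ℕ.+ (N2 ∸ (x ∸ N2)) ℕ.+ n) % N2   ≡⟨ cong₂ (λ a b → (a ℕ.+ (N2 ∸ b) ℕ.+ n) % N2) x′∸N2 x∸N2 ⟩
      ((n ℕ.+ s) % N2 ℕ.+ (N2 ∸ s) ℕ.+ n) % N2     ≡⟨ cong (_% N2) (ℕₚ.+-assoc ((n ℕ.+ s) % N2) (N2 ∸ s) n) ⟩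
      ((n ℕ.+ s) % N2 ℕ.+ ((N2 ∸ s) ℕ.+ n)) % N2   ≡⟨ %-absorbˡ (n ℕ.+ s) ((N2 ∸ s) ℕ.+ n) ⟩
      ((n ℕ.+ s) ℕ.+ ((N2 ∸ s) ℕ.+ n)) % N2        ≡⟨ cong (_% N2) (regroup n s (N2 ∸ s)) ⟩
      (n ℕ.+ (s ℕ.+ (N2 ∸ s)) ℕ.+ n) % N2          ≡⟨ cong (λ z → (n ℕ.+ z ℕ.+ n) % N2) s+[N2∸s] ⟩
      (n ℕ.+ N2 ℕ.+ n) % N2                        ≡⟨ cong (_% N2) (twice n) ⟩
      (0 ℕ.+ 2 ℕ.* N2) % N2                        ≡⟨ [m+kn]%n≡m%n 0 2 N2 ⟩
      0                                            ∎
      where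
      open ≡-Reasoning
      regroup : ∀ n s r → n ℕ.+ s ℕ.+ (r ℕ.+ n) ≡ n ℕ.+ (s ℕ.+ r) ℕ.+ n
      regroup = ℕ-Solver.solve-∀
      twice : ∀ n → n ℕ.+ 2 ℕ.* n ℕ.+ n ≡ 0 ℕ.+ 2 ℕ.* (2 ℕ.* n)
      twice = ℕ-Solver.solve-∀

    below4 : ∀ {m} → m < 4 → m < 4 ℕ.* n
    below4 m<4 = ℕₚ.<-≤-trans m<4 (ℕₚ.m≤m*n 4 n)

    pow₂ : pow x 2 ≡ n
    pow₂ = trans (cong (λ z → mul z x) e·x) x·x

    pow-cases : ∀ m → pow x m ≡ 0 ⊎ pow x m ≡ x ⊎ pow x m ≡ n ⊎ pow x m ≡ x′
    pow-cases zero = inj₁ refl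
    pow-cases (suc m) with pow-cases m
    ... | inj₁ p≡e                 = inj₂ (inj₁ (trans (cong (λ z → mul z x) p≡e) e·x))
    ... | inj₂ (inj₁ p≡x)          = inj₂ (inj₂ (inj₁ (trans (cong (λ z → mul z x) p≡x) x·x)))
    ... | inj₂ (inj₂ (inj₁ p≡aⁿ))  = inj₂ (inj₂ (inj₂ (trans (cong (λ z → mul z x) p≡aⁿ) aⁿ·x)))
    ... | inj₂ (inj₂ (inj₂ p≡x′))  = inj₁ (trans (cong (λ z → mul z x) p≡x′) x′·x)

    isPowerOf-order4 : ∀ y → y ≢ 0 → y ≢ x → isPowerOf y x ≡ ((y ≡ᵇ n) ∨ (y ≡ᵇ x′))
    isPowerOf-order4 y y≢e y≢x with y ℕₚ.≟ n | y ℕₚ.≟ x′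
    ... | yes refl | _        = trans (isPowerOf-witness {x = x} 1 (below4 (s≤s (s≤s z≤n))) pow₂)
                                      (sym (cong (_∨ (n ≡ᵇ x′)) (dec-true (n ℕₚ.≟ n) refl)))
    ... | no _     | yes refl = trans (isPowerOf-witness {x = x} 2 (below4 (s≤s (s≤s (s≤s z≤n)))) (trans (cong (λ z → mul z x) pow₂) aⁿ·x))
                                      (sym (trans (cong ((x′ ≡ᵇ n) ∨_) (dec-true (x′ ℕₚ.≟ x′) refl)) (∨-zeroʳ (x′ ≡ᵇ n))))
    ... | no y≢n   | no y≢x′  = trans (anyFin-none (4 ℕ.* n) (λ i → y ≡ᵇ pow x (suc (toℕ i))) (λ i → dec-false (y ℕₚ.≟ _) (differs (suc (toℕ i)))))
                                      (sym (cong₂ _∨_ (dec-false (y ℕₚ.≟ n) y≢n) (dec-false (y ℕₚ.≟ x′) y≢x′)))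
      where
      differs : ∀ m → y ≢ pow x m
      differs m y≡ with pow-cases m
      ... | inj₁ p≡e                = y≢e (trans y≡ p≡e)
      ... | inj₂ (inj₁ p≡x)         = y≢x (trans y≡ p≡x)
      ... | inj₂ (inj₂ (inj₁ p≡aⁿ)) = y≢n (trans y≡ p≡aⁿ)
      ... | inj₂ (inj₂ (inj₂ p≡x′)) = y≢x′ (trans y≡ p≡x′)

    x′-low : s < n → x′ ≡ x ℕ.+ n
    x′-low s<n = trans (cong (N2 ℕ.+_) (m<n⇒m%n≡m n+s<N2)) (regroup N2 n s)
      where
      n+s<N2 : n ℕ.+ s < N2
      n+s<N2 = subst (n ℕ.+ s <_) (cong (n ℕ.+_) (sym (ℕₚ.+-identityʳ n))) (ℕₚ.+-monoʳ-< n s<n)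
      regroup : ∀ a b c → a ℕ.+ (b ℕ.+ c) ≡ a ℕ.+ c ℕ.+ b
      regroup = ℕ-Solver.solve-∀

    x′-high : n ≤ s → x′ ℕ.+ n ≡ x
    x′-high n≤s = trans (cong (λ z → N2 ℕ.+ z ℕ.+ n) wrap) (trans (ℕₚ.+-assoc N2 (s ∸ n) n) (cong (N2 ℕ.+_) (ℕₚ.m∸n+n≡m n≤s)))
      where
      unfold : n ℕ.+ s ≡ (s ∸ n) ℕ.+ 1 ℕ.* N2
      unfold = trans (cong (n ℕ.+_) (sym (ℕₚ.m∸n+n≡m n≤s))) (regroup n (s ∸ n))
        where
        regroup : ∀ n r → n ℕ.+ (r ℕ.+ n) ≡ r ℕ.+ 1 ℕ.* (2 ℕ.* n)
        regroup = ℕ-Solver.solve-∀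
      s∸n<N2 : s ∸ n < N2
      s∸n<N2 = ℕₚ.≤-<-trans (ℕₚ.m∸n≤m s n) s<N2
      wrap : (n ℕ.+ s) % N2 ≡ s ∸ n
      wrap = trans (cong (_% N2) unfold) (trans ([m+kn]%n≡m%n (s ∸ n) 1 N2) (m<n⇒m%n≡m s∸n<N2))


2^-∣-total : ∀ a b → (2 ^ a ∣ 2 ^ b) ⊎ (2 ^ b ∣ 2 ^ a)
2^-∣-total a b with ℕₚ.≤-total a b
... | inj₁ a≤b = inj₁ (divides (2 ^ (b ∸ a)) (trans (cong (2 ^_) (sym (ℕₚ.m∸n+n≡m a≤b))) (ℕₚ.^-distribˡ-+-* 2 (b ∸ a) a)))
... | inj₂ b≤a = inj₂ (divides (2 ^ (a ∸ b)) (trans (cong (2 ^_) (sym (ℕₚ.m∸n+n≡m b≤a))) (ℕₚ.^-distribˡ-+-* 2 (a ∸ b) b)))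

private
  even-or-odd : ∀ d → (Σ ℕ λ m → d ≡ 2 ℕ.* m) ⊎ (Σ ℕ λ m → d ≡ suc (2 ℕ.* m))
  even-or-odd zero = inj₁ (0 , refl)
  even-or-odd (suc d) with even-or-odd d
  ... | inj₁ (m , d≡2m)   = inj₂ (m , cong suc d≡2m)
  ... | inj₂ (m , d≡2m+1) = inj₁ (suc m , trans (cong suc d≡2m+1) (step m))
    where
    step : ∀ m → suc (suc (2 ℕ.* m)) ≡ 2 ℕ.* suc m
    step = ℕ-Solver.solve-∀

  odd-coprime-2 : ∀ m → Coprime (suc (2 ℕ.* m)) 2
  odd-coprime-2 zero    (d∣1 , _) = ∣1⇒≡1 d∣1
  odd-coprime-2 (suc m) = subst (λ z → Coprime z 2) (step m) (coprime-+ (odd-coprime-2 m))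
    where
    step : ∀ m → 2 ℕ.+ suc (2 ℕ.* m) ≡ suc (2 ℕ.* suc m)
    step = ℕ-Solver.solve-∀

∣2^⇒2^ : ∀ e d → d ∣ 2 ^ e → Σ ℕ λ a → d ≡ 2 ^ a
∣2^⇒2^ zero    d d∣1 = 0 , ∣1⇒≡1 d∣1
∣2^⇒2^ (suc e) d d∣2^e⁺¹ with even-or-odd d
... | inj₁ (m , refl) with ∣2^⇒2^ e m (*-cancelˡ-∣ 2 d∣2^e⁺¹)
...   | a , refl = suc a , refl
∣2^⇒2^ (suc e) d d∣2^e⁺¹ | inj₂ (m , refl) = ∣2^⇒2^ e (suc (2 ℕ.* m)) (coprime-divisor (odd-coprime-2 m) d∣2^e⁺¹)

module CyclicTwoGroup (t k : ℕ) (2^k≡n : 2 ^ k ≡ suc (suc t)) where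
  open QuaternionArithmetic t
  open Quaternion n

  private
    N2≡2^k⁺¹ : N2 ≡ 2 ^ suc k
    N2≡2^k⁺¹ = cong (2 ℕ.*_) (sym 2^k≡n)

  bézout-multiple : ∀ p q g → Bézout.Identity g p N2 → g ∣ q → Σ ℕ λ m → (p ℕ.* m) % N2 ≡ q % N2
  bézout-multiple p q g (Bézout.+- x y g+yN≡xp) (divides c q≡cg) =
    x ℕ.* c , trans (cong (_% N2) (trans (regroup₁ p x c) (trans (cong (ℕ._* c) (sym g+yN≡xp)) (regroup₂ g y c N2))))
                  (trans ([m+kn]%n≡m%n (c ℕ.* g) (y ℕ.* c) N2) (cong (_% N2) (sym q≡cg)))
    where
    regroup₁ : ∀ p x c → p ℕ.* (x ℕ.* c) ≡ x ℕ.* p ℕ.* c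
    regroup₁ = ℕ-Solver.solve-∀
    regroup₂ : ∀ g y c N → (g ℕ.+ y ℕ.* N) ℕ.* c ≡ c ℕ.* g ℕ.+ y ℕ.* c ℕ.* N
    regroup₂ = ℕ-Solver.solve-∀
  -- Here g + x p = y N2, and N2 - 1 plays the role of -1 modulo N2.
  bézout-multiple p q g (Bézout.-+ x y g+xp≡yN) (divides c q≡cg) =
    x ℕ.* c ℕ.* (N2 ∸ 1) , trans (sym ([m+kn]%n≡m%n (p ℕ.* (x ℕ.* c ℕ.* (N2 ∸ 1))) (c ℕ.* g) N2))
      (trans (cong (_% N2) (trans (regroup₁ p x c g (N2 ∸ 1)) (trans (cong (λ z → c ℕ.* (N2 ∸ 1) ℕ.* z ℕ.+ c ℕ.* g) g+xp≡yN)
                                                                      (regroup₂ c (N2 ∸ 1) y g))))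
             (trans ([m+kn]%n≡m%n (c ℕ.* g) (y ℕ.* c ℕ.* (N2 ∸ 1)) N2) (cong (_% N2) (sym q≡cg))))
    where
    regroup₁ : ∀ p x c g N′ → p ℕ.* (x ℕ.* c ℕ.* N′) ℕ.+ c ℕ.* g ℕ.* suc N′ ≡ c ℕ.* N′ ℕ.* (g ℕ.+ x ℕ.* p) ℕ.+ c ℕ.* g
    regroup₁ = ℕ-Solver.solve-∀
    regroup₂ : ∀ c N′ y g → c ℕ.* N′ ℕ.* (y ℕ.* suc N′) ℕ.+ c ℕ.* g ≡ c ℕ.* g ℕ.+ y ℕ.* c ℕ.* N′ ℕ.* suc N′
    regroup₂ = ℕ-Solver.solve-∀

  isPowerOf-multiple : ∀ {p q} → p < N2 → q ≢ 0 → q < N2 → (Σ ℕ λ m → (p ℕ.* m) % N2 ≡ q % N2) → isPowerOf q p ≡ true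
  isPowerOf-multiple {p} {q} p<N2 q≢0 q<N2 (m , pm≡q) = isPowerOf-witness (m′ ∸ 1) m′∸1<4n pow≡q
    where
    m′ = m % N2
    pm′≡q : (p ℕ.* m′) % N2 ≡ q
    pm′≡q = trans (trans (%-distribˡ-* p m′ N2) (trans (cong (λ z → ((p % N2) ℕ.* z) % N2) (m%n%n≡m%n m N2)) (sym (%-distribˡ-* p m N2))))
                  (trans pm≡q (m<n⇒m%n≡m q<N2))
    m′≢0 : m′ ≢ 0
    m′≢0 m′≡0 = q≢0 (trans (sym pm′≡q) (trans (cong (λ z → (p ℕ.* z) % N2) m′≡0) (cong (_% N2) (ℕₚ.*-zeroʳ p))))
    m′∸1<4n : m′ ∸ 1 < 4 ℕ.* n
    m′∸1<4n = ℕₚ.≤-<-trans (ℕₚ.m∸n≤m m′ 1) (ℕₚ.<-≤-trans (m%n<n m N2) (ℕₚ.*-monoˡ-≤ n {2} {4} (s≤s (s≤s z≤n))))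
    pow≡q : pow p (suc (m′ ∸ 1)) ≡ q
    pow≡q = trans (cong (pow p) (ℕₚ.suc-pred m′ ⦃ ℕ.≢-nonZero m′≢0 ⦄)) (trans (pow-a p<N2 m′) pm′≡q)

  -- The subgroups of the cyclic 2-group ⟨a⟩ form a chain, so of any two non-identity
  -- powers of a one is a power of the other.
  powers-comparable : ∀ {p q} → p < N2 → p ≢ 0 → q < N2 → q ≢ 0 → (isPowerOf q p ∨ isPowerOf p q) ≡ true
  powers-comparable {p} {q} p<N2 p≢0 q<N2 q≢0 with Bézout.lemma p N2 | Bézout.lemma q N2
  ... | Bézout.result g gcd-p id-p | Bézout.result g′ gcd-q id-q
    with ∣2^⇒2^ (suc k) g (subst (g ∣_) N2≡2^k⁺¹ (GCD.gcd∣n gcd-p)) | ∣2^⇒2^ (suc k) g′ (subst (g′ ∣_) N2≡2^k⁺¹ (GCD.gcd∣n gcd-q))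
  ... | a , g≡2^a | b , g′≡2^b with 2^-∣-total a b
  ...   | inj₁ 2^a∣2^b = cong (_∨ isPowerOf p q) (isPowerOf-multiple p<N2 q≢0 q<N2
                           (bézout-multiple p q g id-p (∣-trans (subst₂ _∣_ (sym g≡2^a) (sym g′≡2^b) 2^a∣2^b) (GCD.gcd∣m gcd-q))))
  ...   | inj₂ 2^b∣2^a = trans (cong (isPowerOf q p ∨_) (isPowerOf-multiple q<N2 p≢0 p<N2
                           (bézout-multiple q p g′ id-q (∣-trans (subst₂ _∣_ (sym g′≡2^b) (sym g≡2^a) 2^b∣2^a) (GCD.gcd∣m gcd-p)))))
                         (∨-zeroʳ (isPowerOf q p))

-- The proper power graph of Q_n

-- The generator a, the involution aⁿ, the other powers of a, and the elements aˢb with s < n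
-- and with s ≥ n.
data Kind : Set where
  gen inv rot low high : Kind

private
  classify : Bool → Bool → Bool → Bool → Kind
  classify true  _     _     _     = gen
  classify false true  _     _     = inv
  classify false false true  _     = rot
  classify false false false true  = low
  classify false false false false = high

  classify-rot : ∀ {a b c d} → a ≡ false → b ≡ false → c ≡ true → classify a b c d ≡ rot
  classify-rot refl refl refl = refl

  classify-low : ∀ {a b c d} → a ≡ false → b ≡ false → c ≡ false → d ≡ true → classify a b c d ≡ low
  classify-low refl refl refl refl = refl

  classify-high : ∀ {a b c d} → a ≡ false → b ≡ false → c ≡ false → d ≡ false → classify a b c d ≡ high
  classify-high refl refl refl refl = refl

module ProperPowerGraph (t : ℕ) where

  n : ℕ
  n = suc (suc t)

  -- Vertex j is the element with code j + 1: u is aⁿ, the vertices below nA = 2n - 1 are the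
  -- powers of a, and vertex j ≥ nA is aˢb with s = j + 1 - 2n, where s < n exactly when j < nAB.
  u nA nAB V : ℕ
  u   = suc t
  nA  = suc (suc (suc (t ℕ.+ t)))
  nAB = nA ℕ.+ n
  V   = 4 ℕ.* n ∸ 1

  V≡nAB+n : V ≡ nAB ℕ.+ n
  V≡nAB+n = solve t
    where
    solve : ∀ t → suc (t ℕ.+ 3 ℕ.* suc (suc t)) ≡ suc (suc (suc (t ℕ.+ t))) ℕ.+ suc (suc t) ℕ.+ suc (suc t)
    solve = ℕ-Solver.solve-∀

  nA≡ : + nA ≡ + 3 + (+ t + + t)
  nA≡ = ℤₚ.pos-+ 3 (t ℕ.+ t)

  V≡ : + V ≡ + 7 + + 4 * + t
  V≡ = trans (cong +_ (solve t)) (trans (ℤₚ.pos-+ 7 (4 ℕ.* t)) (cong (_+_ (+ 7)) (ℤₚ.pos-* 4 t)))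
    where
    solve : ∀ t → suc (t ℕ.+ 3 ℕ.* suc (suc t)) ≡ 7 ℕ.+ 4 ℕ.* t
    solve = ℕ-Solver.solve-∀

  u<nA : u ℕ.< nA
  u<nA = s≤s (s≤s (ℕₚ.m≤n⇒m≤1+n (ℕₚ.m≤m+n t t)))

  nA≤nAB : nA ℕ.≤ nAB
  nA≤nAB = ℕₚ.m≤m+n nA n

  nAB≤V : nAB ℕ.≤ V
  nAB≤V = subst (nAB ℕ.≤_) (sym V≡nAB+n) (ℕₚ.m≤m+n nAB n)

  u<V : u ℕ.< V
  u<V = ℕₚ.<-≤-trans u<nA (ℕₚ.≤-trans nA≤nAB nAB≤V)

  kind : ℕ → Kind
  kind i = classify (i ≡ᵇ 0) (i ≡ᵇ u) (i <ᵇ nA) (i <ᵇ nAB)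

  data View (i : ℕ) : Kind → Set where
    gen  : i ≡ 0 → View i gen
    inv  : i ≡ u → View i inv
    rot  : i ≢ 0 → i ≢ u → i ℕ.< nA → View i rot
    low  : nA ℕ.≤ i → i ℕ.< nAB → View i low
    high : nAB ℕ.≤ i → View i high

  view : ∀ i → View i (kind i)
  view i with i ≡ᵇ 0 in i≟0 | i ≡ᵇ u in i≟u | i <ᵇ nA in i<?nA | i <ᵇ nAB in i<?nAB
  ... | true  | _     | _     | _     = gen (≡ᵇ-true⇒≡ i≟0)
  ... | false | true  | _     | _     = inv (≡ᵇ-true⇒≡ i≟u)
  ... | false | false | true  | _     = rot (≡ᵇ-false⇒≢ i≟0) (≡ᵇ-false⇒≢ i≟u) (<ᵇ-true⇒< i<?nA)
  ... | false | false | false | true  = low (<ᵇ-false⇒≥ i<?nA) (<ᵇ-true⇒< i<?nAB)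
  ... | false | false | false | false = high (<ᵇ-false⇒≥ i<?nAB)

  kind-inv : kind u ≡ inv
  kind-inv rewrite dec-true (u ℕₚ.≟ u) refl = refl

  kind-rot : ∀ {i} → i ≢ 0 → i ≢ u → i ℕ.< nA → kind i ≡ rot
  kind-rot {i} i≢0 i≢u i<nA = classify-rot (dec-false (i ℕₚ.≟ 0) i≢0) (dec-false (i ℕₚ.≟ u) i≢u) (dec-true (i ℕₚ.<? nA) i<nA)

  private
    nA≤⇒≢0 : ∀ {i} → nA ℕ.≤ i → i ≢ 0
    nA≤⇒≢0 nA≤i refl with nA≤i
    ... | ()

    nA≤⇒≢u : ∀ {i} → nA ℕ.≤ i → i ≢ u
    nA≤⇒≢u nA≤i refl = ℕₚ.<⇒≱ u<nA nA≤i

  kind-low : ∀ {i} → nA ℕ.≤ i → i ℕ.< nAB → kind i ≡ low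
  kind-low {i} nA≤i i<nAB = classify-low (dec-false (i ℕₚ.≟ 0) (nA≤⇒≢0 nA≤i)) (dec-false (i ℕₚ.≟ u) (nA≤⇒≢u nA≤i))
                                         (dec-false (i ℕₚ.<? nA) (ℕₚ.≤⇒≯ nA≤i)) (dec-true (i ℕₚ.<? nAB) i<nAB)

  kind-high : ∀ {i} → nAB ℕ.≤ i → kind i ≡ high
  kind-high {i} nAB≤i = classify-high (dec-false (i ℕₚ.≟ 0) (nA≤⇒≢0 nA≤i)) (dec-false (i ℕₚ.≟ u) (nA≤⇒≢u nA≤i))
                                      (dec-false (i ℕₚ.<? nA) (ℕₚ.≤⇒≯ nA≤i)) (dec-false (i ℕₚ.<? nAB) (ℕₚ.≤⇒≯ nAB≤i))
    where nA≤i = ℕₚ.≤-trans nA≤nAB nAB≤i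

  low-partner : ∀ {i} → nA ℕ.≤ i → i ℕ.< nAB → kind (i ℕ.+ n) ≡ high × i ℕ.+ n ℕ.< V
  low-partner {i} nA≤i i<nAB = kind-high (ℕₚ.+-monoˡ-≤ n nA≤i) , subst (i ℕ.+ n ℕ.<_) (sym V≡nAB+n) (ℕₚ.+-monoˡ-< n i<nAB)

  high-partner : ∀ {i} → nAB ℕ.≤ i → i ℕ.< V → kind (i ∸ n) ≡ low × i ∸ n ℕ.+ n ≡ i
  high-partner {i} nAB≤i i<V = kind-low nA≤i∸n i∸n<nAB , ℕₚ.m∸n+n≡m n≤i
    where
    n≤i = ℕₚ.≤-trans (ℕₚ.m≤n+m n nA) nAB≤i
    nA≤i∸n : nA ℕ.≤ i ∸ n
    nA≤i∸n = subst (ℕ._≤ i ∸ n) (ℕₚ.m+n∸n≡m nA n) (ℕₚ.∸-monoˡ-≤ n nAB≤i)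
    i∸n<nAB : i ∸ n ℕ.< nAB
    i∸n<nAB = subst (i ∸ n ℕ.<_) (ℕₚ.m+n∸n≡m nAB n) (ℕₚ.∸-monoˡ-< (subst (i ℕ.<_) V≡nAB+n i<V) n≤i)

  -- The vertices in index order: a, then t further powers, aⁿ, t + 1 further powers, then n + n elements aˢb.
  private
    o₁ o₂ o₃ o₄ o₅ : ℕ → ℕ
    o₁ d = 1 ℕ.+ d
    o₂ d = o₁ (t ℕ.+ d)
    o₃ d = o₂ (1 ℕ.+ d)
    o₄ d = o₃ (suc t ℕ.+ d)
    o₅ d = o₄ (n ℕ.+ d)

    ℓ₁ ℓ₂ ℓ₃ : ℕ
    ℓ₁ = t ℕ.+ ℓ₂
    ℓ₂ = 1 ℕ.+ ℓ₃
    ℓ₃ = suc t ℕ.+ (n ℕ.+ n)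

    V≡segments : V ≡ 1 ℕ.+ ℓ₁
    V≡segments = solve t
      where
      solve : ∀ t → suc (t ℕ.+ 3 ℕ.* suc (suc t)) ≡ 1 ℕ.+ (t ℕ.+ (1 ℕ.+ (suc t ℕ.+ (suc (suc t) ℕ.+ suc (suc t)))))
      solve = ℕ-Solver.solve-∀

    segment₁ : ∀ d → d ℕ.< t → kind (o₁ d) ≡ rot
    segment₁ d d<t = kind-rot (λ ()) (λ 1+d≡u → ℕₚ.<-irrefl (ℕₚ.suc-injective 1+d≡u) d<t)
                              (s≤s (ℕₚ.≤-trans d<t (ℕₚ.m≤n⇒m≤1+n (ℕₚ.m≤n⇒m≤1+n (ℕₚ.m≤m+n t t)))))

    segment₂ : kind (o₂ 0) ≡ inv
    segment₂ = trans (cong (kind ∘ suc) (ℕₚ.+-identityʳ t)) kind-inv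

    segment₃ : ∀ d → d ℕ.< suc t → kind (o₃ d) ≡ rot
    segment₃ d d<1+t = trans (cong kind (cong suc (ℕₚ.+-suc t d)))
      (kind-rot (λ ()) (λ e → ℕₚ.<-irrefl (sym (ℕₚ.suc-injective e)) (s≤s (ℕₚ.m≤m+n t d)))
                (s≤s (s≤s (s≤s (ℕₚ.+-monoʳ-≤ t (ℕₚ.≤-pred d<1+t))))))

    segment₄ : ∀ d → d ℕ.< n → kind (o₄ d) ≡ low
    segment₄ d d<n = trans (cong kind (shift t d)) (kind-low (ℕₚ.m≤m+n nA d) (ℕₚ.+-monoʳ-< nA d<n))
      where
      shift : ∀ t d → 1 ℕ.+ (t ℕ.+ (1 ℕ.+ (suc t ℕ.+ d))) ≡ suc (suc (suc (t ℕ.+ t))) ℕ.+ d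
      shift = ℕ-Solver.solve-∀

    segment₅ : ∀ d → d ℕ.< n → kind (o₅ d) ≡ high
    segment₅ d _ = trans (cong kind (shift t d)) (kind-high (ℕₚ.m≤m+n nAB d))
      where
      shift : ∀ t d → 1 ℕ.+ (t ℕ.+ (1 ℕ.+ (suc t ℕ.+ (suc (suc t) ℕ.+ d)))) ≡ suc (suc (suc (t ℕ.+ t))) ℕ.+ suc (suc t) ℕ.+ d
      shift = ℕ-Solver.solve-∀

  sumKinds : ∀ (φ : Kind → ℤ) → sumBelow V (φ ∘ kind) ≡
    φ gen + (+ t * φ rot + (φ inv + (+ suc t * φ rot + (+ n * φ low + + n * φ high))))
  sumKinds φ =
    trans (cong (λ m → sumBelow m f) V≡segments)
    (trans (sumBelow-+ 1 ℓ₁ f)                     (cong₂ _+_ (ℤₚ.+-identityʳ (φ gen))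
    (trans (sumBelow-+ t ℓ₂ (f ∘ o₁))              (cong₂ _+_ (constant t rot o₁ segment₁)
    (trans (sumBelow-+ 1 ℓ₃ (f ∘ o₂))              (cong₂ _+_ (trans (ℤₚ.+-identityʳ _) (cong φ segment₂))
    (trans (sumBelow-+ (suc t) (n ℕ.+ n) (f ∘ o₃)) (cong₂ _+_ (constant (suc t) rot o₃ segment₃)
    (trans (sumBelow-+ n n (f ∘ o₄))               (cong₂ _+_ (constant n low o₄ segment₄) (constant n high o₅ segment₅)))))))))))
    where
    f : ℕ → ℤ
    f = φ ∘ kind
    constant : ∀ m c (g : ℕ → ℕ) → (∀ d → d ℕ.< m → kind (g d) ≡ c) → sumBelow m (f ∘ g) ≡ + m * φ c
    constant m c g kind≡ = trans (sumBelow-cong m (λ d d<m → cong φ (kind≡ d d<m))) (sumBelow-const m (φ c))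

  prodKinds : ∀ (φ : Kind → ℤ) → prodBelow V (φ ∘ kind) ≡
    φ gen * (φ rot ℤ.^ t * (φ inv * (φ rot ℤ.^ suc t * (φ low ℤ.^ n * φ high ℤ.^ n))))
  prodKinds φ =
    trans (cong (λ m → prodBelow m f) V≡segments)
    (trans (prodBelow-+ 1 ℓ₁ f)                     (cong₂ _*_ (ℤₚ.*-identityʳ (φ gen))
    (trans (prodBelow-+ t ℓ₂ (f ∘ o₁))              (cong₂ _*_ (constant t rot o₁ segment₁)
    (trans (prodBelow-+ 1 ℓ₃ (f ∘ o₂))              (cong₂ _*_ (trans (ℤₚ.*-identityʳ _) (cong φ segment₂))
    (trans (prodBelow-+ (suc t) (n ℕ.+ n) (f ∘ o₃)) (cong₂ _*_ (constant (suc t) rot o₃ segment₃)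
    (trans (prodBelow-+ n n (f ∘ o₄))               (cong₂ _*_ (constant n low o₄ segment₄) (constant n high o₅ segment₅)))))))))))
    where
    f : ℕ → ℤ
    f = φ ∘ kind
    constant : ∀ m c (g : ℕ → ℕ) → (∀ d → d ℕ.< m → kind (g d) ≡ c) → prodBelow m (f ∘ g) ≡ φ c ℤ.^ m
    constant m c g kind≡ = trans (prodBelow-cong m (λ d d<m → cong φ (kind≡ d d<m))) (prodBelow-const m (φ c))

  adjKind : Kind → ℕ → ℕ → Bool
  adjKind gen  i k = not (k ≡ᵇ i) ∧ (k <ᵇ nA)
  adjKind rot  i k = not (k ≡ᵇ i) ∧ (k <ᵇ nA)
  adjKind inv  i k = not (k ≡ᵇ u)
  adjKind low  i k = (k ≡ᵇ u) ∨ (k ≡ᵇ i ℕ.+ n)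
  adjKind high i k = (k ≡ᵇ u) ∨ (k ≡ᵇ i ∸ n)

  adjShape : ℕ → ℕ → Bool
  adjShape i = adjKind (kind i) i

  inA : ℕ → ℤ
  inA k = b2z (k <ᵇ nA)

  pinnedRow : ℤ → Kind → ℕMatrix
  pinnedRow y gen  i k = (+ nA - y) * δ i k - inA k
  pinnedRow y rot  i k = (+ nA - y) * δ i k - inA k
  pinnedRow y inv  i k = + 1
  pinnedRow y low  i k = (+ 2 - y) * δ i k - δ u k - δ (i ℕ.+ n) k
  pinnedRow y high i k = (+ 2 - y) * δ i k - δ u k - δ (i ∸ n) k

  byKind : (Kind → ℕMatrix) → ℕMatrix
  byKind r i = r (kind i) i

  isPower : Kind → ℤ
  isPower gen = + 1
  isPower inv = + 1
  isPower rot = + 1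
  isPower _   = + 0

  inA-kind : ∀ k → inA k ≡ isPower (kind k)
  inA-kind k with kind k | view k
  ... | gen  | gen refl          = refl
  ... | inv  | inv refl          = cong b2z (dec-true (u ℕₚ.<? nA) u<nA)
  ... | rot  | rot _ _ k<nA      = cong b2z (dec-true (k ℕₚ.<? nA) k<nA)
  ... | low  | low nA≤k _        = cong b2z (dec-false (k ℕₚ.<? nA) (ℕₚ.≤⇒≯ nA≤k))
  ... | high | high nAB≤k        = cong b2z (dec-false (k ℕₚ.<? nA) (ℕₚ.≤⇒≯ (ℕₚ.≤-trans nA≤nAB nAB≤k)))

  sum-inA : sumBelow V inA ≡ + nA
  sum-inA = trans (sumBelow-cong V (λ k _ → inA-kind k)) (trans (sumKinds isPower) (trans (count (+ t) (+ n)) (sym nA≡)))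
    where
    count : ∀ t n → + 1 + (t * + 1 + (+ 1 + ((+ 1 + t) * + 1 + (n * + 0 + n * + 0)))) ≡ + 3 + (t + t)
    count = solve-∀

  degreeKind : Kind → ℤ
  degreeKind gen  = + nA - + 1
  degreeKind rot  = + nA - + 1
  degreeKind inv  = + V - + 1
  degreeKind low  = + 2
  degreeKind high = + 2

  private
    δ-count : ∀ {a} → a ℕ.< V → sumBelow V (λ k → δ k a) ≡ + 1
    δ-count {a} a<V = trans (sumBelow-cong V (λ k _ → trans (δ-sym k a) (sym (ℤₚ.*-identityʳ (δ a k)))))
                            (sumBelow-δ V a (λ _ → + 1) a<V)

    tidy : ∀ v → + 1 * v + - (+ 1) * + 1 ≡ v - + 1
    tidy = solve-∀

    b2z-inA-≢ : ∀ {i} k → i ℕ.< nA → b2z (not (k ≡ᵇ i) ∧ (k <ᵇ nA)) ≡ + 1 * inA k + - (+ 1) * δ k i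
    b2z-inA-≢ {i} k i<nA with k ℕₚ.≟ i
    ... | yes refl rewrite dec-true (k ℕₚ.≟ k) refl | dec-true (k ℕₚ.<? nA) i<nA = refl
    ... | no k≢i   rewrite dec-false (k ℕₚ.≟ i) k≢i = sym (trans (ℤₚ.+-identityʳ (+ 1 * inA k)) (ℤₚ.*-identityˡ (inA k)))

    b2z-≢u : ∀ k → b2z (not (k ≡ᵇ u)) ≡ + 1 * + 1 + - (+ 1) * δ k u
    b2z-≢u k with k ℕₚ.≟ u
    ... | yes refl rewrite dec-true (k ℕₚ.≟ k) refl = refl
    ... | no k≢u   rewrite dec-false (k ℕₚ.≟ u) k≢u = refl

    b2z-u∨ : ∀ {p} k → u ≢ p → b2z ((k ≡ᵇ u) ∨ (k ≡ᵇ p)) ≡ + 1 * δ k u + + 1 * δ k p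
    b2z-u∨ {p} k u≢p with k ℕₚ.≟ u
    ... | yes refl rewrite dec-true (k ℕₚ.≟ k) refl | dec-false (k ℕₚ.≟ p) u≢p = refl
    ... | no k≢u   rewrite dec-false (k ℕₚ.≟ u) k≢u = sym (trans (ℤₚ.+-identityˡ (+ 1 * δ k p)) (ℤₚ.*-identityˡ (δ k p)))

    degree-powers : ∀ {i} → i ℕ.< nA → sumBelow V (λ k → b2z (not (k ≡ᵇ i) ∧ (k <ᵇ nA))) ≡ + nA - + 1
    degree-powers {i} i<nA =
      trans (sumBelow-linear V (+ 1) (- (+ 1)) inA (λ k → δ k i) (λ k _ → b2z-inA-≢ k i<nA))
            (trans (cong₂ (λ s d → + 1 * s + - (+ 1) * d) sum-inA (δ-count (ℕₚ.<-≤-trans i<nA (ℕₚ.≤-trans nA≤nAB nAB≤V))))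
                   (tidy (+ nA)))

    degree-all : sumBelow V (λ k → b2z (not (k ≡ᵇ u))) ≡ + V - + 1
    degree-all = trans (sumBelow-linear V (+ 1) (- (+ 1)) (λ _ → + 1) (λ k → δ k u) (λ k _ → b2z-≢u k))
                       (trans (cong₂ (λ s d → + 1 * s + - (+ 1) * d) (trans (sumBelow-const V (+ 1)) (ℤₚ.*-identityʳ (+ V))) (δ-count u<V))
                              (tidy (+ V)))

    degree-pair : ∀ {p} → p ℕ.< V → u ≢ p → sumBelow V (λ k → b2z ((k ≡ᵇ u) ∨ (k ≡ᵇ p))) ≡ + 2
    degree-pair {p} p<V u≢p =
      trans (sumBelow-linear V (+ 1) (+ 1) (λ k → δ k u) (λ k → δ k p) (λ k _ → b2z-u∨ k u≢p))
            (cong₂ (λ a b → + 1 * a + + 1 * b) (δ-count u<V) (δ-count p<V))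

  u≢low-partner : ∀ {i} → nA ℕ.≤ i → i ℕ.< nAB → u ≢ i ℕ.+ n
  u≢low-partner nA≤i i<nAB u≡ with trans (sym kind-inv) (trans (cong kind u≡) (proj₁ (low-partner nA≤i i<nAB)))
  ... | ()

  u≢high-partner : ∀ {i} → nAB ℕ.≤ i → i ℕ.< V → u ≢ i ∸ n
  u≢high-partner nAB≤i i<V u≡ with trans (sym kind-inv) (trans (cong kind u≡) (proj₁ (high-partner nAB≤i i<V)))
  ... | ()

  degree-adjShape : ∀ i → i ℕ.< V → sumBelow V (λ k → b2z (adjShape i k)) ≡ degreeKind (kind i)
  degree-adjShape i i<V with kind i | view i
  ... | gen  | gen refl       = degree-powers (s≤s z≤n)
  ... | rot  | rot _ _ i<nA   = degree-powers i<nA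
  ... | inv  | inv refl       = degree-all
  ... | low  | low nA≤i i<nAB = degree-pair (proj₂ (low-partner nA≤i i<nAB)) (u≢low-partner nA≤i i<nAB)
  ... | high | high nAB≤i     = degree-pair (ℕₚ.≤-<-trans (ℕₚ.m∸n≤m i n) i<V) (u≢high-partner nAB≤i i<V)

  module _ (adj : Fin V → Fin V → Bool) (adj≡ : ∀ i k → adj i k ≡ adjShape (toℕ i) (toℕ k)) where

    uᶠ : Fin V
    uᶠ = fromℕ< u<V

    pinnedLaplacian : ∀ y i k → updateRow (shiftedLaplacian V adj y) uᶠ (λ _ → + 1) i k ≡ byKind (pinnedRow y) (toℕ i) (toℕ k)
    pinnedLaplacian y i k with i Finₚ.≟ uᶠ
    ... | yes refl = cong (λ c → pinnedRow y c (toℕ uᶠ) (toℕ k)) (sym (trans (cong kind (Finₚ.toℕ-fromℕ< u<V)) kind-inv))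
    ... | no i≢u = begin
      laplacian V adj i k - y * δ I K
        ≡⟨ cong (_- y * δ I K) (laplacian-δ V adj i k) ⟩
      δ I K * degree V adj i - b2z (adj i k) - y * δ I K
        ≡⟨ cong₂ (λ d a → δ I K * d - b2z a - y * δ I K) degree≡ (adj≡ i k) ⟩
      δ I K * degreeKind (kind I) - b2z (adjShape I K) - y * δ I K
        ≡⟨ row (kind I) (view I) ⟩
      byKind (pinnedRow y) I K ∎
      where
      open ≡-Reasoning
      I = toℕ i
      K = toℕ k
      degree≡ : degree V adj i ≡ degreeKind (kind I)
      degree≡ = trans (sumFin≡sum V (λ k → b2z (adj i k)))
                (trans (sum-cong-≗ (λ k → cong b2z (adj≡ i k)))
                (trans (sum≡sumBelow V (λ K → b2z (adjShape I K)))
                       (degree-adjShape I (Finₚ.toℕ<n i))))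
      powerRow : I ℕ.< nA → δ I K * (+ nA - + 1) - b2z (not (K ≡ᵇ I) ∧ (K <ᵇ nA)) - y * δ I K ≡ (+ nA - y) * δ I K - inA K
      powerRow I<nA = trans (cong (λ a → δ I K * (+ nA - + 1) - a - y * δ I K) (trans (b2z-inA-≢ K I<nA) (cong (λ d → + 1 * inA K + - (+ 1) * d) (δ-sym K I))))
                            (collect (+ nA) y (δ I K) (inA K))
        where
        collect : ∀ a y d e → d * (a - + 1) - (+ 1 * e + - (+ 1) * d) - y * d ≡ (a - y) * d - e
        collect = solve-∀
      pairRow : ∀ p → u ≢ p → δ I K * + 2 - b2z ((K ≡ᵇ u) ∨ (K ≡ᵇ p)) - y * δ I K ≡ (+ 2 - y) * δ I K - δ u K - δ p K
      pairRow p u≢p = trans (cong (λ a → δ I K * + 2 - a - y * δ I K) (trans (b2z-u∨ K u≢p) (cong₂ (λ a b → + 1 * a + + 1 * b) (δ-sym K u) (δ-sym K p))))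
                            (collect y (δ I K) (δ u K) (δ p K))
        where
        collect : ∀ y d a b → d * + 2 - (+ 1 * a + + 1 * b) - y * d ≡ (+ 2 - y) * d - a - b
        collect = solve-∀
      row : ∀ c → View I c → δ I K * degreeKind c - b2z (adjKind c I K) - y * δ I K ≡ pinnedRow y c I K
      row gen  (gen I≡0)        = powerRow (subst (ℕ._< nA) (sym I≡0) (s≤s z≤n))
      row rot  (rot _ _ I<nA)   = powerRow I<nA
      row inv  (inv I≡u)        = ⊥-elim (i≢u (Finₚ.toℕ-injective (trans I≡u (sym (Finₚ.toℕ-fromℕ< u<V)))))
      row low  (low nA≤I I<nAB) = pairRow (I ℕ.+ n) (u≢low-partner nA≤I I<nAB)
      row high (high nAB≤I)     = pairRow (I ∸ n) (u≢high-partner nAB≤I (Finₚ.toℕ<n i))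

  adjShape-universal : ∀ i → i ≢ u → adjShape i u ≡ true
  adjShape-universal i i≢u with kind i | view i
  ... | gen  | _              = trans (cong (λ b → not b ∧ (u <ᵇ nA)) (dec-false (u ℕₚ.≟ i) (i≢u ∘ sym))) (dec-true (u ℕₚ.<? nA) u<nA)
  ... | rot  | _              = trans (cong (λ b → not b ∧ (u <ᵇ nA)) (dec-false (u ℕₚ.≟ i) (i≢u ∘ sym))) (dec-true (u ℕₚ.<? nA) u<nA)
  ... | inv  | inv i≡u        = ⊥-elim (i≢u i≡u)
  ... | low  | _              = cong (_∨ (u ≡ᵇ i ℕ.+ n)) (dec-true (u ℕₚ.≟ u) refl)
  ... | high | _              = cong (_∨ (u ≡ᵇ i ∸ n)) (dec-true (u ℕₚ.≟ u) refl)

module _ (n : ℕ) where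
  open Quaternion n

  adj-sym : ∀ i j → adj i j ≡ adj j i
  adj-sym i j = cong₂ _∧_ (cong not (≡ᵇ-comm (elt i) (elt j))) (∨-comm (isPowerOf (elt j) (elt i)) (isPowerOf (elt i) (elt j)))

  adj-irrefl : ∀ i → adj i i ≡ false
  adj-irrefl i rewrite dec-true (elt i ℕₚ.≟ elt i) refl = refl

module PowerGraphAdjacency (t k : ℕ) (2^k≡n : 2 ^ k ≡ suc (suc t)) where
  open ProperPowerGraph t
  open QuaternionArithmetic t using (n<N2; isPowerOf-ab; module Order4)
  open CyclicTwoGroup t k 2^k≡n using (powers-comparable)
  open Quaternion n using (N2; isPowerOf; adj)

  -- adj i j is adjCode applied to the codes suc (toℕ i) and suc (toℕ j).
  adjCode : ℕ → ℕ → Bool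
  adjCode p q = not (p ≡ᵇ q) ∧ (isPowerOf q p ∨ isPowerOf p q)

  private
    ≢-false : ∀ {a b} → a ≢ b → (a ≡ᵇ b) ≡ false
    ≢-false {a} {b} = dec-false (a ℕₚ.≟ b)

  adjCode-aa : ∀ {p q} → p < N2 → p ≢ 0 → q < N2 → q ≢ 0 → adjCode p q ≡ not (p ≡ᵇ q)
  adjCode-aa {p} {q} p<N2 p≢0 q<N2 q≢0 =
    trans (cong (not (p ≡ᵇ q) ∧_) (powers-comparable p<N2 p≢0 q<N2 q≢0)) (∧-identityʳ (not (p ≡ᵇ q)))

  private
    a≢b : ∀ {p s} → p < N2 → p ≢ N2 ℕ.+ s
    a≢b {s = s} p<N2 p≡x = ℕₚ.<⇒≱ p<N2 (subst (N2 ≤_) (sym p≡x) (ℕₚ.m≤m+n N2 s))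

  adjCode-ab : ∀ {p s} → p < N2 → p ≢ 0 → s < N2 → adjCode p (N2 ℕ.+ s) ≡ (p ≡ᵇ n)
  adjCode-ab {p} {s} p<N2 p≢0 s<N2
    rewrite ≢-false (a≢b {s = s} p<N2) | isPowerOf-ab p<N2 (Order4.N2≤x s s<N2)
          | Order4.isPowerOf-order4 s s<N2 p p≢0 (a≢b p<N2) | ≢-false (a≢b {s = (n ℕ.+ s) % N2} p<N2)
          = ∨-identityʳ (p ≡ᵇ n)

  adjCode-ba : ∀ {s q} → s < N2 → q < N2 → q ≢ 0 → adjCode (N2 ℕ.+ s) q ≡ (q ≡ᵇ n)
  adjCode-ba {s} {q} s<N2 q<N2 q≢0
    rewrite ≢-false ((a≢b {s = s} q<N2) ∘ sym) | isPowerOf-ab q<N2 (Order4.N2≤x s s<N2)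
          | Order4.isPowerOf-order4 s s<N2 q q≢0 (a≢b q<N2) | ≢-false (a≢b {s = (n ℕ.+ s) % N2} q<N2)
          = trans (∨-identityʳ _) (∨-identityʳ (q ≡ᵇ n))

  adjCode-bb : ∀ {s s′} (s<N2 : s < N2) (s′<N2 : s′ < N2) → adjCode (N2 ℕ.+ s) (N2 ℕ.+ s′) ≡
               not (N2 ℕ.+ s ≡ᵇ N2 ℕ.+ s′) ∧ ((N2 ℕ.+ s′ ≡ᵇ Order4.x′ s s<N2) ∨ (N2 ℕ.+ s ≡ᵇ Order4.x′ s′ s′<N2))
  adjCode-bb {s} {s′} s<N2 s′<N2 with N2 ℕ.+ s ℕₚ.≟ N2 ℕ.+ s′
  ... | yes x≡x′ rewrite dec-true (N2 ℕ.+ s ℕₚ.≟ N2 ℕ.+ s′) x≡x′ = refl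
  ... | no x≢x′
    rewrite dec-false (N2 ℕ.+ s ℕₚ.≟ N2 ℕ.+ s′) x≢x′
          | Order4.isPowerOf-order4 s s<N2 (N2 ℕ.+ s′) (λ ()) (x≢x′ ∘ sym)
          | Order4.isPowerOf-order4 s′ s′<N2 (N2 ℕ.+ s) (λ ()) x≢x′
          | ≢-false {N2 ℕ.+ s′} {n} (λ x≡n → ℕₚ.<⇒≱ n<N2 (subst (N2 ≤_) x≡n (ℕₚ.m≤m+n N2 s′)))
          | ≢-false {N2 ℕ.+ s} {n} (λ x≡n → ℕₚ.<⇒≱ n<N2 (subst (N2 ≤_) x≡n (ℕₚ.m≤m+n N2 s)))
          = refl

  private
    N2≡1+nA : N2 ≡ suc nA
    N2≡1+nA = solve t
      where
      solve : ∀ t → 2 ℕ.* suc (suc t) ≡ suc (suc (suc (suc (t ℕ.+ t))))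
      solve = ℕ-Solver.solve-∀

    code-a : ∀ {I} → I < nA → suc I < N2
    code-a {I} I<nA = subst (suc I <_) (sym N2≡1+nA) (s≤s I<nA)

    code-b : ∀ {I} → nA ≤ I → I < V → Σ ℕ λ s → s < N2 × N2 ℕ.+ s ≡ suc I
    code-b {I} nA≤I I<V = suc I ∸ N2 , s<N2 , ℕₚ.m+[n∸m]≡n N2≤1+I
      where
      N2≤1+I : N2 ≤ suc I
      N2≤1+I = subst (_≤ suc I) (sym N2≡1+nA) (s≤s nA≤I)
      1+I<2N2 : suc I < N2 ℕ.+ N2
      1+I<2N2 = subst (suc I <_) (solve t) (s≤s I<V)
        where
        solve : ∀ t → suc (suc (t ℕ.+ 3 ℕ.* suc (suc t))) ≡ 2 ℕ.* suc (suc t) ℕ.+ 2 ℕ.* suc (suc t)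
        solve = ℕ-Solver.solve-∀
      s<N2 : suc I ∸ N2 < N2
      s<N2 = subst (suc I ∸ N2 <_) (ℕₚ.m+n∸m≡n N2 N2) (ℕₚ.∸-monoˡ-< 1+I<2N2 N2≤1+I)

  partner : ℕ → ℕ
  partner I = if I <ᵇ nAB then I ℕ.+ n else I ∸ n

  IsB : ℕ → Set
  IsB I = nA ≤ I × I < V

  partner-low : ∀ {I} → I < nAB → partner I ≡ I ℕ.+ n
  partner-low {I} I<nAB rewrite dec-true (I ℕₚ.<? nAB) I<nAB = refl

  partner-high : ∀ {I} → nAB ≤ I → partner I ≡ I ∸ n
  partner-high {I} nAB≤I rewrite dec-false (I ℕₚ.<? nAB) (ℕₚ.≤⇒≯ nAB≤I) = refl

  partner-IsB : ∀ {I} → IsB I → IsB (partner I) × partner (partner I) ≡ I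
  partner-IsB {I} (nA≤I , I<V) with I ℕₚ.<? nAB
  ... | yes I<nAB rewrite partner-low I<nAB =
        (ℕₚ.≤-trans nA≤I (ℕₚ.m≤m+n I n) , proj₂ (low-partner nA≤I I<nAB)) ,
        trans (partner-high (ℕₚ.+-monoˡ-≤ n nA≤I)) (ℕₚ.m+n∸n≡m I n)
  ... | no I≮nAB rewrite partner-high (ℕₚ.≮⇒≥ I≮nAB) =
        (nA≤ , ℕₚ.<-≤-trans I∸n<nAB nAB≤V) , trans (partner-low I∸n<nAB) (proj₂ (high-partner (ℕₚ.≮⇒≥ I≮nAB) I<V))
    where
    I∸n<nAB : I ∸ n < nAB
    I∸n<nAB = subst (I ∸ n <_) (ℕₚ.m+n∸n≡m nAB n) (ℕₚ.∸-monoˡ-< (subst (I <_) V≡nAB+n I<V) (ℕₚ.≤-trans (ℕₚ.m≤n+m n nA) (ℕₚ.≮⇒≥ I≮nAB)))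
    nA≤ : nA ≤ I ∸ n
    nA≤ = subst (_≤ I ∸ n) (ℕₚ.m+n∸n≡m nA n) (ℕₚ.∸-monoˡ-≤ n (ℕₚ.≮⇒≥ I≮nAB))

  partner-≢ : ∀ {I} → IsB I → partner I ≢ I
  partner-≢ {I} (nA≤I , _) with I ℕₚ.<? nAB
  ... | yes I<nAB rewrite partner-low I<nAB = λ I+n≡I → ℕₚ.<-irrefl (sym I+n≡I) (ℕₚ.m<m+n I (s≤s z≤n))
  ... | no I≮nAB rewrite partner-high (ℕₚ.≮⇒≥ I≮nAB) =
        λ I∸n≡I → ℕₚ.<-irrefl I∸n≡I (ℕₚ.∸-monoʳ-< {I} {n} {0} (s≤s z≤n) (ℕₚ.≤-trans (ℕₚ.m≤n+m n nA) (ℕₚ.≮⇒≥ I≮nAB)))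

  partner-code : ∀ {I s} (s<N2 : s < N2) → N2 ℕ.+ s ≡ suc I → nA ≤ I → Order4.x′ s s<N2 ≡ suc (partner I)
  partner-code {I} {s} s<N2 N2+s≡1+I nA≤I with I ℕₚ.<? nAB
  ... | yes I<nAB rewrite partner-low I<nAB = trans (Order4.x′-low s s<N2 s<n) (cong (λ z → z ℕ.+ n) N2+s≡1+I)
    where
    s<n : s < n
    s<n = ℕₚ.+-cancelˡ-< N2 s n (subst (_< N2 ℕ.+ n) (sym N2+s≡1+I) (subst (suc I <_) (cong (λ z → z ℕ.+ n) (sym N2≡1+nA)) (s≤s I<nAB)))
  ... | no I≮nAB rewrite partner-high (ℕₚ.≮⇒≥ I≮nAB) =
        trans (sym (ℕₚ.m+n∸n≡m (Order4.x′ s s<N2) n))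
              (trans (cong (_∸ n) (trans (Order4.x′-high s s<N2 n≤s) N2+s≡1+I)) (ℕₚ.+-∸-assoc 1 n≤I))
    where
    n≤I : n ≤ I
    n≤I = ℕₚ.≤-trans (ℕₚ.m≤n+m n nA) (ℕₚ.≮⇒≥ I≮nAB)
    n≤s : n ≤ s
    n≤s = ℕₚ.+-cancelˡ-≤ N2 n s (subst (N2 ℕ.+ n ≤_) (sym N2+s≡1+I) (subst (_≤ suc I) (cong (λ z → z ℕ.+ n) (sym N2≡1+nA)) (s≤s (ℕₚ.≮⇒≥ I≮nAB))))

  private
    partner-sym : ∀ {I K} → IsB I → IsB K → (K ≡ᵇ partner I) ≡ (I ≡ᵇ partner K)
    partner-sym {I} {K} bI bK with K ℕₚ.≟ partner I
    ... | yes refl = trans (dec-true (partner I ℕₚ.≟ partner I) refl) (sym (dec-true (I ℕₚ.≟ partner (partner I)) (sym (proj₂ (partner-IsB bI)))))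
    ... | no K≢πI  = trans (≢-false K≢πI) (sym (≢-false {I} {partner K} (λ I≡πK → K≢πI (trans (sym (proj₂ (partner-IsB bK))) (cong partner (sym I≡πK))))))

    adjacent-partners : ∀ a b c → (b ≡ true → a ≡ false) → b ≡ c → not a ∧ (b ∨ c) ≡ b
    adjacent-partners a true  .true  b⇒¬a refl rewrite b⇒¬a refl = refl
    adjacent-partners a false .false _    refl = ∧-zeroʳ (not a)

    partners : ∀ {I K} → IsB I → IsB K → not (I ≡ᵇ K) ∧ ((K ≡ᵇ partner I) ∨ (I ≡ᵇ partner K)) ≡ (K ≡ᵇ partner I)
    partners {I} {K} bI bK = adjacent-partners (I ≡ᵇ K) (K ≡ᵇ partner I) (I ≡ᵇ partner K) I≢K (partner-sym bI bK)
      where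
      I≢K : (K ≡ᵇ partner I) ≡ true → (I ≡ᵇ K) ≡ false
      I≢K K≡ᵇπI = ≢-false (λ I≡K → partner-≢ bI (sym (trans I≡K (≡ᵇ-true⇒≡ K≡ᵇπI))))

  powerRow : ∀ {I} → I < nA → I ≢ u → ∀ K → K < V → adjCode (suc I) (suc K) ≡ not (K ≡ᵇ I) ∧ (K <ᵇ nA)
  powerRow {I} I<nA I≢u K K<V with K ℕₚ.<? nA
  ... | yes K<nA rewrite dec-true (K ℕₚ.<? nA) K<nA =
        trans (adjCode-aa (code-a I<nA) (λ ()) (code-a K<nA) (λ ())) (trans (cong not (≡ᵇ-comm I K)) (sym (∧-identityʳ _)))
  ... | no K≮nA with code-b (ℕₚ.≮⇒≥ K≮nA) K<V
  ...   | s , s<N2 , N2+s≡1+K rewrite dec-false (K ℕₚ.<? nA) K≮nA =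
        trans (cong (adjCode (suc I)) (sym N2+s≡1+K))
              (trans (adjCode-ab (code-a I<nA) (λ ()) s<N2) (trans (≢-false (I≢u ∘ ℕₚ.suc-injective)) (sym (∧-zeroʳ _))))

  involutionRow : ∀ K → K < V → adjCode (suc u) (suc K) ≡ not (K ≡ᵇ u)
  involutionRow K K<V with K ℕₚ.<? nA
  ... | yes K<nA = trans (adjCode-aa (code-a u<nA) (λ ()) (code-a K<nA) (λ ())) (cong not (≡ᵇ-comm u K))
  ... | no K≮nA with code-b (ℕₚ.≮⇒≥ K≮nA) K<V
  ...   | s , s<N2 , N2+s≡1+K =
        trans (cong (adjCode (suc u)) (sym N2+s≡1+K))
              (trans (adjCode-ab (code-a u<nA) (λ ()) s<N2)
                     (trans (dec-true (n ℕₚ.≟ n) refl) (sym (cong not (≢-false (λ K≡u → K≮nA (subst (_< nA) (sym K≡u) u<nA)))))))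

  reflectionRow : ∀ {I} → IsB I → ∀ K → K < V → adjCode (suc I) (suc K) ≡ (K ≡ᵇ u) ∨ (K ≡ᵇ partner I)
  reflectionRow {I} bI@(nA≤I , I<V) K K<V with code-b nA≤I I<V | K ℕₚ.<? nA
  ... | s , s<N2 , N2+s≡1+I | yes K<nA =
        trans (cong (λ z → adjCode z (suc K)) (sym N2+s≡1+I))
              (trans (adjCode-ba s<N2 (code-a K<nA) (λ ()))
                     (sym (trans (cong ((K ≡ᵇ u) ∨_) (≢-false (λ K≡πI → ℕₚ.<⇒≱ K<nA (subst (nA ≤_) (sym K≡πI) (proj₁ (proj₁ (partner-IsB bI)))))))
                                 (∨-identityʳ (K ≡ᵇ u)))))
  ... | s , s<N2 , N2+s≡1+I | no K≮nA with code-b (ℕₚ.≮⇒≥ K≮nA) K<V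
  ...   | s′ , s′<N2 , N2+s′≡1+K = begin
    adjCode (suc I) (suc K)
      ≡⟨ cong₂ adjCode (sym N2+s≡1+I) (sym N2+s′≡1+K) ⟩
    adjCode (N2 ℕ.+ s) (N2 ℕ.+ s′)
      ≡⟨ adjCode-bb s<N2 s′<N2 ⟩
    not (N2 ℕ.+ s ≡ᵇ N2 ℕ.+ s′) ∧ ((N2 ℕ.+ s′ ≡ᵇ Order4.x′ s s<N2) ∨ (N2 ℕ.+ s ≡ᵇ Order4.x′ s′ s′<N2))
      ≡⟨ cong₂ (λ a b → not (a ≡ᵇ b) ∧ ((b ≡ᵇ Order4.x′ s s<N2) ∨ (a ≡ᵇ Order4.x′ s′ s′<N2))) N2+s≡1+I N2+s′≡1+K ⟩
    not (I ≡ᵇ K) ∧ ((suc K ≡ᵇ Order4.x′ s s<N2) ∨ (suc I ≡ᵇ Order4.x′ s′ s′<N2))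
      ≡⟨ cong₂ (λ a b → not (I ≡ᵇ K) ∧ ((suc K ≡ᵇ a) ∨ (suc I ≡ᵇ b)))
               (partner-code s<N2 N2+s≡1+I nA≤I) (partner-code s′<N2 N2+s′≡1+K (ℕₚ.≮⇒≥ K≮nA)) ⟩
    not (I ≡ᵇ K) ∧ ((K ≡ᵇ partner I) ∨ (I ≡ᵇ partner K))
      ≡⟨ partners bI (ℕₚ.≮⇒≥ K≮nA , K<V) ⟩
    K ≡ᵇ partner I
      ≡⟨ cong (_∨ (K ≡ᵇ partner I)) (sym (≢-false (λ K≡u → K≮nA (subst (_< nA) (sym K≡u) u<nA)))) ⟩
    (K ≡ᵇ u) ∨ (K ≡ᵇ partner I) ∎
    where open ≡-Reasoning

  adj≡adjShape : ∀ i j → adj i j ≡ adjShape (toℕ i) (toℕ j)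
  adj≡adjShape i j with kind (toℕ i) | view (toℕ i)
  ... | gen  | gen I≡0        = subst (λ I → adjCode (suc I) (suc (toℕ j)) ≡ not (toℕ j ≡ᵇ I) ∧ (toℕ j <ᵇ nA)) (sym I≡0)
                                      (powerRow (s≤s z≤n) (λ ()) (toℕ j) (Finₚ.toℕ<n j))
  ... | rot  | rot _ I≢u I<nA = powerRow I<nA I≢u (toℕ j) (Finₚ.toℕ<n j)
  ... | inv  | inv I≡u        = subst (λ I → adjCode (suc I) (suc (toℕ j)) ≡ not (toℕ j ≡ᵇ u)) (sym I≡u)
                                      (involutionRow (toℕ j) (Finₚ.toℕ<n j))
  ... | low  | low nA≤I I<nAB = trans (reflectionRow (nA≤I , Finₚ.toℕ<n i) (toℕ j) (Finₚ.toℕ<n j))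
                                      (cong (λ p → (toℕ j ≡ᵇ u) ∨ (toℕ j ≡ᵇ p)) (partner-low I<nAB))
  ... | high | high nAB≤I     = trans (reflectionRow (ℕₚ.≤-trans nA≤nAB nAB≤I , Finₚ.toℕ<n i) (toℕ j) (Finₚ.toℕ<n j))
                                      (cong (λ p → (toℕ j ≡ᵇ u) ∨ (toℕ j ≡ᵇ p)) (partner-high nAB≤I))

-- Row reduction

-- Subtracting the row of a from the other powers of a, and the row of a^(s-n)b from that of aˢb,
-- leaves (2n - 1 - y)(δᵢ - δ₀) and (3 - y)(δᵢ - δᵢ₋ₙ).  Combining the row of aˢb (s < n) with its
-- partner, a and the powers of a gives (1 - y)(δᵢ - δ₀).  After these factors are divided out,
-- adding partners turns the rows of aˢb (s ≥ n) into δᵢ - δ₀ as well, and adding suitable rows to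
-- those of a and of aⁿ leaves a lower-triangular matrix with diagonal (4n - 1 - y, 1, …, 1).
module Elimination (t : ℕ) (y : ℤ) where
  open ProperPowerGraph t

  Rows : Set
  Rows = Kind → ℕMatrix

  detRows : Rows → ℤ
  detRows R = det V (restrict V (byKind R))

  rowStage : ∀ (S : Kind → Bool) (w : ℕ → ℕ → ℤ) (R R′ : Rows) →
    (∀ c → S c ≡ false → ∀ i k → R′ c i k ≡ R c i k) →
    (∀ i j → i ℕ.< V → j ℕ.< V → S (kind j) ≡ true → w i j ≡ + 0) →
    (∀ i k → i ℕ.< V → k ℕ.< V → S (kind i) ≡ true →
       R′ (kind i) i k ≡ R (kind i) i k + sumBelow V (λ j → w i j * byKind R j k)) →
    detRows R′ ≡ detRows R
  rowStage S w R R′ same w≡0 new =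
    det-rowOpsℕ V (S ∘ kind) w (byKind R) (byKind R′) w≡0 (λ i k _ Si → same (kind i) Si i k) new

  δ-across : ∀ (S : Kind → Bool) a j → S (kind a) ≡ false → S (kind j) ≡ true → δ a j ≡ + 0
  δ-across S a j Sa Sj = δ-≢ a≢j
    where
    a≢j : a ≢ j
    a≢j refl with trans (sym Sa) Sj
    ... | ()

  sum-pickRow : ∀ c {a} (R : Rows) k → a ℕ.< V → sumBelow V (λ j → c * δ a j * byKind R j k) ≡ c * byKind R a k
  sum-pickRow c {a} R k a<V =
    trans (sumBelow-cong V (λ j _ → ℤₚ.*-assoc c (δ a j) (byKind R j k)))
          (trans (sumBelow-* V c (λ j → δ a j * byKind R j k)) (cong (c *_) (sumBelow-δ V a (λ j → byKind R j k) a<V)))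

  R₀ : Rows
  R₀ = pinnedRow y

  R₁ : Rows
  R₁ rot  i k = (+ nA - y) * (δ i k - δ 0 k)
  R₁ high i k = (+ 3 - y) * (δ i k - δ (i ∸ n) k)
  R₁ c        = R₀ c

  stage₁ : detRows R₁ ≡ detRows R₀
  stage₁ = rowStage S w R₀ R₁ same w≡0 new
    where
    S : Kind → Bool
    S rot  = true
    S high = true
    S _    = false
    weight : Kind → ℕ → ℕ → ℤ
    weight rot  i j = - (+ 1) * δ 0 j
    weight high i j = - (+ 1) * δ (i ∸ n) j
    weight _    i j = + 0
    w : ℕ → ℕ → ℤ
    w i = weight (kind i) i
    same : ∀ c → S c ≡ false → ∀ i k → R₁ c i k ≡ R₀ c i k
    same gen _ i k = refl
    same inv _ i k = refl
    same low _ i k = refl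
    w≡0 : ∀ i j → i ℕ.< V → j ℕ.< V → S (kind j) ≡ true → w i j ≡ + 0
    w≡0 i j i<V _ Sj with kind i | view i
    ... | gen  | _            = refl
    ... | inv  | _            = refl
    ... | low  | _            = refl
    ... | rot  | _            = cong (- (+ 1) *_) (δ-across S 0 j refl Sj)
    ... | high | high nAB≤i   = cong (- (+ 1) *_) (δ-across S (i ∸ n) j (cong S (proj₁ (high-partner nAB≤i i<V))) Sj)
    new : ∀ i k → i ℕ.< V → k ℕ.< V → S (kind i) ≡ true →
          R₁ (kind i) i k ≡ R₀ (kind i) i k + sumBelow V (λ j → w i j * byKind R₀ j k)
    new i k i<V k<V Si with kind i | view i
    ... | rot | _ = trans (expand (+ nA - y) (δ i k) (δ 0 k) (inA k))
                          (cong (_+_ (R₀ rot i k)) (sym (sum-pickRow (- (+ 1)) R₀ k (s≤s z≤n))))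
      where
      expand : ∀ a d d₀ e → a * (d - d₀) ≡ a * d - e + - (+ 1) * (a * d₀ - e)
      expand = solve-∀
    ... | high | high nAB≤i = trans (expand y (δ i k) (δ u k) (δ (i ∸ n) k))
        (cong (_+_ (R₀ high i k)) (sym (trans (sum-pickRow (- (+ 1)) R₀ k (ℕₚ.≤-<-trans (ℕₚ.m∸n≤m i n) i<V))
                                              (cong (λ r → - (+ 1) * r) partnerRow))))
      where
      expand : ∀ y d dᵤ dₚ → (+ 3 - y) * (d - dₚ) ≡ (+ 2 - y) * d - dᵤ - dₚ + - (+ 1) * ((+ 2 - y) * dₚ - dᵤ - d)
      expand = solve-∀
      partnerRow : byKind R₀ (i ∸ n) k ≡ (+ 2 - y) * δ (i ∸ n) k - δ u k - δ i k
      partnerRow = trans (cong (λ c → R₀ c (i ∸ n) k) (proj₁ (high-partner nAB≤i i<V)))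
                         (cong (λ p → (+ 2 - y) * δ (i ∸ n) k - δ u k - δ p k) (proj₂ (high-partner nAB≤i i<V)))

  scaleStage : ∀ (c : Kind → ℤ) (R R′ : Rows) → (∀ κ i k → R′ κ i k ≡ c κ * R κ i k) →
               detRows R′ ≡ prodBelow V (c ∘ kind) * detRows R
  scaleStage c R R′ R′≡cR = det-scaleRowsℕ V (c ∘ kind) (byKind R) (byKind R′) (λ i k _ → R′≡cR (kind i) i k)

  R₂ : Rows
  R₂ rot  i k = δ i k - δ 0 k
  R₂ high i k = δ i k - δ (i ∸ n) k
  R₂ c        = R₀ c

  factor₁ : Kind → ℤ
  factor₁ rot  = + nA - y
  factor₁ high = + 3 - y
  factor₁ _    = + 1

  scale₁ : detRows R₁ ≡ prodBelow V (factor₁ ∘ kind) * detRows R₂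
  scale₁ = scaleStage factor₁ R₂ R₁ R₁≡
    where
    R₁≡ : ∀ κ i k → R₁ κ i k ≡ factor₁ κ * R₂ κ i k
    R₁≡ gen  i k = sym (ℤₚ.*-identityˡ _)
    R₁≡ inv  i k = sym (ℤₚ.*-identityˡ _)
    R₁≡ rot  i k = refl
    R₁≡ low  i k = sym (ℤₚ.*-identityˡ _)
    R₁≡ high i k = refl

  isRot isB : Kind → Bool
  isRot rot = true
  isRot _   = false
  isB low  = true
  isB high = true
  isB _    = false

  count : (Kind → Bool) → ℤ
  count P = sumBelow V (λ j → b2z (P (kind j)))

  classSum : ∀ (P : Kind → Bool) (R : Rows) k → k ℕ.< V →
    (∀ j → j ℕ.< V → P (kind j) ≡ true → byKind R j k ≡ δ j k - δ 0 k) →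
    sumBelow V (λ j → b2z (P (kind j)) * byKind R j k) ≡ b2z (P (kind k)) - count P * δ 0 k
  classSum P R k k<V rows = begin
    sumBelow V (λ j → b2z (P (kind j)) * byKind R j k)
      ≡⟨ sumBelow-linear V (+ 1) (- (+ 1)) (λ j → δ k j * b2z (P (kind j))) (λ j → b2z (P (kind j)) * δ 0 k) term≡ ⟩
    + 1 * sumBelow V (λ j → δ k j * b2z (P (kind j))) + - (+ 1) * sumBelow V (λ j → b2z (P (kind j)) * δ 0 k)
      ≡⟨ cong₂ (λ a b → + 1 * a + - (+ 1) * b) (sumBelow-δ V k (λ j → b2z (P (kind j))) k<V)
               (trans (sumBelow-cong V (λ j _ → ℤₚ.*-comm (b2z (P (kind j))) (δ 0 k))) (sumBelow-* V (δ 0 k) (λ j → b2z (P (kind j))))) ⟩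
    + 1 * b2z (P (kind k)) + - (+ 1) * (δ 0 k * count P)
      ≡⟨ tidy (b2z (P (kind k))) (δ 0 k) (count P) ⟩
    b2z (P (kind k)) - count P * δ 0 k ∎
    where
    open ≡-Reasoning
    tidy : ∀ p d c → + 1 * p + - (+ 1) * (d * c) ≡ p - c * d
    tidy = solve-∀
    term≡ : ∀ j → j ℕ.< V → b2z (P (kind j)) * byKind R j k ≡ + 1 * (δ k j * b2z (P (kind j))) + - (+ 1) * (b2z (P (kind j)) * δ 0 k)
    term≡ j j<V with P (kind j) in Pj
    ... | true  = trans (ℤₚ.*-identityˡ _) (trans (rows j j<V Pj) (trans (cong (_- δ 0 k) (δ-sym j k)) (shape (δ k j) (δ 0 k))))
      where
      shape : ∀ d d₀ → d - d₀ ≡ + 1 * (d * + 1) + - (+ 1) * (+ 1 * d₀)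
      shape = solve-∀
    ... | false = sym (cong₂ _+_ (cong (+ 1 *_) (ℤₚ.*-zeroʳ (δ k j))) refl)

  isGen isInv : Kind → Bool
  isGen gen = true
  isGen _   = false
  isInv inv = true
  isInv _   = false

  δ₀-kind : ∀ k → δ 0 k ≡ b2z (isGen (kind k))
  δ₀-kind k with kind k | view k
  ... | gen  | gen refl   = refl
  ... | inv  | inv refl   = refl
  ... | rot  | rot k≢0 _ _ = δ-≢ (k≢0 ∘ sym)
  ... | low  | low nA≤k _ = δ-≢ (λ 0≡k → ℕₚ.<⇒≱ (s≤s z≤n) (subst (nA ℕ.≤_) (sym 0≡k) nA≤k))
  ... | high | high nAB≤k = δ-≢ (λ 0≡k → ℕₚ.<⇒≱ (s≤s z≤n) (subst (nA ℕ.≤_) (sym 0≡k) (ℕₚ.≤-trans nA≤nAB nAB≤k)))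

  δᵤ-kind : ∀ k → δ u k ≡ b2z (isInv (kind k))
  δᵤ-kind k with kind k | view k
  ... | gen  | gen refl   = refl
  ... | inv  | inv refl   = δ-refl u
  ... | rot  | rot _ k≢u _ = δ-≢ (k≢u ∘ sym)
  ... | low  | low nA≤k _ = δ-≢ (λ u≡k → ℕₚ.<⇒≱ u<nA (subst (nA ℕ.≤_) (sym u≡k) nA≤k))
  ... | high | high nAB≤k = δ-≢ (λ u≡k → ℕₚ.<⇒≱ u<nA (subst (nA ℕ.≤_) (sym u≡k) (ℕₚ.≤-trans nA≤nAB nAB≤k)))

  inA≡ : ∀ k → inA k ≡ b2z (isRot (kind k)) + δ 0 k + δ u k
  inA≡ k rewrite inA-kind k | δ₀-kind k | δᵤ-kind k with kind k
  ... | gen  = refl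
  ... | inv  = refl
  ... | rot  = refl
  ... | low  = refl
  ... | high = refl

  count-isRot : count isRot ≡ + 1 + (+ t + + t)
  count-isRot = trans (sumKinds (b2z ∘ isRot)) (tally (+ t) (+ n))
    where
    tally : ∀ t n → + 0 + (t * + 1 + (+ 0 + ((+ 1 + t) * + 1 + (n * + 0 + n * + 0)))) ≡ + 1 + (t + t)
    tally = solve-∀

  R₃ : Rows
  R₃ low i k = (+ 1 - y) * (δ i k - δ 0 k)
  R₃ c       = R₂ c

  stage₂ : detRows R₃ ≡ detRows R₂
  stage₂ = rowStage S w R₂ R₃ same w≡0 new
    where
    S : Kind → Bool
    S low = true
    S _   = false
    weight : Kind → ℕ → ℕ → ℤ
    weight low i j = + 1 * δ (i ℕ.+ n) j + - (+ 1) * δ 0 j + - (+ 1) * b2z (isRot (kind j))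
    weight _   i j = + 0
    w : ℕ → ℕ → ℤ
    w i = weight (kind i) i
    same : ∀ c → S c ≡ false → ∀ i k → R₃ c i k ≡ R₂ c i k
    same gen  _ i k = refl
    same inv  _ i k = refl
    same rot  _ i k = refl
    same high _ i k = refl
    notRot : ∀ c → S c ≡ true → isRot c ≡ false
    notRot low _ = refl
    w≡0 : ∀ i j → i ℕ.< V → j ℕ.< V → S (kind j) ≡ true → w i j ≡ + 0
    w≡0 i j i<V _ Sj with kind i | view i
    ... | gen  | _              = refl
    ... | inv  | _              = refl
    ... | rot  | _              = refl
    ... | high | _              = refl
    ... | low  | low nA≤i i<nAB =
      trans (cong₂ (λ a b → + 1 * a + - (+ 1) * b + - (+ 1) * b2z (isRot (kind j)))
                   (δ-across S (i ℕ.+ n) j (cong S (proj₁ (low-partner nA≤i i<nAB))) Sj) (δ-across S 0 j refl Sj))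
            (cong (λ r → + 1 * + 0 + - (+ 1) * + 0 + - (+ 1) * b2z r) (notRot (kind j) Sj))
    new : ∀ i k → i ℕ.< V → k ℕ.< V → S (kind i) ≡ true →
          R₃ (kind i) i k ≡ R₂ (kind i) i k + sumBelow V (λ j → w i j * byKind R₂ j k)
    new i k i<V k<V Si with kind i | view i
    ... | low | low nA≤i i<nAB = begin
      (+ 1 - y) * (δ i k - δ 0 k)
        ≡⟨ collect y (δ i k) (δ 0 k) (δ u k) (δ p k) (b2z (isRot (kind k))) (+ t) ⟩
      (+ 2 - y) * δ i k - δ u k - δ p k
        + (+ 1 * (δ p k - δ i k) + - (+ 1) * ((+ 3 + (+ t + + t) - y) * δ 0 k - (b2z (isRot (kind k)) + δ 0 k + δ u k))
           + - (+ 1) * (b2z (isRot (kind k)) - (+ 1 + (+ t + + t)) * δ 0 k))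
        ≡⟨ cong (_+_ (R₂ low i k)) (sym weighted) ⟩
      R₂ low i k + sumBelow V (λ j → weight low i j * X j) ∎
      where
      open ≡-Reasoning
      p = i ℕ.+ n
      X : ℕ → ℤ
      X j = byKind R₂ j k
      r : ℕ → ℤ
      r j = b2z (isRot (kind j))
      collect : ∀ y d d₀ dᵤ dₚ r t →
        (+ 1 - y) * (d - d₀) ≡ (+ 2 - y) * d - dᵤ - dₚ + (+ 1 * (dₚ - d) + - (+ 1) * ((+ 3 + (t + t) - y) * d₀ - (r + d₀ + dᵤ))
                                                            + - (+ 1) * (r - (+ 1 + (t + t)) * d₀))
      collect = solve-∀
      split : ∀ a b c x → (+ 1 * a + - (+ 1) * b + - (+ 1) * c) * x ≡ + 1 * a * x + - (+ 1) * b * x + - (+ 1) * (c * x)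
      split = solve-∀
      weighted : sumBelow V (λ j → weight low i j * X j) ≡
        + 1 * (δ p k - δ i k) + - (+ 1) * ((+ 3 + (+ t + + t) - y) * δ 0 k - (b2z (isRot (kind k)) + δ 0 k + δ u k))
        + - (+ 1) * (b2z (isRot (kind k)) - (+ 1 + (+ t + + t)) * δ 0 k)
      weighted = begin
        sumBelow V (λ j → weight low i j * X j)
          ≡⟨ sumBelow-cong V (λ j _ → split (δ p j) (δ 0 j) (r j) (X j)) ⟩
        sumBelow V (λ j → + 1 * δ p j * X j + - (+ 1) * δ 0 j * X j + - (+ 1) * (r j * X j))
          ≡⟨ trans (sumBelow-distrib V (λ j → + 1 * δ p j * X j + - (+ 1) * δ 0 j * X j) (λ j → - (+ 1) * (r j * X j)))
                   (cong₂ _+_ (sumBelow-distrib V (λ j → + 1 * δ p j * X j) (λ j → - (+ 1) * δ 0 j * X j))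
                              (sumBelow-* V (- (+ 1)) (λ j → r j * X j))) ⟩
        sumBelow V (λ j → + 1 * δ p j * X j) + sumBelow V (λ j → - (+ 1) * δ 0 j * X j) + - (+ 1) * sumBelow V (λ j → r j * X j)
          ≡⟨ cong₂ _+_ (cong₂ _+_ partnerTerm genTerm) (cong (- (+ 1) *_) rotTerm) ⟩
        + 1 * (δ p k - δ i k) + - (+ 1) * ((+ 3 + (+ t + + t) - y) * δ 0 k - (b2z (isRot (kind k)) + δ 0 k + δ u k))
          + - (+ 1) * (b2z (isRot (kind k)) - (+ 1 + (+ t + + t)) * δ 0 k) ∎
        where
        partnerTerm : sumBelow V (λ j → + 1 * δ p j * X j) ≡ + 1 * (δ p k - δ i k)
        partnerTerm = trans (sum-pickRow (+ 1) R₂ k (proj₂ (low-partner nA≤i i<nAB)))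
                            (cong (+ 1 *_) (trans (cong (λ c → R₂ c p k) (proj₁ (low-partner nA≤i i<nAB)))
                                                  (cong (λ q → δ p k - δ q k) (ℕₚ.m+n∸n≡m i n))))
        genTerm : sumBelow V (λ j → - (+ 1) * δ 0 j * X j) ≡ - (+ 1) * ((+ 3 + (+ t + + t) - y) * δ 0 k - (b2z (isRot (kind k)) + δ 0 k + δ u k))
        genTerm = trans (sum-pickRow (- (+ 1)) R₂ k (s≤s z≤n)) (cong (λ z → - (+ 1) * z) (cong₂ (λ a e → (a - y) * δ 0 k - e) nA≡ (inA≡ k)))
        rotTerm : sumBelow V (λ j → r j * X j) ≡ b2z (isRot (kind k)) - (+ 1 + (+ t + + t)) * δ 0 k
        rotTerm = trans (classSum isRot R₂ k k<V rotRows) (cong (λ c → b2z (isRot (kind k)) - c * δ 0 k) count-isRot)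
          where
          rotRows : ∀ j → j ℕ.< V → isRot (kind j) ≡ true → X j ≡ δ j k - δ 0 k
          rotRows j _ isRotj with kind j
          rotRows j _ refl | rot = refl

  R₄ : Rows
  R₄ low i k = δ i k - δ 0 k
  R₄ c       = R₂ c

  factor₂ : Kind → ℤ
  factor₂ low = + 1 - y
  factor₂ _   = + 1

  scale₂ : detRows R₃ ≡ prodBelow V (factor₂ ∘ kind) * detRows R₄
  scale₂ = scaleStage factor₂ R₄ R₃ R₃≡
    where
    R₃≡ : ∀ κ i k → R₃ κ i k ≡ factor₂ κ * R₄ κ i k
    R₃≡ gen  i k = sym (ℤₚ.*-identityˡ _)
    R₃≡ inv  i k = sym (ℤₚ.*-identityˡ _)
    R₃≡ rot  i k = sym (ℤₚ.*-identityˡ _)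
    R₃≡ low  i k = refl
    R₃≡ high i k = sym (ℤₚ.*-identityˡ _)

  R₅ : Rows
  R₅ high i k = δ i k - δ 0 k
  R₅ c        = R₄ c

  stage₃ : detRows R₅ ≡ detRows R₄
  stage₃ = rowStage S w R₄ R₅ same w≡0 new
    where
    S : Kind → Bool
    S high = true
    S _    = false
    weight : Kind → ℕ → ℕ → ℤ
    weight high i j = + 1 * δ (i ∸ n) j
    weight _    i j = + 0
    w : ℕ → ℕ → ℤ
    w i = weight (kind i) i
    same : ∀ c → S c ≡ false → ∀ i k → R₅ c i k ≡ R₄ c i k
    same gen _ i k = refl
    same inv _ i k = refl
    same rot _ i k = refl
    same low _ i k = refl
    w≡0 : ∀ i j → i ℕ.< V → j ℕ.< V → S (kind j) ≡ true → w i j ≡ + 0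
    w≡0 i j i<V _ Sj with kind i | view i
    ... | gen  | _          = refl
    ... | inv  | _          = refl
    ... | rot  | _          = refl
    ... | low  | _          = refl
    ... | high | high nAB≤i = cong (+ 1 *_) (δ-across S (i ∸ n) j (cong S (proj₁ (high-partner nAB≤i i<V))) Sj)
    new : ∀ i k → i ℕ.< V → k ℕ.< V → S (kind i) ≡ true →
          R₅ (kind i) i k ≡ R₄ (kind i) i k + sumBelow V (λ j → w i j * byKind R₄ j k)
    new i k i<V k<V Si with kind i | view i
    ... | high | high nAB≤i = trans (telescope (δ i k) (δ (i ∸ n) k) (δ 0 k))
        (cong (_+_ (R₄ high i k)) (sym (trans (sum-pickRow (+ 1) R₄ k (ℕₚ.≤-<-trans (ℕₚ.m∸n≤m i n) i<V))
                                              (cong (λ c → + 1 * R₄ c (i ∸ n) k) (proj₁ (high-partner nAB≤i i<V))))))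
      where
      telescope : ∀ d dₚ d₀ → d - d₀ ≡ d - dₚ + + 1 * (dₚ - d₀)
      telescope = solve-∀

  isOther : Kind → Bool
  isOther gen = false
  isOther inv = false
  isOther _   = true

  partition : ∀ k → + 1 ≡ b2z (isRot (kind k)) + δ 0 k + δ u k + b2z (isB (kind k))
  partition k rewrite δ₀-kind k | δᵤ-kind k with kind k
  ... | gen  = refl
  ... | inv  = refl
  ... | rot  = refl
  ... | low  = refl
  ... | high = refl

  partition′ : ∀ k → + 1 ≡ b2z (isOther (kind k)) + δ 0 k + δ u k
  partition′ k rewrite δ₀-kind k | δᵤ-kind k with kind k
  ... | gen  = refl
  ... | inv  = refl
  ... | rot  = refl
  ... | low  = refl
  ... | high = refl

  count-isB : count isB ≡ + 4 + (+ t + + t)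
  count-isB = trans (sumKinds (b2z ∘ isB)) (tally (+ t))
    where
    tally : ∀ t → + 0 + (t * + 0 + (+ 0 + ((+ 1 + t) * + 0 + ((+ 2 + t) * + 1 + (+ 2 + t) * + 1)))) ≡ + 4 + (t + t)
    tally = solve-∀

  count-isOther : count isOther ≡ + 5 + + 4 * + t
  count-isOther = trans (sumKinds (b2z ∘ isOther)) (tally (+ t))
    where
    tally : ∀ t → + 0 + (t * + 1 + (+ 0 + ((+ 1 + t) * + 1 + ((+ 2 + t) * + 1 + (+ 2 + t) * + 1)))) ≡ + 5 + + 4 * t
    tally = solve-∀

  R₆ : Rows
  R₆ gen i k = (+ V - y) * δ 0 k
  R₆ c       = R₅ c

  stage₄ : detRows R₆ ≡ detRows R₅
  stage₄ = rowStage S w R₅ R₆ same w≡0 new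
    where
    S : Kind → Bool
    S gen = true
    S _   = false
    weight : Kind → ℕ → ℕ → ℤ
    weight gen i j = + 1 * δ u j + - (+ 1) * b2z (isB (kind j))
    weight _   i j = + 0
    w : ℕ → ℕ → ℤ
    w i = weight (kind i) i
    same : ∀ c → S c ≡ false → ∀ i k → R₆ c i k ≡ R₅ c i k
    same inv  _ i k = refl
    same rot  _ i k = refl
    same low  _ i k = refl
    same high _ i k = refl
    notB : ∀ c → S c ≡ true → isB c ≡ false
    notB gen _ = refl
    w≡0 : ∀ i j → i ℕ.< V → j ℕ.< V → S (kind j) ≡ true → w i j ≡ + 0
    w≡0 i j _ _ Sj with kind i
    ... | gen  = cong₂ (λ a b → + 1 * a + - (+ 1) * b2z b) (δ-across S u j (cong S kind-inv) Sj) (notB (kind j) Sj)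
    ... | inv  = refl
    ... | rot  = refl
    ... | low  = refl
    ... | high = refl
    new : ∀ i k → i ℕ.< V → k ℕ.< V → S (kind i) ≡ true →
          R₆ (kind i) i k ≡ R₅ (kind i) i k + sumBelow V (λ j → w i j * byKind R₅ j k)
    new i k i<V k<V Si with kind i | view i
    ... | gen | gen refl = begin
      (+ V - y) * δ 0 k
        ≡⟨ cong (λ v → (v - y) * δ 0 k) V≡ ⟩
      (+ 7 + + 4 * + t - y) * δ 0 k
        ≡⟨ collect y (δ 0 k) (δ u k) (b2z (isRot (kind k))) (b2z (isB (kind k))) (+ t) ⟩
      (+ 3 + (+ t + + t) - y) * δ 0 k - (ρ + δ 0 k + δ u k)
        + (+ 1 * (ρ + δ 0 k + δ u k + β) + - (+ 1) * (β - (+ 4 + (+ t + + t)) * δ 0 k))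
        ≡⟨ cong₂ (λ a e → (a - y) * δ 0 k - e + (+ 1 * (ρ + δ 0 k + δ u k + β) + - (+ 1) * (β - (+ 4 + (+ t + + t)) * δ 0 k)))
                 (sym nA≡) (sym (inA≡ k)) ⟩
      R₅ gen 0 k + (+ 1 * (ρ + δ 0 k + δ u k + β) + - (+ 1) * (β - (+ 4 + (+ t + + t)) * δ 0 k))
        ≡⟨ cong (_+_ (R₅ gen 0 k)) (sym weighted) ⟩
      R₅ gen 0 k + sumBelow V (λ j → weight gen 0 j * X j) ∎
      where
      open ≡-Reasoning
      ρ = b2z (isRot (kind k))
      β = b2z (isB (kind k))
      X : ℕ → ℤ
      X j = byKind R₅ j k
      collect : ∀ y d₀ dᵤ ρ β t →
        ((+ 7 + + 4 * t) - y) * d₀ ≡ (+ 3 + (t + t) - y) * d₀ - (ρ + d₀ + dᵤ) + (+ 1 * (ρ + d₀ + dᵤ + β) + - (+ 1) * (β - (+ 4 + (t + t)) * d₀))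
      collect = solve-∀
      split : ∀ a b x → (+ 1 * a + - (+ 1) * b) * x ≡ + 1 * a * x + - (+ 1) * (b * x)
      split = solve-∀
      weighted : sumBelow V (λ j → weight gen 0 j * X j) ≡ + 1 * (ρ + δ 0 k + δ u k + β) + - (+ 1) * (β - (+ 4 + (+ t + + t)) * δ 0 k)
      weighted = begin
        sumBelow V (λ j → weight gen 0 j * X j)
          ≡⟨ sumBelow-cong V (λ j _ → split (δ u j) (b2z (isB (kind j))) (X j)) ⟩
        sumBelow V (λ j → + 1 * δ u j * X j + - (+ 1) * (b2z (isB (kind j)) * X j))
          ≡⟨ trans (sumBelow-distrib V (λ j → + 1 * δ u j * X j) (λ j → - (+ 1) * (b2z (isB (kind j)) * X j)))
                   (cong (_+_ (sumBelow V (λ j → + 1 * δ u j * X j))) (sumBelow-* V (- (+ 1)) (λ j → b2z (isB (kind j)) * X j))) ⟩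
        sumBelow V (λ j → + 1 * δ u j * X j) + - (+ 1) * sumBelow V (λ j → b2z (isB (kind j)) * X j)
          ≡⟨ cong₂ (λ a b → a + - (+ 1) * b) onesTerm bTerm ⟩
        + 1 * (ρ + δ 0 k + δ u k + β) + - (+ 1) * (β - (+ 4 + (+ t + + t)) * δ 0 k) ∎
        where
        onesTerm : sumBelow V (λ j → + 1 * δ u j * X j) ≡ + 1 * (ρ + δ 0 k + δ u k + β)
        onesTerm = trans (sum-pickRow (+ 1) R₅ k u<V) (cong (+ 1 *_) (trans (cong (λ c → R₅ c u k) kind-inv) (partition k)))
        bTerm : sumBelow V (λ j → b2z (isB (kind j)) * X j) ≡ β - (+ 4 + (+ t + + t)) * δ 0 k
        bTerm = trans (classSum isB R₅ k k<V bRows) (cong (λ c → β - c * δ 0 k) count-isB)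
          where
          bRows : ∀ j → j ℕ.< V → isB (kind j) ≡ true → X j ≡ δ j k - δ 0 k
          bRows j _ isBj with kind j
          bRows j _ refl | low  = refl
          bRows j _ refl | high = refl

  R₇ : Rows
  R₇ inv i k = (+ V - + 1) * δ 0 k + δ u k
  R₇ c       = R₆ c

  stage₅ : detRows R₇ ≡ detRows R₆
  stage₅ = rowStage S w R₆ R₇ same w≡0 new
    where
    S : Kind → Bool
    S inv = true
    S _   = false
    weight : Kind → ℕ → ℕ → ℤ
    weight inv i j = - (+ 1) * b2z (isOther (kind j))
    weight _   i j = + 0
    w : ℕ → ℕ → ℤ
    w i = weight (kind i) i
    same : ∀ c → S c ≡ false → ∀ i k → R₇ c i k ≡ R₆ c i k
    same gen  _ i k = refl
    same rot  _ i k = refl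
    same low  _ i k = refl
    same high _ i k = refl
    notOther : ∀ c → S c ≡ true → isOther c ≡ false
    notOther inv _ = refl
    w≡0 : ∀ i j → i ℕ.< V → j ℕ.< V → S (kind j) ≡ true → w i j ≡ + 0
    w≡0 i j _ _ Sj with kind i
    ... | inv  = cong (λ b → - (+ 1) * b2z b) (notOther (kind j) Sj)
    ... | gen  = refl
    ... | rot  = refl
    ... | low  = refl
    ... | high = refl
    new : ∀ i k → i ℕ.< V → k ℕ.< V → S (kind i) ≡ true →
          R₇ (kind i) i k ≡ R₆ (kind i) i k + sumBelow V (λ j → w i j * byKind R₆ j k)
    new i k i<V k<V Si with kind i
    ... | inv = begin
      (+ V - + 1) * δ 0 k + δ u k
        ≡⟨ cong (λ v → (v - + 1) * δ 0 k + δ u k) V≡ ⟩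
      (+ 7 + + 4 * + t - + 1) * δ 0 k + δ u k
        ≡⟨ collect (+ t) (b2z (isOther (kind k))) (δ 0 k) (δ u k) ⟩
      (o + δ 0 k + δ u k) + - (+ 1) * (o - (+ 5 + + 4 * + t) * δ 0 k)
        ≡⟨ cong₂ (λ a b → a + - (+ 1) * b) (sym (partition′ k))
                 (sym (trans (classSum isOther R₆ k k<V otherRows) (cong (λ c → o - c * δ 0 k) count-isOther))) ⟩
      + 1 + - (+ 1) * sumBelow V (λ j → b2z (isOther (kind j)) * byKind R₆ j k)
        ≡⟨ cong (_+_ (+ 1)) (sym (trans (sumBelow-cong V (λ j _ → ℤₚ.*-assoc (- (+ 1)) (b2z (isOther (kind j))) (byKind R₆ j k)))
                                        (sumBelow-* V (- (+ 1)) (λ j → b2z (isOther (kind j)) * byKind R₆ j k)))) ⟩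
      + 1 + sumBelow V (λ j → weight inv i j * byKind R₆ j k) ∎
      where
      open ≡-Reasoning
      o = b2z (isOther (kind k))
      collect : ∀ t o d₀ dᵤ → (+ 7 + + 4 * t - + 1) * d₀ + dᵤ ≡ (o + d₀ + dᵤ) + - (+ 1) * (o - (+ 5 + + 4 * t) * d₀)
      collect = solve-∀
      otherRows : ∀ j → j ℕ.< V → isOther (kind j) ≡ true → byKind R₆ j k ≡ δ j k - δ 0 k
      otherRows j _ isOtherj with kind j
      otherRows j _ refl | rot  = refl
      otherRows j _ refl | low  = refl
      otherRows j _ refl | high = refl

  diagonal : Kind → ℤ
  diagonal gen = + V - y
  diagonal _   = + 1

  det-R₇ : detRows R₇ ≡ prodBelow V (diagonal ∘ kind)
  det-R₇ = trans (det-lowerTriangular V (byKind R₇) upper≡0) (prodBelow-cong V diag≡)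
    where
    unit : ∀ {i} → i ≢ 0 → δ i i - δ 0 i ≡ + 1
    unit {i} i≢0 rewrite δ-refl i | δ-≢ (i≢0 ∘ sym) = refl
    above : ∀ {i k} → i ℕ.< k → δ i k ≡ + 0
    above i<k = δ-≢ (λ i≡k → ℕₚ.<-irrefl i≡k i<k)
    above₀ : ∀ {i k} → i ℕ.< k → δ 0 k ≡ + 0
    above₀ i<k = δ-≢ (λ 0≡k → ℕₚ.<-irrefl 0≡k (ℕₚ.≤-<-trans z≤n i<k))
    upper≡0 : ∀ i k → i ℕ.< k → k ℕ.< V → byKind R₇ i k ≡ + 0
    upper≡0 i k i<k _ with kind i | view i
    ... | gen  | gen refl = trans (cong ((+ V - y) *_) (above₀ i<k)) (ℤₚ.*-zeroʳ (+ V - y))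
    ... | inv  | inv refl = trans (cong₂ (λ a b → (+ V - + 1) * a + b) (above₀ i<k) (above i<k))
                                  (trans (ℤₚ.+-identityʳ ((+ V - + 1) * + 0)) (ℤₚ.*-zeroʳ (+ V - + 1)))
    ... | rot  | _        = cong₂ _-_ (above i<k) (above₀ i<k)
    ... | low  | _        = cong₂ _-_ (above i<k) (above₀ i<k)
    ... | high | _        = cong₂ _-_ (above i<k) (above₀ i<k)
    diag≡ : ∀ i → i ℕ.< V → byKind R₇ i i ≡ diagonal (kind i)
    diag≡ i _ with kind i | view i
    ... | gen  | gen refl     = ℤₚ.*-identityʳ (+ V - y)
    ... | inv  | inv refl     = trans (cong (_+_ ((+ V - + 1) * + 0)) (δ-refl u)) (cong (_+ + 1) (ℤₚ.*-zeroʳ (+ V - + 1)))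
    ... | rot  | rot i≢0 _ _  = unit i≢0
    ... | low  | low nA≤i _   = unit (λ i≡0 → ℕₚ.<⇒≱ (s≤s z≤n) (subst (nA ℕ.≤_) i≡0 nA≤i))
    ... | high | high nAB≤i   = unit (λ i≡0 → ℕₚ.<⇒≱ (s≤s z≤n) (subst (nA ℕ.≤_) i≡0 (ℕₚ.≤-trans nA≤nAB nAB≤i)))

  det-pinned : detRows R₀ ≡ (+ nA - y) ℤ.^ (t ℕ.+ suc t) * (+ 3 - y) ℤ.^ n * (+ 1 - y) ℤ.^ n * (+ V - y)
  det-pinned = begin
    detRows R₀                                                              ≡⟨ sym stage₁ ⟩
    detRows R₁                                                              ≡⟨ scale₁ ⟩
    prodBelow V (factor₁ ∘ kind) * detRows R₂                               ≡⟨ cong (prodBelow V (factor₁ ∘ kind) *_) (sym stage₂) ⟩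
    prodBelow V (factor₁ ∘ kind) * detRows R₃                               ≡⟨ cong (prodBelow V (factor₁ ∘ kind) *_) scale₂ ⟩
    prodBelow V (factor₁ ∘ kind) * (prodBelow V (factor₂ ∘ kind) * detRows R₄)
      ≡⟨ cong (λ d → prodBelow V (factor₁ ∘ kind) * (prodBelow V (factor₂ ∘ kind) * d))
              (sym (trans stage₅ (trans stage₄ stage₃))) ⟩
    prodBelow V (factor₁ ∘ kind) * (prodBelow V (factor₂ ∘ kind) * detRows R₇)
      ≡⟨ cong₂ (λ a b → a * b) (prodKinds factor₁) (cong₂ _*_ (prodKinds factor₂) (trans det-R₇ (prodKinds diagonal))) ⟩
    + 1 * (Λ ℤ.^ t * (+ 1 * (Λ ℤ.^ suc t * ((+ 1) ℤ.^ n * (+ 3 - y) ℤ.^ n))))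
      * (+ 1 * ((+ 1) ℤ.^ t * (+ 1 * ((+ 1) ℤ.^ suc t * ((+ 1 - y) ℤ.^ n * (+ 1) ℤ.^ n))))
         * ((+ V - y) * ((+ 1) ℤ.^ t * (+ 1 * ((+ 1) ℤ.^ suc t * ((+ 1) ℤ.^ n * (+ 1) ℤ.^ n))))))
      ≡⟨ tidy ⟩
    Λ ℤ.^ (t ℕ.+ suc t) * (+ 3 - y) ℤ.^ n * (+ 1 - y) ℤ.^ n * (+ V - y) ∎
    where
    open ≡-Reasoning
    Λ = + nA - y
    regroup : ∀ p q b c d → + 1 * (p * (+ 1 * (q * (+ 1 * b)))) * (+ 1 * (+ 1 * (+ 1 * (+ 1 * (c * + 1))))
                            * (d * (+ 1 * (+ 1 * (+ 1 * (+ 1 * + 1)))))) ≡ p * q * b * c * d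
    regroup = solve-∀
    tidy : + 1 * (Λ ℤ.^ t * (+ 1 * (Λ ℤ.^ suc t * ((+ 1) ℤ.^ n * (+ 3 - y) ℤ.^ n))))
             * (+ 1 * ((+ 1) ℤ.^ t * (+ 1 * ((+ 1) ℤ.^ suc t * ((+ 1 - y) ℤ.^ n * (+ 1) ℤ.^ n))))
                * ((+ V - y) * ((+ 1) ℤ.^ t * (+ 1 * ((+ 1) ℤ.^ suc t * ((+ 1) ℤ.^ n * (+ 1) ℤ.^ n))))))
           ≡ Λ ℤ.^ (t ℕ.+ suc t) * (+ 3 - y) ℤ.^ n * (+ 1 - y) ℤ.^ n * (+ V - y)
    tidy rewrite ℤₚ.^-zeroˡ t | ℤₚ.^-distribˡ-+-* Λ t (suc t) =
      regroup (Λ ℤ.^ t) (Λ ℤ.^ suc t) ((+ 3 - y) ℤ.^ n) ((+ 1 - y) ℤ.^ n) (+ V - y)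

-- Characteristic polynomials

reflect-pow : ∀ m (a x : ℤ) → (a - x) ℤ.^ m ≡ (- (+ 1)) ℤ.^ m * (x - a) ℤ.^ m
reflect-pow zero    a x = refl
reflect-pow (suc m) a x = trans (cong ((a - x) *_) (reflect-pow m a x)) (regroup a x ((- (+ 1)) ℤ.^ m) ((x - a) ℤ.^ m))
  where
  regroup : ∀ a x s p → (a - x) * (s * p) ≡ (- (+ 1)) * s * ((x - a) * p)
  regroup = solve-∀

module CharacteristicPolynomials (t k : ℕ) (2^k≡n : 2 ^ k ≡ suc (suc t)) where
  open ProperPowerGraph t
  open Quaternion n using (adj; L; DL)
  open PowerGraphAdjacency t k 2^k≡n using (adj≡adjShape)

  e : ℕ
  e = t ℕ.+ suc t

  σ : ℕ → ℤ
  σ m = (- (+ 1)) ℤ.^ m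

  det-pinnedLaplacian : ∀ y → det V (updateRow (shiftedLaplacian V adj y) (uᶠ adj adj≡adjShape) (λ _ → + 1)) ≡
                        (+ nA - y) ℤ.^ e * (+ 3 - y) ℤ.^ n * (+ 1 - y) ℤ.^ n * (+ V - y)
  det-pinnedLaplacian y = trans (det-cong V (pinnedLaplacian adj adj≡adjShape y)) (Elimination.det-pinned t y)

  private
    2n∸3≡e : 2 ℕ.* n ∸ 3 ≡ e
    2n∸3≡e = solve t
      where
      solve : ∀ t → t ℕ.+ suc (suc (t ℕ.+ 0)) ∸ 1 ≡ t ℕ.+ suc t
      solve t = trans (cong (_∸ 1) (ℕₚ.+-suc t (suc (t ℕ.+ 0)))) (cong (λ z → t ℕ.+ suc z) (ℕₚ.+-identityʳ t))

    σV : σ V ≡ - (+ 1) * (σ e * (σ n * (σ n * - (+ 1))))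
    σV = trans (cong σ (solve t)) (trans (ℤₚ.^-distribˡ-+-* (- (+ 1)) 1 (e ℕ.+ (n ℕ.+ (n ℕ.+ 1))))
           (cong (- (+ 1) *_) (trans (ℤₚ.^-distribˡ-+-* (- (+ 1)) e (n ℕ.+ (n ℕ.+ 1)))
             (cong (σ e *_) (trans (ℤₚ.^-distribˡ-+-* (- (+ 1)) n (n ℕ.+ 1))
               (cong (σ n *_) (ℤₚ.^-distribˡ-+-* (- (+ 1)) n 1)))))))
      where
      solve : ∀ t → suc (t ℕ.+ 3 ℕ.* suc (suc t)) ≡ 1 ℕ.+ ((t ℕ.+ suc t) ℕ.+ (suc (suc t) ℕ.+ (suc (suc t) ℕ.+ 1)))
      solve = ℕ-Solver.solve-∀

  laplacianCharPoly : ∀ x → det V (subScalar V L x) ≡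
    σ (4 ℕ.* n ∸ 1) * (x * (x - + 3) ℤ.^ n * (x - + 1) ℤ.^ n * (x - + (4 ℕ.* n ∸ 1)) * (x - + (2 ℕ.* n ∸ 1)) ℤ.^ (2 ℕ.* n ∸ 3))
  laplacianCharPoly x = begin
    det V (subScalar V L x)
      ≡⟨ det-charLaplacian adj (adj-sym n) (uᶠ adj adj≡adjShape) x ⟩
    - x * det V (updateRow (shiftedLaplacian V adj x) (uᶠ adj adj≡adjShape) (λ _ → + 1))
      ≡⟨ cong (- x *_) (det-pinnedLaplacian x) ⟩
    - x * ((+ nA - x) ℤ.^ e * (+ 3 - x) ℤ.^ n * (+ 1 - x) ℤ.^ n * (+ V - x))
      ≡⟨ cong₃ (λ a b c → - x * (a * b * c * (+ V - x))) (reflect-pow e (+ nA) x) (reflect-pow n (+ 3) x) (reflect-pow n (+ 1) x) ⟩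
    - x * (σ e * A * (σ n * B) * (σ n * C) * (+ V - x))
      ≡⟨ regroup x (+ V) A B C (σ e) (σ n) ⟩
    - (+ 1) * (σ e * (σ n * (σ n * - (+ 1)))) * (x * B * C * (x - + V) * A)
      ≡⟨ cong₂ _*_ (sym σV) (cong (λ z → x * B * C * (x - + V) * z) (cong₂ (λ a m → (x - + a) ℤ.^ m) (sym 2n∸1≡nA) (sym 2n∸3≡e))) ⟩
    σ V * (x * B * C * (x - + V) * (x - + (2 ℕ.* n ∸ 1)) ℤ.^ (2 ℕ.* n ∸ 3)) ∎
    where
    open ≡-Reasoning
    A = (x - + nA) ℤ.^ e
    B = (x - + 3) ℤ.^ n
    C = (x - + 1) ℤ.^ n
    regroup : ∀ x v a b c sₑ sₙ → - x * (sₑ * a * (sₙ * b) * (sₙ * c) * (v - x)) ≡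
                                  - (+ 1) * (sₑ * (sₙ * (sₙ * - (+ 1)))) * (x * b * c * (x - v) * a)
    regroup = solve-∀
    cong₃ : ∀ {A B C D : Set} (f : A → B → C → D) {a a′ b b′ c c′} → a ≡ a′ → b ≡ b′ → c ≡ c′ → f a b c ≡ f a′ b′ c′
    cong₃ f refl refl refl = refl
    2n∸1≡nA : 2 ℕ.* n ∸ 1 ≡ nA
    2n∸1≡nA = solve t
      where
      solve : ∀ t → suc (t ℕ.+ 1 ℕ.* suc (suc t)) ≡ suc (suc (suc (t ℕ.+ t)))
      solve = ℕ-Solver.solve-∀

  private
    ℤ-linear : ∀ {a} c d → a ≡ c ℕ.+ d ℕ.* t → + a ≡ + c + + d * + t
    ℤ-linear {a} c d a≡ = trans (cong +_ a≡) (trans (ℤₚ.pos-+ c (d ℕ.* t)) (cong (_+_ (+ c)) (ℤₚ.pos-* d t)))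

    6n∸1 : + (6 ℕ.* n ∸ 1) ≡ + 11 + + 6 * + t
    6n∸1 = ℤ-linear 11 6 (solve t)
      where
      solve : ∀ t → suc (t ℕ.+ 5 ℕ.* suc (suc t)) ≡ 11 ℕ.+ 6 ℕ.* t
      solve = ℕ-Solver.solve-∀

    8n≡16+8t : 8 ℕ.* n ≡ 16 ℕ.+ 8 ℕ.* t
    8n≡16+8t = solve t
      where
      solve : ∀ t → 8 ℕ.* suc (suc t) ≡ 16 ℕ.+ 8 ℕ.* t
      solve = ℕ-Solver.solve-∀

    8n∸5 : + (8 ℕ.* n ∸ 5) ≡ + 11 + + 8 * + t
    8n∸5 = ℤ-linear 11 8 (cong (_∸ 5) 8n≡16+8t)

    8n∸3 : + (8 ℕ.* n ∸ 3) ≡ + 13 + + 8 * + t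
    8n∸3 = ℤ-linear 13 8 (cong (_∸ 3) 8n≡16+8t)

  universal : ∀ i → i ≢ uᶠ adj adj≡adjShape → adj i (uᶠ adj adj≡adjShape) ≡ true
  universal i i≢u = trans (adj≡adjShape i uᶠ′) (trans (cong (adjShape (toℕ i)) (Finₚ.toℕ-fromℕ< u<V))
                                                       (adjShape-universal (toℕ i) (λ I≡u → i≢u (Finₚ.toℕ-injective (trans I≡u (sym (Finₚ.toℕ-fromℕ< u<V)))))))
    where uᶠ′ = uᶠ adj adj≡adjShape

  distanceLaplacianCharPoly : ∀ x → det V (subScalar V DL x) ≡
    σ (4 ℕ.* n ∸ 1) * (x * (x - + (4 ℕ.* n ∸ 1)) * (x - + (6 ℕ.* n ∸ 1)) ℤ.^ (2 ℕ.* n ∸ 3)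
                       * (x - + (8 ℕ.* n ∸ 5)) ℤ.^ n * (x - + (8 ℕ.* n ∸ 3)) ℤ.^ n)
  distanceLaplacianCharPoly x = begin
    det V (subScalar V DL x)
      ≡⟨ det-charDistanceLaplacian adj (adj-sym n) (adj-irrefl n) (uᶠ adj adj≡adjShape) universal (ℕₚ.≤-<-trans (s≤s z≤n) u<V) x ⟩
    σ V * (x * det V (updateRow (shiftedLaplacian V adj y) (uᶠ adj adj≡adjShape) (λ _ → + 1)))
      ≡⟨ cong (λ d → σ V * (x * d)) (det-pinnedLaplacian y) ⟩
    σ V * (x * ((+ nA - y) ℤ.^ e * (+ 3 - y) ℤ.^ n * (+ 1 - y) ℤ.^ n * (+ V - y)))
      ≡⟨ cong (λ z → σ V * (x * z)) (cong₄ (λ a b c d → a ℤ.^ e * b ℤ.^ n * c ℤ.^ n * d) shift₁ shift₃ shift₀ shiftᵥ) ⟩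
    σ V * (x * ((x - + (6 ℕ.* n ∸ 1)) ℤ.^ e * (x - + (8 ℕ.* n ∸ 5)) ℤ.^ n * (x - + (8 ℕ.* n ∸ 3)) ℤ.^ n * (x - + V)))
      ≡⟨ cong (σ V *_) (regroup x (+ V) ((x - + (6 ℕ.* n ∸ 1)) ℤ.^ e) ((x - + (8 ℕ.* n ∸ 5)) ℤ.^ n) ((x - + (8 ℕ.* n ∸ 3)) ℤ.^ n)) ⟩
    σ V * (x * (x - + V) * (x - + (6 ℕ.* n ∸ 1)) ℤ.^ e * (x - + (8 ℕ.* n ∸ 5)) ℤ.^ n * (x - + (8 ℕ.* n ∸ 3)) ℤ.^ n)
      ≡⟨ cong (λ m → σ V * (x * (x - + V) * (x - + (6 ℕ.* n ∸ 1)) ℤ.^ m * (x - + (8 ℕ.* n ∸ 5)) ℤ.^ n * (x - + (8 ℕ.* n ∸ 3)) ℤ.^ n))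
              (sym 2n∸3≡e) ⟩
    σ V * (x * (x - + V) * (x - + (6 ℕ.* n ∸ 1)) ℤ.^ (2 ℕ.* n ∸ 3) * (x - + (8 ℕ.* n ∸ 5)) ℤ.^ n * (x - + (8 ℕ.* n ∸ 3)) ℤ.^ n) ∎
    where
    open ≡-Reasoning
    y = + 2 * + V - x
    cong₄ : ∀ {A B C D E : Set} (f : A → B → C → D → E) {a a′ b b′ c c′ d d′} →
            a ≡ a′ → b ≡ b′ → c ≡ c′ → d ≡ d′ → f a b c d ≡ f a′ b′ c′ d′
    cong₄ f refl refl refl refl = refl
    regroup : ∀ x v a b c → x * (a * b * c * (x - v)) ≡ x * (x - v) * a * b * c
    regroup = solve-∀
    shift₁ : + nA - y ≡ x - + (6 ℕ.* n ∸ 1)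
    shift₁ = trans (cong₂ (λ a v → a - (+ 2 * v - x)) nA≡ V≡) (trans (solve (+ t) x) (cong (_-_ x) (sym 6n∸1)))
      where
      solve : ∀ t x → + 3 + (t + t) - (+ 2 * (+ 7 + + 4 * t) - x) ≡ x - (+ 11 + + 6 * t)
      solve = solve-∀
    shift₃ : + 3 - y ≡ x - + (8 ℕ.* n ∸ 5)
    shift₃ = trans (cong (λ v → + 3 - (+ 2 * v - x)) V≡) (trans (solve (+ t) x) (cong (_-_ x) (sym 8n∸5)))
      where
      solve : ∀ t x → + 3 - (+ 2 * (+ 7 + + 4 * t) - x) ≡ x - (+ 11 + + 8 * t)
      solve = solve-∀
    shift₀ : + 1 - y ≡ x - + (8 ℕ.* n ∸ 3)
    shift₀ = trans (cong (λ v → + 1 - (+ 2 * v - x)) V≡) (trans (solve (+ t) x) (cong (_-_ x) (sym 8n∸3)))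
      where
      solve : ∀ t x → + 1 - (+ 2 * (+ 7 + + 4 * t) - x) ≡ x - (+ 13 + + 8 * t)
      solve = solve-∀
    shiftᵥ : + V - y ≡ x - + V
    shiftᵥ = solve (+ V) x
      where
      solve : ∀ v x → v - (+ 2 * v - x) ≡ x - v
      solve = solve-∀

2≤2^k : ∀ {k} → 1 ≤ k → 2 ≤ 2 ^ k
2≤2^k {suc k} _ = ℕₚ.*-monoʳ-≤ 2 (ℕₚ.m^n>0 2 k)

theorem3p5 : (k : ℕ) → 1 ≤ k → (x : ℤ) →
    let n = 2 ^ k
        open Quaternion n
        s = (- (+ 1)) ℤ.^ (4 ℕ.* n ∸ 1)
    in (det V (subScalar V DL x)
          ≡ s * (x * (x - + (4 ℕ.* n ∸ 1)) * (x - + (6 ℕ.* n ∸ 1)) ℤ.^ (2 ℕ.* n ∸ 3)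
                 * (x - + (8 ℕ.* n ∸ 5)) ℤ.^ n * (x - + (8 ℕ.* n ∸ 3)) ℤ.^ n))
     × (det V (subScalar V L x)
          ≡ s * (x * (x - + 3) ℤ.^ n * (x - + 1) ℤ.^ n * (x - + (4 ℕ.* n ∸ 1))
                 * (x - + (2 ℕ.* n ∸ 1)) ℤ.^ (2 ℕ.* n ∸ 3)))
theorem3p5 k 1≤k x with 2 ^ k in 2^k≡n | 2≤2^k 1≤k
... | suc (suc t) | _ = distanceLaplacianCharPoly x , laplacianCharPoly x
  where open CharacteristicPolynomials t k 2^k≡n
... | 1 | s≤s ()
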